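{- Fix any integer $d\geq 3$, any prime power $q$, and a set $S\subseteq [d-1]$ with $|S|\geq 2$. Let $s$ be any face of the projected flags complex $\mathcal{B}^{d,S}_q$ of co-dimension at least $2$ (i.e. $|S|-|s|\geq 2$). Then the second largest eigenvalue of the normalized adjacency operator of the underlying graph of the link of $s$ in $\mathcal{B}^{d,S}_q$ is at most $\frac{2}{(|S|-|s|-1)(\sqrt{q}-1)}$. In particular, $\mathcal{B}^{d,S}_q$ is a $\frac{2}{\sqrt{q}-1}$-(one-sided) local spectral expander. Moreover, $\mathcal{B}^{d,S}_q$ is a $\frac{1}{\sqrt{q}}$-product.
   Context: For a prime power $q$, integer $d$, and $S=\{s_1<\dots<s_k\}\subseteq[d-1]$, the projected flags complex $\mathcal{B}^{d,S}_q$ is the $k$-partite simplicial complex whose vertices are the subspaces $W\subseteq\mathbb{F}_q^d$ with $\dim W\in S$ (the color of a vertex is its dimension), and whose top faces are the chains $W_1\subset W_2\subset\cdots\subset W_k$ with $\dim W_i=s_i$; faces are all subsets of top faces. The complex is weighted by the uniform distribution on top faces; the distribution on $i$-faces is obtained by sampling a top face and a uniformly random subset of size $i+1$. The link of a face $s$ is $X_s=\{t\setminus s: t\in X, t\supseteq s\}$ with the induced (conditional) distribution; its underlying graph has vertices $X_s(0)$, edges $X_s(1)$, edge weights from this distribution, and normalized adjacency operator $\mathsf{A}f(v)=\frac{1}{2\pi_0(v)}\sum_{u\sim v}\pi_1(uv)f(u)$, where $\pi_0$ is the induced vertex distribution. A $D$-dimensional complex $X$ is a $\lambda$-(one-sided)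 local spectral expander if for every face $s$ of dimension at most $D-2$ (including the empty face) the second largest eigenvalue of the underlying graph of $X_s$ is at most $\lambda$. A partite complex $X$ is a $\lambda$-product if for every face $\tau$ of co-dimension at least $2$ and every two colors $i\neq j$ not in the colors of $\tau$, the bipartite graph induced on vertices of colors $i,j$ in $X_\tau$ has second largest eigenvalue at most $\lambda$. -}

module Defs where

open import Level using (Level; _⊔_; 0ℓ) renaming (suc to lsuc)
open import Algebra.Bundles using (CommutativeRing; Semiring)
open import Algebra.Core using (Op₁; Op₂)
open import Algebra.Structures using (IsCommutativeRing)
import Algebra.Definitions.RawSemiring as RawSemiringDefs
open import Data.Fin.Base using (Fin; zero; suc; toℕ; funToFin)
import Data.Fin.Base as Fin
import Data.Fin.Properties as Fin
open import Data.Fin.Subset using (Subset; inside; outside; _∈_; _⊆_; _⊂_; _∪_; _∩_; ⁅_⁆; ∣_∣; Empty)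
open import Data.Fin.Subset.Properties using (_∈?_; _⊆?_; _⊂?_; anySubset?; nonempty?)
open import Data.List.Base as List using (List; []; _∷_; _++_; length; filter; allFin; cartesianProduct)
open import Data.Nat.Base as ℕ using (ℕ; zero; suc; _∸_)
open import Data.Nat.Combinatorics using (_C_)
open import Data.Product using (∃; ∃!; _×_; _,_; proj₁; proj₂)
open import Data.Sum.Base using (_⊎_)
open import Data.Vec.Base as Vec using (Vec; []; _∷_; lookup; replicate; zipWith)
open import Data.Vec.Functional using (Vector)
open import Data.Vec.Relation.Unary.All using (All; all?)
import Data.Vec.Properties as Vec
open import Relation.Binary.Core using (Rel)
open import Relation.Binary.Definitions using () renaming (Decidable to Decidable₂)
open import Relation.Binary.PropositionalEquality.Core using (_≡_; _≢_)
open import Relation.Binary.Structures using (IsDecTotalOrder)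
open import Relation.Nullary.Decidable.Core
  using (Dec; yes; no; does; map′; ¬?; _×-dec_; _⊎-dec_; _→-dec_; decidable-stable)
open import Relation.Nullary.Negation.Core using (¬_)
open import Relation.Unary using (Pred; Decidable)
open import Data.Bool.Base using (if_then_else_)

record IsField {c ℓ} {A : Set c} (_≈_ : Rel A ℓ) (_+_ _*_ : Op₂ A)
               (-_ _⁻¹ : Op₁ A) (0# 1# : A) : Set (c ⊔ ℓ) where
  field
    isCommutativeRing : IsCommutativeRing _≈_ _+_ _*_ -_ 0# 1#
    1≉0               : ¬ (1# ≈ 0#)
    ⁻¹-cong           : ∀ {x y} → x ≈ y → (x ⁻¹) ≈ (y ⁻¹)
    -- The value of 0# ⁻¹ is unspecified.
    *-inverseʳ        : ∀ x → ¬ (x ≈ 0#) → (x * (x ⁻¹)) ≈ 1#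

-- A field with q elements.  Such a field is unique up to isomorphism, so
-- quantifying over these structures is quantifying over models of 𝔽_q.
record FiniteField (q : ℕ) : Set where
  field
    _+_ _*_ : Op₂ (Fin q)
    -_ _⁻¹  : Op₁ (Fin q)
    0# 1#   : Fin q
    isField : IsField _≡_ _+_ _*_ -_ _⁻¹ 0# 1#

-- The library has no real numbers.  All numbers below live in an arbitrary
-- real closed field; ℝ is one, and all real closed fields satisfy the same
-- first-order sentences.  Real-closedness guarantees that self-adjoint
-- matrices have a full basis of eigenvectors.
record RealClosedField c ℓ₁ ℓ₂ : Set (lsuc (c ⊔ ℓ₁ ⊔ ℓ₂)) where
  infix  8 _⁻¹ √_ -_
  infixl 7 _*_ _/_
  infixl 6 _+_
  infix  4 _≈_ _≤_
  field
    Carrier : Set c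
    _≈_     : Rel Carrier ℓ₁
    _+_ _*_ : Op₂ Carrier
    -_ _⁻¹  : Op₁ Carrier
    0# 1#   : Carrier
    isField : IsField _≈_ _+_ _*_ -_ _⁻¹ 0# 1#

  commutativeRing : CommutativeRing c ℓ₁
  commutativeRing = record { isCommutativeRing = IsField.isCommutativeRing isField }

  open CommutativeRing commutativeRing public using (semiring; _-_)
  open RawSemiringDefs (Semiring.rawSemiring semiring) public
    using (sum; _^_) renaming (_×_ to _·_)

  field
    _≤_             : Rel Carrier ℓ₂
    √_              : Op₁ Carrier
    isDecTotalOrder : IsDecTotalOrder _≈_ _≤_
    +-monoˡ-≤       : ∀ z {x y} → x ≤ y → x + z ≤ y + z
    *-nonneg        : ∀ {x y} → 0# ≤ x → 0# ≤ y → 0# ≤ x * y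
    -- The value of √ x is unspecified for x < 0.
    √-nonneg        : ∀ {x} → 0# ≤ x → 0# ≤ √ x
    √-square        : ∀ {x} → 0# ≤ x → √ x * √ x ≈ x
    -- Every monic polynomial x²ᵐ⁺¹ + a₂ₘ x²ᵐ + … + a₀ has a root.
    odd-root : ∀ m (a : Vector Carrier (suc (2 ℕ.* m))) →
               ∃ λ x → x ^ suc (2 ℕ.* m) + sum (λ i → a i * x ^ toℕ i) ≈ 0#

  _/_ : Op₂ Carrier
  x / y = x * y ⁻¹

  fromℕ : ℕ → Carrier
  fromℕ n = n · 1#

subsets : ∀ n → List (Subset n)
subsets zero    = [] ∷ []
subsets (suc n) = List.map (outside ∷_) (subsets n) ++ List.map (inside ∷_) (subsets n)

Searchable : Set → Set₁
Searchable A = ∀ {P : Pred A 0ℓ} → Decidable P → Dec (∃ P)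

search-Vec : ∀ {A} → Searchable A → ∀ n → Searchable (Vec A n)
search-Vec any zero    P? = map′ ([] ,_) (λ { ([] , p) → p }) (P? [])
search-Vec any (suc n) P? =
  map′ (λ { (x , xs , p) → x ∷ xs , p }) (λ { (x ∷ xs , p) → x , xs , p })
       (any (λ x → search-Vec any n (λ xs → P? (x ∷ xs))))

search-all : ∀ {A} → Searchable A → {P : Pred A 0ℓ} → Decidable P → Dec (∀ x → P x)
search-all any P? with any (λ x → ¬? (P? x))
... | yes (x , ¬p) = no (λ p → ¬p (p x))
... | no ∄¬p       = yes (λ x → decidable-stable (P? x) (λ ¬p → ∄¬p (x , ¬p)))

-- Only the top faces are recorded, and they carry the uniform distribution.
record Complex (N : ℕ) : Set₁ where
  field
    Top  : Pred (Subset N) 0ℓ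
    Top? : Decidable Top

  Face : Pred (Subset N) 0ℓ
  Face t = ∃ λ T → Top T × t ⊆ T

  Face? : Decidable Face
  Face? t = anySubset? (λ T → Top? T ×-dec t ⊆? T)

  Edge : Rel (Fin N) 0ℓ
  Edge u v = u ≢ v × Face (⁅ u ⁆ ∪ ⁅ v ⁆)

  Edge? : Decidable₂ Edge
  Edge? u v = ¬? (u Fin.≟ v) ×-dec Face? (⁅ u ⁆ ∪ ⁅ v ⁆)

  tops : List (Subset N)
  tops = filter Top? (subsets N)

-- The top faces are T ∖ s for the top faces T ⊇ s, so the faces are t ∖ s for
-- the faces t ⊇ s.  Conditioning the uniform distribution on T ⊇ s gives the
-- uniform distribution on the top faces of the link.
link : ∀ {N} → Complex N → Subset N → Complex N
link X s = record
  { Top  = λ T → Empty (T ∩ s) × Top (T ∪ s)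
  ; Top? = λ T → ¬? (nonempty? (T ∩ s)) ×-dec Top? (T ∪ s)
  } where open Complex X

record PartiteComplex (N k : ℕ) : Set₁ where
  field
    complex : Complex N
    color   : Fin N → Fin k
  open Complex complex public
  field
    partite : ∀ {T} → Top T → ∀ c → ∃! _≡_ (λ v → v ∈ T × color v ≡ c)

module Spectral {c ℓ₁ ℓ₂} (K : RealClosedField c ℓ₁ ℓ₂) where
  open RealClosedField K

  Matrix : ℕ → Set c
  Matrix n = Fin n → Fin n → Carrier

  -- The eigenvalues of M with multiplicity, in decreasing order; n linearly
  -- independent vectors form a basis of the n-dimensional space.
  record Spectrum {n} (M : Matrix n) : Set (c ⊔ ℓ₁ ⊔ ℓ₂) where
    field
      eigenvalue  : Fin n → Carrier
      eigenvector : Fin n → Vector Carrier n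
      isEigen     : ∀ i v → sum (λ u → M v u * eigenvector i u) ≈ eigenvalue i * eigenvector i v
      independent : ∀ (a : Vector Carrier n) →
                    (∀ v → sum (λ i → a i * eigenvector i v) ≈ 0#) → ∀ i → a i ≈ 0#
      decreasing  : ∀ {i j} → i Fin.≤ j → eigenvalue j ≤ eigenvalue i

  IsSecondLargestEigenvalue : ∀ {n} → Matrix n → Carrier → Set (c ⊔ ℓ₁ ⊔ ℓ₂)
  IsSecondLargestEigenvalue M μ =
    ∃ λ (Λ : Spectrum M) → ∃ λ i → toℕ i ≡ 1 × μ ≈ Spectrum.eigenvalue Λ i

  record WeightedGraph (N : ℕ) : Set (lsuc 0ℓ ⊔ c) where
    field
      Vertex  : Pred (Fin N) 0ℓ
      Vertex? : Decidable Vertex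
      -- Edge weights, 0# on non-edges.  They need not be normalised to total
      -- mass 1, since the adjacency operator is invariant under scaling.
      weight  : Fin N → Fin N → Carrier

    vertices : List (Fin N)
    vertices = filter Vertex? (allFin N)

    order : ℕ
    order = length vertices

    π₁ : Fin order → Fin order → Carrier
    π₁ u v = weight (List.lookup vertices u) (List.lookup vertices v)

    -- The law of a uniformly random endpoint of a random edge.
    π₀ : Fin order → Carrier
    π₀ v = sum (λ u → π₁ u v) / fromℕ 2

    adjacency : Matrix order
    adjacency v u = π₁ u v / (fromℕ 2 * π₀ v)

  SecondLargestEigenvalue≤ : ∀ {N} → WeightedGraph N → Carrier → Set (c ⊔ ℓ₁ ⊔ ℓ₂)
  SecondLargestEigenvalue≤ G b =
    ∀ μ → IsSecondLargestEigenvalue (WeightedGraph.adjacency G) μ → μ ≤ b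

  -- The probability that t is the outcome of sampling a uniform top face T and
  -- then a uniform subset of T of size ∣ t ∣.
  prob : ∀ {N} → Complex N → Subset N → Carrier
  prob X t = List.foldr _+_ 0# (List.map weightIn tops) / fromℕ (length tops)
    where
    open Complex X
    weightIn : Subset _ → Carrier
    weightIn T = if does (t ⊆? T) then fromℕ (∣ T ∣ C ∣ t ∣) ⁻¹ else 0#

  underlyingGraph : ∀ {N} → Complex N → WeightedGraph N
  underlyingGraph X = record
    { Vertex  = λ v → Face ⁅ v ⁆
    ; Vertex? = λ v → Face? ⁅ v ⁆
    ; weight  = λ u v → if does (Edge? u v) then prob X (⁅ u ⁆ ∪ ⁅ v ⁆) else 0#
    } where open Complex X

  inducedSubgraph : ∀ {N} → WeightedGraph N → {P : Pred (Fin N) 0ℓ} → Decidable P → WeightedGraph N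
  inducedSubgraph G {P} P? = record
    { Vertex  = λ v → Vertex v × P v
    ; Vertex? = λ v → Vertex? v ×-dec P? v
    ; weight  = weight
    } where open WeightedGraph G

  module _ {N k} (X : PartiteComplex N k) where
    open PartiteComplex X

    linkGraph : Subset N → WeightedGraph N
    linkGraph s = underlyingGraph (link complex s)

    -- Bipartite for i ≢ j, as no edge joins two vertices of the same color.
    bipartiteLinkGraph : Subset N → Fin k → Fin k → WeightedGraph N
    bipartiteLinkGraph τ i j =
      inducedSubgraph (linkGraph τ) (λ v → color v Fin.≟ i ⊎-dec color v Fin.≟ j)

    -- X has dimension k - 1 and s has dimension ∣ s ∣ - 1, so dim s ≤ dim X - 2
    -- amounts to 2 ≤ k ∸ ∣ s ∣.
    IsLocalSpectralExpander : Carrier → Set (c ⊔ ℓ₁ ⊔ ℓ₂)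
    IsLocalSpectralExpander b =
      ∀ s → Face s → 2 ℕ.≤ k ∸ ∣ s ∣ → SecondLargestEigenvalue≤ (linkGraph s) b

    IsProduct : Carrier → Set (c ⊔ ℓ₁ ⊔ ℓ₂)
    IsProduct b =
      ∀ τ → Face τ → 2 ℕ.≤ k ∸ ∣ τ ∣ →
      ∀ i j → i ≢ j → (∀ v → v ∈ τ → color v ≢ i × color v ≢ j) →
      SecondLargestEigenvalue≤ (bipartiteLinkGraph τ i j) b

module Subspaces {q} (F : FiniteField q) (d : ℕ) where
  open FiniteField F

  Vect : Set
  Vect = Vec (Fin q) d

  0ᵛ : Vect
  0ᵛ = replicate d 0#

  infixl 6 _+ᵛ_
  _+ᵛ_ : Op₂ Vect
  _+ᵛ_ = zipWith _+_

  infixr 7 _*ᵛ_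
  _*ᵛ_ : Fin q → Vect → Vect
  a *ᵛ v = Vec.map (a *_) v

  combination : ∀ {m} → Vec (Fin q) m → Vec Vect m → Vect
  combination a b = Vec.foldr′ _+ᵛ_ 0ᵛ (zipWith _*ᵛ_ a b)

  -- A subset of 𝔽_q^d is a subset of Fin (q ^ d) via funToFin, the library's
  -- bijection from functions Fin d → Fin q to Fin (q ^ d).
  VectSet : Set
  VectSet = Subset (q ℕ.^ d)

  infix 4 _∈ᵛ_
  _∈ᵛ_ : Vect → VectSet → Set
  v ∈ᵛ W = funToFin (lookup v) ∈ W

  IsSubspace : VectSet → Set
  IsSubspace W = 0ᵛ ∈ᵛ W
               × (∀ u v → u ∈ᵛ W → v ∈ᵛ W → u +ᵛ v ∈ᵛ W)
               × (∀ a v → v ∈ᵛ W → a *ᵛ v ∈ᵛ W)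

  IsBasis : ∀ {m} → VectSet → Vec Vect m → Set
  IsBasis {m} W b = All (_∈ᵛ W) b
                  × (∀ a → combination a b ≡ 0ᵛ → a ≡ replicate m 0#)
                  × (∀ v → v ∈ᵛ W → ∃ λ a → v ≡ combination a b)

  HasDim : VectSet → ℕ → Set
  HasDim W m = ∃ λ (b : Vec Vect m) → IsBasis W b

  private
    any-scalars : ∀ m → Searchable (Vec (Fin q) m)
    any-scalars = search-Vec Fin.any?

    _∈ᵛ?_ : ∀ v W → Dec (v ∈ᵛ W)
    v ∈ᵛ? W = funToFin (lookup v) ∈? W

    _≟_ : ∀ {m} → Decidable₂ {A = Vec (Fin q) m} _≡_
    _≟_ = Vec.≡-dec Fin._≟_

  IsSubspace? : Decidable IsSubspace
  IsSubspace? W =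
    0ᵛ ∈ᵛ? W
    ×-dec search-all (any-scalars d) (λ u → search-all (any-scalars d) (λ v →
            u ∈ᵛ? W →-dec (v ∈ᵛ? W →-dec (u +ᵛ v) ∈ᵛ? W)))
    ×-dec Fin.all? (λ a → search-all (any-scalars d) (λ v →
            v ∈ᵛ? W →-dec (a *ᵛ v) ∈ᵛ? W))

  HasDim? : ∀ W m → Dec (HasDim W m)
  HasDim? W m = search-Vec (any-scalars d) m (λ b →
    all? (_∈ᵛ? W) b
    ×-dec search-all (any-scalars m) (λ a → combination a b ≟ 0ᵛ →-dec a ≟ replicate m 0#)
    ×-dec search-all (any-scalars d) (λ v →
            v ∈ᵛ? W →-dec any-scalars m (λ a → v ≟ combination a b)))

-- S = {s₁ < … < s_k} is given by the sequence s; a vertex is a pair of a color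
-- c : Fin k and a subspace of dimension s c.
module ProjectedFlags {q} (F : FiniteField q) (d : ℕ) {k} (s : Fin k → ℕ) where
  open Subspaces F d

  IsVertex : Pred (Fin k × VectSet) 0ℓ
  IsVertex (c , W) = IsSubspace W × HasDim W (s c)

  IsVertex? : Decidable IsVertex
  IsVertex? (c , W) = IsSubspace? W ×-dec HasDim? W (s c)

  vertexList : List (Fin k × VectSet)
  vertexList = filter IsVertex? (cartesianProduct (allFin k) (subsets (q ℕ.^ d)))

  size : ℕ
  size = length vertexList

  color : Fin size → Fin k
  color v = proj₁ (List.lookup vertexList v)

  space : Fin size → VectSet
  space v = proj₂ (List.lookup vertexList v)

  -- T consists of exactly one subspace of each dimension sᵢ, and these form a
  -- strictly increasing chain.
  IsFlag : Pred (Subset size) 0ℓ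
  IsFlag T = (∀ c → ∃! _≡_ (λ v → v ∈ T × color v ≡ c))
           × (∀ u v → u ∈ T → v ∈ T → color u Fin.< color v → space u ⊂ space v)

  IsFlag? : Decidable IsFlag
  IsFlag? T =
    Fin.all? (λ c → Fin.any? (λ v →
      (v ∈? T ×-dec color v Fin.≟ c)
      ×-dec map′ (λ f {y} → f y) (λ f y → f {y})
              (Fin.all? (λ y → (y ∈? T ×-dec color y Fin.≟ c) →-dec v Fin.≟ y))))
    ×-dec Fin.all? (λ u → Fin.all? (λ v →
      u ∈? T →-dec (v ∈? T →-dec (color u Fin.<? color v →-dec space u ⊂? space v))))

  projectedFlags : PartiteComplex size k
  projectedFlags = record
    { complex = record { Top = IsFlag ; Top? = IsFlag? }
    ; color   = color
    ; partite = proj₁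
    }

{-# OPTIONS --safe #-}
module Submission where

-- Let ν u v be the number of top faces of a link through its vertices u and v.
-- An eigenvector f for the second eigenvalue λ can be taken orthogonal to the
-- constants.  Averaging f over the vertices of a fixed color gives an
-- eigenvector of the complete graph on the m colors, so if λ > 0 then the
-- restriction of f to each color has mean zero.  It remains to bound the sum of
-- ν u v · f u · f v over the vertices u, v of two colors i < j.  If the face has
-- a subspace whose dimension lies between, u and v are independent and the sum
-- is 0.  Otherwise counting flags turns it into a sum over the inclusions u ⊂ v
-- between two levels of an interval [A , B] of subspaces.  For one step up and
-- down from a level at height x and depth y of the interval,
-- up* up − down* down = [y] − [x], with [n] = 1 + q + … + q^(n−1); induction on
-- the level gives ‖up f‖² ≤ ([x] [y] − [x]) ‖f‖² for f of mean zero, which after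
-- normalisation is at most 1/q.  Iterating, colors at distance r contribute at
-- most q^(−r/2), and the sum of these over the colors is at most 2 / (√q − 1).

open import Defs
open import Level using (0ℓ; _⊔_)
open import Algebra.Bundles using (CommutativeRing; CommutativeSemigroup; CommutativeSemiring)
open import Algebra.Core using (Op₂)
open import Algebra.Module.Structures using (IsLeftSemimodule)
open import Data.Fin.Base as Fin using (Fin; zero; suc)
import Data.Fin.Properties as Fin
open import Data.List.Base as List using (List; []; _∷_; allFin)
import Data.List.Membership.Propositional as List
open import Data.List.Membership.Propositional.Properties using (∈-allFin; ∈-lookup; ∈-filter⁺; ∈-filter⁻)
open import Data.List.Relation.Unary.AllPairs using ([]; _∷_)
open import Data.List.Relation.Unary.Any using (here; there)
open import Data.List.Relation.Unary.Unique.Propositional using (Unique)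
open import Data.List.Relation.Unary.Unique.Propositional.Properties using (allFin⁺; filter⁺)
open import Data.Nat.Base as ℕ using (ℕ; zero; suc)
import Data.Nat.Properties as ℕ
open import Data.Product.Base using (∃; _×_; _,_; proj₁; proj₂)
open import Data.Sum.Base using (_⊎_; inj₁; inj₂)
open import Function.Base using (_∘_)
open import Relation.Binary.Definitions using (tri<; tri≈; tri>)
open import Relation.Binary.PropositionalEquality.Core as ≡ using (_≡_; _≢_)
open import Relation.Nullary.Decidable.Core
  using (Dec; yes; no; does; ¬?; _×-dec_; _⊎-dec_; _→-dec_; map′; decidable-stable)
open import Relation.Nullary.Negation.Core using (¬_; contradiction)
open import Relation.Unary using (Pred; Decidable)

-- The shape of the constant: a random neighbour of v lies in each of the m - 1 other colors with
-- equal probability, hence the divisor m - 1. Ranks are distinct integers, so colors r places apart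
-- have ranks at least r apart; summing powers of q^(-1/2) on both sides of a color gives at most 2
-- (q^(-1/2) + q^(-1) + ...) = 2 / (√q - 1).
--
-- The inclusion operators are never diagonalised. A bound for `up` passes to its adjoint `down` by
-- Cauchy-Schwarz from ‖down f‖² = ⟨f , up (down f)⟩, and the identity relating up* up to down* down
-- passes it on to the next level.
--
-- Two colors carry different vertex weights. Their cross term is therefore bounded by a multiple of
-- the sum of the two energies, not by a product of norms: such bounds can be added over all pairs,
-- and the row sums of the multipliers bound the whole form.
--
-- Colors average to zero because an average a of a vector orthogonal to the constants satisfies (1
-- + λ (m - 1)) a = 0, where the factor is positive as soon as λ ≥ 0. For λ ≤ 0 the bound is
-- immediate.

module IntegerCoefficientSolver {c ℓ} (R : CommutativeRing c ℓ) where
  open CommutativeRing R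
  open import Algebra.Properties.Ring ring
    using (-‿distribˡ-*; -‿distribʳ-*; -0#≈0#; -‿involutive; -‿+-comm)
  open import Algebra.Properties.Semiring.Mult.TCOptimised semiring
    using (×-homo-+; ×1-homo-*; 1+×) renaming (_×_ to _·_)
  open import Algebra.Solver.Ring.AlmostCommutativeRing
  open import Data.Integer.Base as ℤ using (ℤ; +_; -[1+_]; _⊖_)
  import Data.Integer.Properties as ℤ
  open import Data.Maybe.Base using (Maybe; map)
  import Data.Nat.Properties as ℕ
  open import Relation.Binary.Consequences using (dec⇒weaklyDec)
  open import Relation.Binary.Reasoning.Setoid setoid

  -- The optimised multiples make `1 · 1#` reduce to `1#`, so that `κ 1` in a polynomial matches a
  -- literal `1#` by `refl`.
  fromℤ : ℤ → Carrier
  fromℤ (+ n)    = n · 1#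
  fromℤ -[1+ n ] = - (suc n · 1#)

  private
    fromℤ-⊖ : ∀ m n → fromℤ (m ⊖ n) ≈ m · 1# - n · 1#
    fromℤ-⊖ m zero = sym (trans (+-congˡ -0#≈0#) (+-identityʳ _))
    fromℤ-⊖ zero (suc n) = sym (+-identityˡ _)
    fromℤ-⊖ (suc m) (suc n) = begin
      fromℤ (suc m ⊖ suc n)                      ≡⟨ ≡.cong fromℤ (ℤ.[1+m]⊖[1+n]≡m⊖n m n) ⟩
      fromℤ (m ⊖ n)                              ≈⟨ fromℤ-⊖ m n ⟩
      m · 1# - n · 1#                            ≈⟨ +-congʳ (sym (+-identityʳ _)) ⟩
      m · 1# + 0# - n · 1#                       ≈⟨ +-congʳ (+-congˡ (sym (-‿inverseʳ 1#))) ⟩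
      m · 1# + (1# - 1#) - n · 1#                ≈⟨ +-congʳ (sym (+-assoc _ _ _)) ⟩
      m · 1# + 1# - 1# - n · 1#                  ≈⟨ +-assoc _ _ _ ⟩
      m · 1# + 1# + (- 1# - n · 1#)              ≈⟨ +-cong (+-comm _ _) (-‿+-comm _ _) ⟩
      1# + m · 1# - (1# + n · 1#)                ≈⟨ +-cong (1+× m 1#) (-‿cong (1+× n 1#)) ⟨
      suc m · 1# - suc n · 1#                    ∎

    fromℤ-+ : ∀ i j → fromℤ (i ℤ.+ j) ≈ fromℤ i + fromℤ j
    fromℤ-+ (+ m) (+ n) = ×-homo-+ 1# m n
    fromℤ-+ (+ m) -[1+ n ] = fromℤ-⊖ m (suc n)
    fromℤ-+ -[1+ m ] (+ n) = trans (fromℤ-⊖ n (suc m)) (+-comm _ _)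
    fromℤ-+ -[1+ m ] -[1+ n ] = begin
      - (suc (suc (m ℕ.+ n)) · 1#)       ≡⟨ ≡.cong (λ h → - (h · 1#)) (≡.sym (≡.cong suc (ℕ.+-suc m n))) ⟩
      - ((suc m ℕ.+ suc n) · 1#)         ≈⟨ -‿cong (×-homo-+ 1# (suc m) (suc n)) ⟩
      - (suc m · 1# + suc n · 1#)        ≈⟨ -‿+-comm _ _ ⟨
      - (suc m · 1#) - suc n · 1#        ∎

    fromℤ-neg : ∀ i → fromℤ (ℤ.- i) ≈ - fromℤ i
    fromℤ-neg (+ zero)   = sym -0#≈0#
    fromℤ-neg (+ suc n)  = refl
    fromℤ-neg -[1+ n ]   = sym (-‿involutive _)

    fromℤ-* : ∀ i j → fromℤ (i ℤ.* j) ≈ fromℤ i * fromℤ j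
    fromℤ-* (+ m) (+ n) =
      trans (reflexive (≡.cong fromℤ (≡.sym (ℤ.pos-* m n)))) (×1-homo-* m n)
    fromℤ-* (+ m) -[1+ n ] = begin
      fromℤ (+ m ℤ.* -[1+ n ])           ≡⟨ ≡.cong fromℤ (ℤ.neg-distribʳ-* (+ m) (+ suc n)) ⟨
      fromℤ (ℤ.- (+ m ℤ.* + suc n))      ≈⟨ fromℤ-neg (+ m ℤ.* + suc n) ⟩
      - fromℤ (+ m ℤ.* + suc n)          ≈⟨ -‿cong (fromℤ-* (+ m) (+ suc n)) ⟩
      - (m · 1# * (suc n · 1#))          ≈⟨ -‿distribʳ-* _ _ ⟩
      m · 1# * - (suc n · 1#)            ∎
    fromℤ-* -[1+ m ] (+ n) = begin
      fromℤ (-[1+ m ] ℤ.* + n)           ≡⟨ ≡.cong fromℤ (ℤ.neg-distribˡ-* (+ suc m) (+ n)) ⟨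
      fromℤ (ℤ.- (+ suc m ℤ.* + n))      ≈⟨ fromℤ-neg (+ suc m ℤ.* + n) ⟩
      - fromℤ (+ suc m ℤ.* + n)          ≈⟨ -‿cong (fromℤ-* (+ suc m) (+ n)) ⟩
      - (suc m · 1# * (n · 1#))          ≈⟨ -‿distribˡ-* _ _ ⟩
      - (suc m · 1#) * (n · 1#)          ∎
    fromℤ-* -[1+ m ] -[1+ n ] = begin
      (suc m ℕ.* suc n) · 1#             ≈⟨ ×1-homo-* (suc m) (suc n) ⟩
      suc m · 1# * (suc n · 1#)          ≈⟨ -‿involutive _ ⟨
      - - (suc m · 1# * (suc n · 1#))    ≈⟨ -‿cong (-‿distribˡ-* _ _) ⟩
      - (- (suc m · 1#) * (suc n · 1#))  ≈⟨ -‿distribʳ-* _ _ ⟩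
      - (suc m · 1#) * - (suc n · 1#)    ∎

    homomorphism : ℤ.+-*-rawRing -Raw-AlmostCommutative⟶ fromCommutativeRing R
    homomorphism = record
      { ⟦_⟧    = fromℤ
      ; +-homo = fromℤ-+
      ; *-homo = fromℤ-*
      ; -‿homo = fromℤ-neg
      ; 0-homo = refl
      ; 1-homo = refl
      }

    -- Integer coefficients are compared by computation, which the abstract ring does not offer;
    -- cancellations such as x - x rely on this.
    coefficient≟ : ∀ i j → Maybe (fromℤ i ≈ fromℤ j)
    coefficient≟ i j = map (λ i≡j → reflexive (≡.cong fromℤ i≡j)) (dec⇒weaklyDec ℤ._≟_ i j)

  open import Algebra.Solver.Ring ℤ.+-*-rawRing (fromCommutativeRing R) homomorphism coefficient≟ public
    using (solve; _:=_; _:+_; _:*_; _:-_; :-_; con; Polynomial)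

  κ : ∀ {n} → ℕ → Polynomial n
  κ n = con (+ n)

-- Finite sums over lists and indicator functions.

module Sums {c ℓ} (R : CommutativeSemiring c ℓ) where
  open CommutativeSemiring R
  open import Algebra.Definitions.RawMonoid +-rawMonoid using (sum)
  open import Data.Bool.Base using (if_then_else_)
  open import Data.List.Base using (_++_; map; foldr; filter; lookup; cartesianProduct)
  open import Data.List.Membership.Propositional using (_∈_)
  open import Data.List.Relation.Unary.All as All using (All; []; _∷_)
  open import Relation.Binary.Reasoning.Setoid setoid
  open import Algebra.Properties.CommutativeSemigroup +-commutativeSemigroup using (interchange)

  ∑ : ∀ {a} {A : Set a} → List A → (A → Carrier) → Carrier
  ∑ L f = foldr _+_ 0# (map f L)

  𝟙 : ∀ {p} {P : Set p} → Dec P → Carrier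
  𝟙 d = if does d then 1# else 0#

  module _ {a} {A : Set a} where

    ∑-cong : (L : List A) {f g : A → Carrier} → (∀ x → f x ≈ g x) → ∑ L f ≈ ∑ L g
    ∑-cong []      f≈g = refl
    ∑-cong (x ∷ L) f≈g = +-cong (f≈g x) (∑-cong L f≈g)

    ∑-0 : (L : List A) → ∑ L (λ _ → 0#) ≈ 0#
    ∑-0 []      = refl
    ∑-0 (x ∷ L) = trans (+-identityˡ _) (∑-0 L)

    ∑-zero : (L : List A) {f : A → Carrier} → (∀ x → f x ≈ 0#) → ∑ L f ≈ 0#
    ∑-zero L f≈0 = trans (∑-cong L f≈0) (∑-0 L)

    ∑-+ : (L : List A) (f g : A → Carrier) → ∑ L (λ x → f x + g x) ≈ ∑ L f + ∑ L g
    ∑-+ []      f g = sym (+-identityˡ _)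
    ∑-+ (x ∷ L) f g = trans (+-congˡ (∑-+ L f g)) (interchange _ _ _ _)

    *-∑ : (L : List A) (f : A → Carrier) (k : Carrier) → k * ∑ L f ≈ ∑ L (λ x → k * f x)
    *-∑ []      f k = zeroʳ k
    *-∑ (x ∷ L) f k = trans (distribˡ k _ _) (+-congˡ (*-∑ L f k))

    ∑-* : (L : List A) (f : A → Carrier) (k : Carrier) → ∑ L f * k ≈ ∑ L (λ x → f x * k)
    ∑-* []      f k = zeroˡ k
    ∑-* (x ∷ L) f k = trans (distribʳ k _ _) (+-congˡ (∑-* L f k))

    ∑-++ : (L M : List A) (f : A → Carrier) → ∑ (L ++ M) f ≈ ∑ L f + ∑ M f
    ∑-++ []      M f = sym (+-identityˡ _)
    ∑-++ (x ∷ L) M f = trans (+-congˡ (∑-++ L M f)) (sym (+-assoc _ _ _))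

    ∑-filter : ∀ {p} {P : Pred A p} (P? : Decidable P) (L : List A) (f : A → Carrier) →
               ∑ (filter P? L) f ≈ ∑ L (λ x → 𝟙 (P? x) * f x)
    ∑-filter P? []      f = refl
    ∑-filter P? (x ∷ L) f with P? x
    ... | yes _ = +-cong (sym (*-identityˡ _)) (∑-filter P? L f)
    ... | no  _ = trans (∑-filter P? L f) (trans (sym (+-identityˡ _)) (+-congʳ (sym (zeroˡ _))))

    ∑-sum : (L : List A) (f : A → Carrier) → sum (λ i → f (lookup L i)) ≈ ∑ L f
    ∑-sum []      f = refl
    ∑-sum (x ∷ L) f = +-congˡ (∑-sum L f)

  ∑-map : ∀ {a b} {A : Set a} {B : Set b} (h : A → B) (L : List A) (f : B → Carrier) →
          ∑ (map h L) f ≈ ∑ L (f ∘ h)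
  ∑-map h []      f = refl
  ∑-map h (x ∷ L) f = +-congˡ (∑-map h L f)

  ∑-comm : ∀ {a b} {A : Set a} {B : Set b} (L : List A) (M : List B) (f : A → B → Carrier) →
           ∑ L (λ x → ∑ M (f x)) ≈ ∑ M (λ y → ∑ L (λ x → f x y))
  ∑-comm []      M f = sym (∑-0 M)
  ∑-comm (x ∷ L) M f = trans (+-congˡ (∑-comm L M f)) (sym (∑-+ M _ _))

  ∑-cartesianProduct : ∀ {a b} {A : Set a} {B : Set b} (L : List A) (M : List B) (f : A × B → Carrier) →
                       ∑ (cartesianProduct L M) f ≈ ∑ L (λ x → ∑ M (λ y → f (x , y)))
  ∑-cartesianProduct []      M f = refl
  ∑-cartesianProduct (x ∷ L) M f =
    trans (∑-++ (map (x ,_) M) _ f) (+-cong (∑-map (x ,_) M f) (∑-cartesianProduct L M f))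

  module _ {p} {P : Set p} where

    𝟙-yes : (d : Dec P) → P → 𝟙 d ≈ 1#
    𝟙-yes (yes _) _ = refl
    𝟙-yes (no ¬p) p = contradiction p ¬p

    𝟙-no : (d : Dec P) → ¬ P → 𝟙 d ≈ 0#
    𝟙-no (yes p) ¬p = contradiction p ¬p
    𝟙-no (no _)  _  = refl

    𝟙-idem : (d : Dec P) → 𝟙 d * 𝟙 d ≈ 𝟙 d
    𝟙-idem (yes _) = *-identityˡ _
    𝟙-idem (no _)  = zeroˡ _

    𝟙*-yes : (d : Dec P) → P → ∀ x → 𝟙 d * x ≈ x
    𝟙*-yes d p x = trans (*-congʳ (𝟙-yes d p)) (*-identityˡ x)

    𝟙*-no : (d : Dec P) → ¬ P → ∀ x → 𝟙 d * x ≈ 0#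
    𝟙*-no d ¬p x = trans (*-congʳ (𝟙-no d ¬p)) (zeroˡ x)

    𝟙*-cong : (d : Dec P) {x y : Carrier} → (P → x ≈ y) → 𝟙 d * x ≈ 𝟙 d * y
    𝟙*-cong (yes p) x≈y = *-congˡ (x≈y p)
    𝟙*-cong (no _)  _   = trans (zeroˡ _) (sym (zeroˡ _))

    𝟙*-zero : (d : Dec P) {x : Carrier} → (P → x ≈ 0#) → 𝟙 d * x ≈ 0#
    𝟙*-zero d x≈0 = trans (𝟙*-cong d x≈0) (zeroʳ _)

    𝟙*-if : (d : Dec P) (x : Carrier) → (if does d then x else 0#) ≈ 𝟙 d * x
    𝟙*-if (yes _) x = sym (*-identityˡ x)
    𝟙*-if (no _)  x = sym (zeroˡ x)

  𝟙-cong : ∀ {p q} {P : Set p} {Q : Set q} (d : Dec P) (e : Dec Q) → (P → Q) → (Q → P) → 𝟙 d ≈ 𝟙 e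
  𝟙-cong (yes p) e f g = sym (𝟙-yes e (f p))
  𝟙-cong (no ¬p) e f g = sym (𝟙-no e (¬p ∘ g))

  𝟙-× : ∀ {p q} {P : Set p} {Q : Set q} (d : Dec P) (e : Dec Q) → 𝟙 (d ×-dec e) ≈ 𝟙 d * 𝟙 e
  𝟙-× (yes _) (yes _) = sym (*-identityˡ _)
  𝟙-× (yes _) (no _)  = sym (*-identityˡ _)
  𝟙-× (no _)  _       = sym (zeroˡ _)

  -- The form in which double counting regroups its conditions: a pair of constraints on (x , y) is
  -- factored again in the other order of summation.
  𝟙𝟙-cong : ∀ {p q r s} {P : Set p} {Q : Set q} {P′ : Set r} {Q′ : Set s}
            (d : Dec P) (e : Dec Q) (d′ : Dec P′) (e′ : Dec Q′) →
            (P × Q → P′ × Q′) → (P′ × Q′ → P × Q) → 𝟙 d * 𝟙 e ≈ 𝟙 d′ * 𝟙 e′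
  𝟙𝟙-cong d e d′ e′ f g =
    trans (sym (𝟙-× d e)) (trans (𝟙-cong (d ×-dec e) (d′ ×-dec e′) f g) (𝟙-× d′ e′))

  module _ {a} {A : Set a} where

    -- Used in both directions: to collapse a sum to its only term, and to introduce a redundant sum
    -- before `∑-comm` exchanges the order.
    ∑-unique : ∀ {q} {Q : Pred A q} (Q? : Decidable Q) {L : List A} → Unique L →
               (f : A → Carrier) {x : A} → x ∈ L → Q x → (∀ {y} → Q y → y ≡ x) →
               ∑ L (λ y → 𝟙 (Q? y) * f y) ≈ f x
    ∑-unique {Q = Q} Q? {z ∷ L} (z∉L ∷ uL) f {x} x∈L q only with x∈L
    ... | here ≡.refl = begin
      𝟙 (Q? x) * f x + ∑ L (λ y → 𝟙 (Q? y) * f y)  ≈⟨ +-cong (𝟙*-yes (Q? x) q (f x)) (tail L z∉L) ⟩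
      f x + 0#                                      ≈⟨ +-identityʳ _ ⟩
      f x                                           ∎
      where
      tail : ∀ M → All (λ y → ¬ x ≡ y) M → ∑ M (λ y → 𝟙 (Q? y) * f y) ≈ 0#
      tail []      []        = refl
      tail (y ∷ M) (x≢y ∷ ps) =
        trans (+-cong (𝟙*-no (Q? y) (λ Qy → x≢y (≡.sym (only Qy))) (f y)) (tail M ps)) (+-identityˡ _)
    ... | there x∈ = trans (+-cong (𝟙*-no (Q? z) (λ Qz → All.lookup z∉L x∈ (only Qz)) (f z))
                                   (∑-unique Q? uL f x∈ q only))
                           (+-identityˡ _)

    ∑-unique-1 : ∀ {q} {Q : Pred A q} (Q? : Decidable Q) {L : List A} → Unique L →
                 {x : A} → x ∈ L → Q x → (∀ {y} → Q y → y ≡ x) → ∑ L (λ y → 𝟙 (Q? y)) ≈ 1#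
    ∑-unique-1 Q? {L} uL x∈L q only =
      trans (∑-cong L (λ y → sym (*-identityʳ _))) (∑-unique Q? uL (λ _ → 1#) x∈L q only)

    ∑-none : ∀ {q} {Q : Pred A q} (Q? : Decidable Q) (L : List A) (f : A → Carrier) →
             (∀ {y} → ¬ Q y) → ∑ L (λ y → 𝟙 (Q? y) * f y) ≈ 0#
    ∑-none Q? L f none = ∑-zero L (λ y → 𝟙*-no (Q? y) none (f y))

  *-∑-*-∑ : ∀ {a b} {A : Set a} {B : Set b} (L : List A) (M : List B) (f : A → Carrier) (g : B → Carrier) →
            ∑ L f * ∑ M g ≈ ∑ L (λ x → ∑ M (λ y → f x * g y))
  *-∑-*-∑ L M f g = trans (∑-* L f _) (∑-cong L (λ x → *-∑ M g (f x)))

module ℕSums = Sums ℕ.+-*-commutativeSemiring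

-- Enumerating and counting subsets of a finite set.

module SubsetLemmas where
  open import Data.Fin.Subset using (Subset; inside; outside; _∈_; ∣_∣)
  open import Data.Fin.Subset.Properties using (_∈?_)
  open import Data.List.Membership.Propositional.Properties using (∈-++⁺ˡ; ∈-++⁺ʳ; ∈-map⁺; ∈-map⁻)
  open import Data.List.Relation.Unary.All using ([])
  open import Data.List.Relation.Unary.Unique.Propositional.Properties using (map⁺; ++⁺)
  import Data.List.Properties as List
  open import Data.Vec.Base using ([]; _∷_; tabulate)
  open import Data.Vec.Properties using (lookup∘tabulate; lookup⇒[]=; []=⇒lookup; ∷-injectiveʳ)
  open import Relation.Binary.PropositionalEquality
  open import Relation.Nullary.Decidable using (dec-true)
  open ℕSums using (∑; 𝟙; ∑-map; ∑-cong)

  ∑-length : ∀ {a} {A : Set a} (L : List A) → ∑ L (λ _ → 1) ≡ List.length L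
  ∑-length List.[]      = refl
  ∑-length (x List.∷ L) = cong suc (∑-length L)

  subsets-unique : ∀ n → Unique (subsets n)
  subsets-unique zero    = [] ∷ []
  subsets-unique (suc n) =
    ++⁺ (map⁺ ∷-injectiveʳ (subsets-unique n)) (map⁺ ∷-injectiveʳ (subsets-unique n)) disjoint
    where
    disjoint : ∀ {T} → T List.∈ List.map (outside ∷_) (subsets n) × T List.∈ List.map (inside ∷_) (subsets n) → _
    disjoint (p , r) with ∈-map⁻ (outside ∷_) p | ∈-map⁻ (inside ∷_) r
    ... | _ , _ , refl | _ , _ , ()

  ∈-subsets : ∀ {n} (T : Subset n) → T List.∈ subsets n
  ∈-subsets []            = here refl
  ∈-subsets (outside ∷ T) = ∈-++⁺ˡ (∈-map⁺ (outside ∷_) (∈-subsets T))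
  ∈-subsets (inside ∷ T)  = ∈-++⁺ʳ _ (∈-map⁺ (inside ∷_) (∈-subsets T))

  fromDec : ∀ {n p} {P : Pred (Fin n) p} → Decidable P → Subset n
  fromDec P? = tabulate (does ∘ P?)

  module _ {n p} {P : Pred (Fin n) p} (P? : Decidable P) where

    ∈-fromDec⁺ : ∀ {i} → P i → i ∈ fromDec P?
    ∈-fromDec⁺ {i} p = lookup⇒[]= i _ (trans (lookup∘tabulate _ i) (dec-true (P? i) p))

    ∈-fromDec⁻ : ∀ {i} → i ∈ fromDec P? → P i
    ∈-fromDec⁻ {i} i∈ with P? i | trans (sym (lookup∘tabulate (does ∘ P?) i)) ([]=⇒lookup i∈)
    ... | yes p | _ = p
    ... | no _  | ()

  ∣∣-∑ : ∀ {n} (T : Subset n) → ∣ T ∣ ≡ ∑ (allFin n) (λ i → 𝟙 (i ∈? T))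
  ∣∣-∑ [] = refl
  ∣∣-∑ {suc n} (x ∷ T) = trans (head x) (cong (𝟙 (zero ∈? (x ∷ T)) ℕ.+_)
      (trans (sym (∑-map suc (allFin n) (λ i → 𝟙 (i ∈? (x ∷ T)))))
             (cong (λ L → ∑ L (λ i → 𝟙 (i ∈? (x ∷ T)))) (List.map-tabulate (λ i → i) suc))))
    where
    tail : ∣ T ∣ ≡ ∑ (allFin n) (λ i → 𝟙 (suc i ∈? (x ∷ T)))
    tail = trans (∣∣-∑ T) (∑-cong (allFin n) (λ i → refl))
    head : ∀ y → ∣ y ∷ T ∣ ≡ 𝟙 (zero ∈? (y ∷ T)) ℕ.+ ∑ (allFin n) (λ i → 𝟙 (suc i ∈? (x ∷ T)))
    head inside  = cong suc tail
    head outside = tail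

-- The q-analogues of the natural numbers.

module GaussianIntegers where
  open import Data.Nat.Base hiding (ℕ)
  open import Data.Nat.Properties
  open import Data.Nat.Solver using (module +-*-Solver)
  open import Relation.Binary.PropositionalEquality

  -- [ n ] = 1 + q + … + q ^ (n - 1)
  gaussian : ℕ → ℕ → ℕ
  gaussian q zero    = 0
  gaussian q (suc n) = suc (q * gaussian q n)

  -- With q = r + 1 this is q^(a+n) - q^a = [n] (q - 1) q^a, kept free of the truncated subtraction
  -- of ℕ. The left side will count the vectors of a space that lie outside a subspace.
  ^-gaussian : ∀ r a n → suc r ^ (a + n) ≡ suc r ^ a + gaussian (suc r) n * (r * suc r ^ a)
  ^-gaussian r a zero    = trans (cong (suc r ^_) (+-identityʳ a)) (sym (+-identityʳ _))
  ^-gaussian r a (suc n) = begin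
    suc r ^ (a + suc n)                                    ≡⟨ cong (suc r ^_) (+-suc a n) ⟩
    suc r * suc r ^ (a + n)                                ≡⟨ cong (suc r *_) (^-gaussian r a n) ⟩
    suc r * (suc r ^ a + g * (r * suc r ^ a))              ≡⟨ lemma r (suc r ^ a) g ⟩
    suc r ^ a + suc (suc r * g) * (r * suc r ^ a)          ∎
    where
    open ≡-Reasoning
    open +-*-Solver
    g = gaussian (suc r) n
    lemma : ∀ r x g → suc r * (x + g * (r * x)) ≡ x + suc (suc r * g) * (r * x)
    lemma = solve 3 (λ r x g → (con 1 :+ r) :* (x :+ g :* (r :* x)) :=
                               x :+ (con 1 :+ (con 1 :+ r) :* g) :* (r :* x)) refl

-- An abstract projective geometry.

module GeometryDefinition where
  open import Data.Nat.Base using (_+_; _≤_)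
  open import Relation.Binary.PropositionalEquality using (_≡_; _≢_)
  open ℕSums using (∑; 𝟙)
  open GaussianIntegers using (gaussian)

  -- The part of projective geometry that the spectral estimates use: a graded
  -- poset with the right number of covers.
  record Geometry (q d : ℕ) : Set₁ where
    infix 4 _⊑_ _⊑?_ _≟_
    field
      V               : Set
      elements        : List V
      elements-unique : Unique elements
      ∈-elements      : ∀ W → W List.∈ elements
      _≟_             : ∀ (W W′ : V) → Dec (W ≡ W′)
      _⊑_             : V → V → Set
      _⊑?_            : ∀ W W′ → Dec (W ⊑ W′)
      Level           : ℕ → V → Set
      Level?          : ∀ m W → Dec (Level m W)
      ⊑-refl          : ∀ {W} → W ⊑ W
      ⊑-trans         : ∀ {W W′ W″} → W ⊑ W′ → W′ ⊑ W″ → W ⊑ W″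
      Level-mono      : ∀ {a b A B} → Level a A → Level b B → A ⊑ B → a ≤ b
      Level-≡         : ∀ {a A B} → Level a A → Level a B → A ⊑ B → A ≡ B
      bottom top      : V
      bottom-Level    : Level 0 bottom
      bottom-⊑        : ∀ {m W} → Level m W → bottom ⊑ W
      top-Level       : Level d top
      ⊑-top           : ∀ {W} → W ⊑ top

    Interval : V → V → ℕ → V → Set
    Interval A B m W = Level m W × A ⊑ W × W ⊑ B

    Interval? : ∀ A B m W → Dec (Interval A B m W)
    Interval? A B m W = Level? m W ×-dec (A ⊑? W ×-dec W ⊑? B)

    JoinsIn : V → V → V → ℕ → V → Set
    JoinsIn B W W′ m Y = Level m Y × W ⊑ Y × W′ ⊑ Y × Y ⊑ B

    MeetsIn : V → V → V → ℕ → V → Set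
    MeetsIn A W W′ m X = Level m X × X ⊑ W × X ⊑ W′ × A ⊑ X

    JoinsIn? : ∀ B W W′ m Y → Dec (JoinsIn B W W′ m Y)
    JoinsIn? B W W′ m Y = Level? m Y ×-dec (W ⊑? Y ×-dec (W′ ⊑? Y ×-dec Y ⊑? B))

    MeetsIn? : ∀ A W W′ m X → Dec (MeetsIn A W W′ m X)
    MeetsIn? A W W′ m X = Level? m X ×-dec (X ⊑? W ×-dec (X ⊑? W′ ×-dec A ⊑? X))

    field
      upper-covers  : ∀ {a n A B} → Level a A → Level (a + n) B → A ⊑ B →
                      ∑ elements (λ W → 𝟙 (Interval? A B (suc a) W)) ≡ gaussian q n
      -- Modularity, stated as an equality of counts because these are the off-diagonal entries of
      -- up* up and down* down. For subspaces both counts are 0 or 1.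
      common-covers : ∀ {m b A B W W′} → Level b B → Level (suc m) W → Level (suc m) W′ → W ≢ W′ →
                      A ⊑ W → A ⊑ W′ → W ⊑ B → W′ ⊑ B →
                      ∑ elements (λ Y → 𝟙 (JoinsIn? B W W′ (suc (suc m)) Y)) ≡
                      ∑ elements (λ X → 𝟙 (MeetsIn? A W W′ m X))

open GeometryDefinition using (Geometry) public

-- Linear algebra over a finite field by counting vectors.

module LinearAlgebra {q} (F : FiniteField q) where
  open FiniteField F using (_⁻¹; isField)
  open IsField isField using (*-inverseʳ; 1≉0)
  R : CommutativeRing 0ℓ 0ℓ
  R = record { isCommutativeRing = IsField.isCommutativeRing isField }
  open CommutativeRing R using (_+_; _*_; -_; _-_; 0#; 1#; -‿inverseʳ; -‿inverseˡ; *-comm)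
  open import Algebra.Properties.Ring (CommutativeRing.ring R) using (-‿distribˡ-*; x∙y⁻¹≈ε⇒x≈y)
  open import Data.Fin.Subset using (Subset; _∈_; _∉_; _⊆_; _∩_; ∣_∣; ⊤)
  open import Data.Fin.Subset.Properties
  open import Data.Nat.Base using (_≤_; _<_; z≤n; s≤s)
  open import Data.Vec.Base as Vec using (Vec; []; _∷_; replicate; zipWith)
  open import Data.Vec.Relation.Unary.All as All using (All; []; _∷_)
  open import Relation.Binary.PropositionalEquality
  open SubsetLemmas
  open GaussianIntegers
  open ℕSums

  -- Vectors are abstract here, known only through the module laws and the bijection `encode`, so
  -- that no argument unfolds coordinates or `funToFin`. The lists `scalars` enumerate coefficient
  -- vectors for the cardinality of a subspace.
  module Finite {N} {V : Set} {_+ᵛ_ : Op₂ V} {0ᵛ : V} {_*ᵛ_ : Fin q → V → V}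
    (isModule : IsLeftSemimodule (CommutativeRing.semiring R) _≡_ _+ᵛ_ 0ᵛ _*ᵛ_)
    (encode : V → Fin N) (decode : Fin N → V)
    (encode-decode : ∀ i → encode (decode i) ≡ i) (decode-encode : ∀ v → decode (encode v) ≡ v)
    (scalars : ∀ m → List (Vec (Fin q) m)) (scalars-unique : ∀ m → Unique (scalars m))
    (∈-scalars : ∀ {m} (a : Vec (Fin q) m) → a List.∈ scalars m)
    (∑-scalars : ∀ m → ∑ (scalars m) (λ _ → 1) ≡ q ℕ.^ m)
    where
    open IsLeftSemimodule isModule
    open ≡-Reasoning
    +ᵛ-commutativeSemigroup : CommutativeSemigroup 0ℓ 0ℓ
    +ᵛ-commutativeSemigroup = record { isCommutativeSemigroup = record { isSemigroup = +ᴹ-isSemigroup ; comm = +ᴹ-comm } }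

    open import Algebra.Properties.CommutativeSemigroup +ᵛ-commutativeSemigroup using (interchange)

    VectSet : Set
    VectSet = Subset N

    infix 4 _∈ᵛ_
    _∈ᵛ_ : V → VectSet → Set
    v ∈ᵛ W = encode v ∈ W

    combination : ∀ {m} → Vec (Fin q) m → Vec V m → V
    combination a b = Vec.foldr′ _+ᵛ_ 0ᵛ (zipWith _*ᵛ_ a b)

    IsSubspace : VectSet → Set
    IsSubspace W = 0ᵛ ∈ᵛ W
                 × (∀ u v → u ∈ᵛ W → v ∈ᵛ W → (u +ᵛ v) ∈ᵛ W)
                 × (∀ a v → v ∈ᵛ W → (a *ᵛ v) ∈ᵛ W)

    IsBasis : ∀ {m} → VectSet → Vec V m → Set
    IsBasis {m} W b = All (_∈ᵛ W) b
                    × (∀ a → combination a b ≡ 0ᵛ → a ≡ replicate m 0#)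
                    × (∀ v → v ∈ᵛ W → ∃ λ a → v ≡ combination a b)

    HasDim : VectSet → ℕ → Set
    HasDim W m = ∃ λ (b : Vec V m) → IsBasis W b

    cancel-* : ∀ c v → (c *ᵛ v) +ᵛ ((- c) *ᵛ v) ≡ 0ᵛ
    cancel-* c v = begin
      (c *ᵛ v) +ᵛ ((- c) *ᵛ v)   ≡⟨ *ₗ-distribʳ v c (- c) ⟨
      (c - c) *ᵛ v               ≡⟨ cong (_*ᵛ v) (-‿inverseʳ c) ⟩
      0# *ᵛ v                    ≡⟨ *ₗ-zeroˡ v ⟩
      0ᵛ                         ∎

    +ᵛ-cancel : ∀ c u v → (u +ᵛ (c *ᵛ v)) +ᵛ ((- c) *ᵛ v) ≡ u
    +ᵛ-cancel c u v = trans (+ᴹ-assoc _ _ _) (trans (cong (u +ᵛ_) (cancel-* c v)) (+ᴹ-identityʳ u))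

    +ᵛ-0* : ∀ u v → u +ᵛ (0# *ᵛ v) ≡ u
    +ᵛ-0* u v = trans (cong (u +ᵛ_) (*ₗ-zeroˡ v)) (+ᴹ-identityʳ u)

    v-v : ∀ v → v +ᵛ ((- 1#) *ᵛ v) ≡ 0ᵛ
    v-v v = trans (cong (_+ᵛ ((- 1#) *ᵛ v)) (sym (*ₗ-identityˡ v))) (cancel-* 1# v)

    encode-injective : ∀ {u v} → encode u ≡ encode v → u ≡ v
    encode-injective {u} {v} p =
      trans (sym (decode-encode u)) (trans (cong decode p) (decode-encode v))

    ∈-decode⁺ : ∀ {i} {W : VectSet} → i ∈ W → decode i ∈ᵛ W
    ∈-decode⁺ {i} {W} = subst (_∈ W) (sym (encode-decode i))

    ∈-decode⁻ : ∀ {i} {W : VectSet} → decode i ∈ᵛ W → i ∈ W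
    ∈-decode⁻ {i} {W} = subst (_∈ W) (encode-decode i)

    ⊆ᵛ : ∀ {A B : VectSet} → (∀ v → v ∈ᵛ A → v ∈ᵛ B) → A ⊆ B
    ⊆ᵛ h {i} i∈A = ∈-decode⁻ (h (decode i) (∈-decode⁺ i∈A))

    module _ {p} {P : Pred V p} (P? : Decidable P) where

      vectSet : VectSet
      vectSet = fromDec (P? ∘ decode)

      ∈-vectSet⁺ : ∀ {v} → P v → v ∈ᵛ vectSet
      ∈-vectSet⁺ {v} p = ∈-fromDec⁺ (P? ∘ decode) (subst P (sym (decode-encode v)) p)

      ∈-vectSet⁻ : ∀ {v} → v ∈ᵛ vectSet → P v
      ∈-vectSet⁻ {v} v∈ = subst P (decode-encode v) (∈-fromDec⁻ (P? ∘ decode) v∈)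

    combination-∈ : ∀ {A} → IsSubspace A → ∀ {m} {b : Vec V m} → All (_∈ᵛ A) b → ∀ a → combination a b ∈ᵛ A
    combination-∈ subA         []         []      = proj₁ subA
    combination-∈ subA@(_ , +∈ , *∈) (w∈ ∷ bs) (x ∷ a) = +∈ _ _ (*∈ x _ w∈) (combination-∈ subA bs a)

    combination-sub : ∀ {m} (b : Vec V m) a a′ →
                      combination (zipWith _-_ a a′) b +ᵛ combination a′ b ≡ combination a b
    combination-sub []      []      []       = +ᴹ-identityʳ 0ᵛ
    combination-sub (v ∷ b) (x ∷ a) (y ∷ a′) = begin
      (((x - y) *ᵛ v) +ᵛ combination (zipWith _-_ a a′) b) +ᵛ ((y *ᵛ v) +ᵛ combination a′ b)
        ≡⟨ interchange _ _ _ _ ⟩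
      (((x - y) *ᵛ v) +ᵛ (y *ᵛ v)) +ᵛ (combination (zipWith _-_ a a′) b +ᵛ combination a′ b)
        ≡⟨ cong₂ _+ᵛ_ (trans (sym (*ₗ-distribʳ v (x - y) y)) (cong (_*ᵛ v) x-y+y)) (combination-sub b a a′) ⟩
      (x *ᵛ v) +ᵛ combination a b  ∎
      where
      x-y+y : (x - y) + y ≡ x
      x-y+y = trans (CommutativeRing.+-assoc R x (- y) y)
                (trans (cong (x +_) (-‿inverseˡ y)) (CommutativeRing.+-identityʳ R x))

    -- A + ⟨ v ⟩
    module _ (A : VectSet) (v : V) where

      onLine? : ∀ u → Dec (∃ λ c → (u +ᵛ (c *ᵛ v)) ∈ᵛ A)
      onLine? u = Fin.any? (λ c → encode (u +ᵛ (c *ᵛ v)) ∈? A)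

      adjoin : VectSet
      adjoin = vectSet onLine?

    module _ {A : VectSet} (v : V) where

      adjoin⁺ : ∀ {u} c → (u +ᵛ (c *ᵛ v)) ∈ᵛ A → u ∈ᵛ adjoin A v
      adjoin⁺ c p = ∈-vectSet⁺ (onLine? A v) (c , p)

      adjoin⁻ : ∀ {u} → u ∈ᵛ adjoin A v → ∃ λ c → (u +ᵛ (c *ᵛ v)) ∈ᵛ A
      adjoin⁻ = ∈-vectSet⁻ (onLine? A v)

      ⊆-adjoin : A ⊆ adjoin A v
      ⊆-adjoin = ⊆ᵛ λ u u∈A → adjoin⁺ 0# (subst (_∈ᵛ A) (sym (+ᵛ-0* u v)) u∈A)

      ∈-adjoin : IsSubspace A → v ∈ᵛ adjoin A v
      ∈-adjoin (0∈ , _) = adjoin⁺ (- 1#) (subst (_∈ᵛ A) (sym (v-v v)) 0∈)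

      adjoin-subspace : IsSubspace A → IsSubspace (adjoin A v)
      adjoin-subspace (0∈ , +∈ , *∈) = ∈-0 , ∈-+ , ∈-*
        where
        ∈-0 : 0ᵛ ∈ᵛ adjoin A v
        ∈-0 = adjoin⁺ 0# (subst (_∈ᵛ A) (sym (+ᵛ-0* 0ᵛ v)) 0∈)
        ∈-+ : ∀ u w → u ∈ᵛ adjoin A v → w ∈ᵛ adjoin A v → (u +ᵛ w) ∈ᵛ adjoin A v
        ∈-+ u w u∈ w∈ with adjoin⁻ u∈ | adjoin⁻ w∈
        ... | c , u+cv | e , w+ev = adjoin⁺ (c + e) (subst (_∈ᵛ A) eq (+∈ _ _ u+cv w+ev))
          where
          eq : (u +ᵛ (c *ᵛ v)) +ᵛ (w +ᵛ (e *ᵛ v)) ≡ (u +ᵛ w) +ᵛ ((c + e) *ᵛ v)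
          eq = trans (interchange _ _ _ _) (cong ((u +ᵛ w) +ᵛ_) (sym (*ₗ-distribʳ v c e)))
        ∈-* : ∀ a u → u ∈ᵛ adjoin A v → (a *ᵛ u) ∈ᵛ adjoin A v
        ∈-* a u u∈ with adjoin⁻ u∈
        ... | c , u+cv = adjoin⁺ (a * c) (subst (_∈ᵛ A) eq (*∈ a _ u+cv))
          where
          eq : a *ᵛ (u +ᵛ (c *ᵛ v)) ≡ (a *ᵛ u) +ᵛ ((a * c) *ᵛ v)
          eq = trans (*ₗ-distribˡ a _ _) (cong ((a *ᵛ u) +ᵛ_) (sym (*ₗ-assoc a c v)))

      adjoin-⊆ : ∀ {W} → IsSubspace W → A ⊆ W → v ∈ᵛ W → adjoin A v ⊆ W
      adjoin-⊆ {W} (0∈ , +∈ , *∈) A⊆W v∈W = ⊆ᵛ λ u u∈ → helper u (adjoin⁻ u∈)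
        where
        helper : ∀ u → (∃ λ c → (u +ᵛ (c *ᵛ v)) ∈ᵛ A) → u ∈ᵛ W
        helper u (c , u+cv) = subst (_∈ᵛ W) (+ᵛ-cancel c u v) (+∈ _ _ (A⊆W u+cv) (*∈ (- c) v v∈W))

      -- In a relation c v + w = 0 with w in A, a nonzero c would give v = - c⁻¹ w and put v into A.
      -- So c vanishes, and the old basis handles the rest.
      adjoin-basis : ∀ {m} {b : Vec V m} → IsSubspace A → ¬ v ∈ᵛ A → IsBasis A b → IsBasis (adjoin A v) (v ∷ b)
      adjoin-basis {b = b} subA v∉A (b∈A , free , spans) = (∈-adjoin subA ∷ All.map ⊆-adjoin b∈A) , free′ , spans′
        where
        free′ : ∀ a → combination a (v ∷ b) ≡ 0ᵛ → a ≡ replicate _ 0#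
        free′ (c ∷ a) eq with c Fin.≟ 0#
        ... | yes refl = cong (0# ∷_) (free a (trans (sym (trans (+ᴹ-comm _ _) (+ᵛ-0* _ v))) eq))
        ... | no c≢0 = contradiction (subst (_∈ᵛ A) (sym v≡) (proj₂ (proj₂ subA) k _ (combination-∈ subA b∈A a))) v∉A
          where
          k = - (c ⁻¹)
          w = combination a b
          kc≡-1 : k * c ≡ - 1#
          kc≡-1 = trans (sym (-‿distribˡ-* (c ⁻¹) c)) (cong -_ (trans (*-comm (c ⁻¹) c) (*-inverseʳ c c≢0)))
          v≡ : v ≡ k *ᵛ w
          v≡ = begin
            v                                           ≡⟨ +ᴹ-identityʳ v ⟨
            v +ᵛ 0ᵛ                                     ≡⟨ cong (v +ᵛ_) (trans (cong (k *ᵛ_) eq) (*ₗ-zeroʳ k)) ⟨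
            v +ᵛ (k *ᵛ ((c *ᵛ v) +ᵛ w))                 ≡⟨ cong (v +ᵛ_) (*ₗ-distribˡ k _ _) ⟩
            v +ᵛ ((k *ᵛ (c *ᵛ v)) +ᵛ (k *ᵛ w))          ≡⟨ cong (λ z → v +ᵛ (z +ᵛ (k *ᵛ w))) (*ₗ-assoc k c v) ⟨
            v +ᵛ (((k * c) *ᵛ v) +ᵛ (k *ᵛ w))           ≡⟨ cong (λ z → v +ᵛ ((z *ᵛ v) +ᵛ (k *ᵛ w))) kc≡-1 ⟩
            v +ᵛ (((- 1#) *ᵛ v) +ᵛ (k *ᵛ w))            ≡⟨ +ᴹ-assoc _ _ _ ⟨
            (v +ᵛ ((- 1#) *ᵛ v)) +ᵛ (k *ᵛ w)            ≡⟨ cong (_+ᵛ (k *ᵛ w)) (v-v v) ⟩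
            0ᵛ +ᵛ (k *ᵛ w)                              ≡⟨ +ᴹ-identityˡ _ ⟩
            k *ᵛ w                                      ∎
        spans′ : ∀ u → u ∈ᵛ adjoin A v → ∃ λ a → u ≡ combination a (v ∷ b)
        spans′ u u∈ with adjoin⁻ u∈
        ... | c , u+cv with spans _ u+cv
        ... | a , eq = (- c) ∷ a , (begin
          u                                              ≡⟨ +ᵛ-cancel c u v ⟨
          (u +ᵛ (c *ᵛ v)) +ᵛ ((- c) *ᵛ v)                ≡⟨ cong (_+ᵛ ((- c) *ᵛ v)) eq ⟩
          combination a b +ᵛ ((- c) *ᵛ v)                ≡⟨ +ᴹ-comm _ _ ⟩
          ((- c) *ᵛ v) +ᵛ combination a b                ∎)

    Level : ℕ → VectSet → Set
    Level m W = IsSubspace W × HasDim W m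

    adjoin-Level : ∀ {A m} v → Level m A → ¬ v ∈ᵛ A → Level (suc m) (adjoin A v)
    adjoin-Level v (subA , b , basis) v∉A = adjoin-subspace v subA , v ∷ b , adjoin-basis v subA v∉A basis

    -- Coordinates in a basis are a bijection with coefficient vectors. Monotonicity and uniqueness
    -- of the dimension then come from comparing powers of q, in place of an exchange argument.
    ∣∣-Level : ∀ {W m} → Level m W → ∣ W ∣ ≡ q ℕ.^ m
    ∣∣-Level {W} {m} (subW , b , b∈W , free , spans) = begin
      ∣ W ∣                                                               ≡⟨ ∣∣-∑ W ⟩
      ∑ (allFin N) (λ i → 𝟙 (i ∈? W))                                     ≡⟨ ∑-cong (allFin N) count ⟩
      ∑ (allFin N) (λ i → ∑ (scalars m) (λ a → 𝟙 (i ≟-comb a)))           ≡⟨ ∑-comm (allFin N) (scalars m) _ ⟩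
      ∑ (scalars m) (λ a → ∑ (allFin N) (λ i → 𝟙 (i ≟-comb a)))
        ≡⟨ ∑-cong (scalars m) (λ a → ∑-unique-1 (_≟-comb a) (allFin⁺ N) (∈-allFin _) refl (λ p → p)) ⟩
      ∑ (scalars m) (λ _ → 1)                                             ≡⟨ ∑-scalars m ⟩
      q ℕ.^ m                                                             ∎
      where
      _≟-comb_ : ∀ i a → Dec (i ≡ encode (combination a b))
      i ≟-comb a = i Fin.≟ encode (combination a b)
      sub-0 : ∀ {m} (a a′ : Vec (Fin q) m) → zipWith _-_ a a′ ≡ replicate m 0# → a ≡ a′
      sub-0 []      []       _ = refl
      sub-0 (x ∷ a) (y ∷ a′) p =
        cong₂ _∷_ (x∙y⁻¹≈ε⇒x≈y x y (cong Vec.head p)) (sub-0 a a′ (cong Vec.tail p))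
      combination-injective : ∀ {a a′} → combination a b ≡ combination a′ b → a ≡ a′
      combination-injective {a} {a′} eq = sub-0 a a′ (free _ (begin
        δ                                ≡⟨ +ᵛ-cancel 1# δ w ⟨
        (δ +ᵛ (1# *ᵛ w)) +ᵛ ((- 1#) *ᵛ w) ≡⟨ cong (λ z → (δ +ᵛ z) +ᵛ ((- 1#) *ᵛ w)) (*ₗ-identityˡ w) ⟩
        (δ +ᵛ w) +ᵛ ((- 1#) *ᵛ w)        ≡⟨ cong (_+ᵛ ((- 1#) *ᵛ w)) (trans (combination-sub b a a′) eq) ⟩
        w +ᵛ ((- 1#) *ᵛ w)               ≡⟨ v-v w ⟩
        0ᵛ                               ∎))
        where
        w = combination a′ b
        δ = combination (zipWith _-_ a a′) b
      count : ∀ i → 𝟙 (i ∈? W) ≡ ∑ (scalars m) (λ a → 𝟙 (i ≟-comb a))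
      count i with i ∈? W
      ... | yes i∈W with spans (decode i) (∈-decode⁺ i∈W)
      ... | a , eq = sym (∑-unique-1 (i ≟-comb_) (scalars-unique m) (∈-scalars a) i≡
                       (λ i≡′ → combination-injective (encode-injective (trans (sym i≡′) i≡))))
        where
        i≡ : i ≡ encode (combination a b)
        i≡ = trans (sym (encode-decode i)) (cong encode eq)
      count i | no i∉W = sym (∑-zero (scalars m) (λ a → 𝟙-no (i ≟-comb a)
                  (λ { refl → i∉W (combination-∈ subW b∈W a) })))

    1<q : 1 < q
    1<q = at-least-two 1# 0# 1≉0
      where
      at-least-two : ∀ {n} (x y : Fin n) → x ≢ y → 1 < n
      at-least-two {suc zero}    zero zero x≢y = contradiction refl x≢y
      at-least-two {suc (suc n)} _    _    _   = s≤s (s≤s z≤n)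

    Level-mono : ∀ {a b A B} → Level a A → Level b B → A ⊆ B → a ≤ b
    Level-mono {a} {b} {A} {B} lA lB A⊆B with a ℕ.≤? b
    ... | yes a≤b = a≤b
    ... | no a≰b  = contradiction (subst₂ _≤_ (∣∣-Level lA) (∣∣-Level lB) (p⊆q⇒∣p∣≤∣q∣ A⊆B))
                                  (ℕ.<⇒≱ (ℕ.^-monoʳ-< q 1<q (ℕ.≰⇒> a≰b)))

    Level-unique : ∀ {a b A} → Level a A → Level b A → a ≡ b
    Level-unique lA lA′ = ℕ.≤-antisym (Level-mono lA lA′ ⊆-refl) (Level-mono lA′ lA ⊆-refl)

    ∉-or-⊆ : ∀ A B → Dec (∃ λ v → v ∈ᵛ B × ¬ v ∈ᵛ A)
    ∉-or-⊆ A B = map′ (λ (i , i∈B , i∉A) → decode i , ∈-decode⁺ i∈B , λ p → i∉A (∈-decode⁻ p))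
                      (λ (v , v∈B , v∉A) → encode v , v∈B , v∉A)
                      (Fin.any? (λ i → (i ∈? B) ×-dec (¬? (i ∈? A))))

    ∄⇒⊆ : ∀ {A B} → ¬ (∃ λ v → v ∈ᵛ B × ¬ v ∈ᵛ A) → B ⊆ A
    ∄⇒⊆ {A} {B} ∄ = ⊆ᵛ λ v v∈B → decidable-stable (encode v ∈? A) (λ v∉A → ∄ (v , v∈B , v∉A))

    Level-≡ : ∀ {a A B} → Level a A → Level a B → A ⊆ B → A ≡ B
    Level-≡ {a} {A} {B} lA lB A⊆B with ∉-or-⊆ A B
    ... | no ∄ = ⊆-antisym A⊆B (∄⇒⊆ ∄)
    ... | yes (v , v∈B , v∉A) = contradiction
            (subst₂ _<_ (∣∣-Level lA) (∣∣-Level lB) (p⊂q⇒∣p∣<∣q∣ (A⊆B , encode v , v∈B , v∉A))) (ℕ.<-irrefl refl)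

    ≢⇒∉ : ∀ {a A B} → Level a A → Level a B → A ≢ B → ∃ λ v → v ∈ᵛ B × ¬ v ∈ᵛ A
    ≢⇒∉ {a} {A} {B} lA lB A≢B with ∉-or-⊆ A B
    ... | yes w = w
    ... | no ∄  = contradiction (sym (Level-≡ lB lA (∄⇒⊆ ∄))) A≢B

    trivial : VectSet
    trivial = vectSet (λ v → encode v Fin.≟ encode 0ᵛ)

    trivial⁻ : ∀ {v} → v ∈ᵛ trivial → v ≡ 0ᵛ
    trivial⁻ v∈ = encode-injective (∈-vectSet⁻ (λ v → encode v Fin.≟ encode 0ᵛ) v∈)

    0∈trivial : 0ᵛ ∈ᵛ trivial
    0∈trivial = ∈-vectSet⁺ (λ v → encode v Fin.≟ encode 0ᵛ) refl

    trivial-Level : Level 0 trivial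
    trivial-Level = (0∈trivial , sum∈ , mul∈) , [] , [] , (λ { [] _ → refl }) , λ v v∈ → [] , trivial⁻ v∈
      where
      sum∈ : ∀ u v → u ∈ᵛ trivial → v ∈ᵛ trivial → (u +ᵛ v) ∈ᵛ trivial
      sum∈ u v u∈ v∈ = subst (_∈ᵛ trivial) (sym (trans (cong₂ _+ᵛ_ (trivial⁻ u∈) (trivial⁻ v∈)) (+ᴹ-identityʳ 0ᵛ))) 0∈trivial
      mul∈ : ∀ a v → v ∈ᵛ trivial → (a *ᵛ v) ∈ᵛ trivial
      mul∈ a v v∈ = subst (_∈ᵛ trivial) (sym (trans (cong (a *ᵛ_) (trivial⁻ v∈)) (*ₗ-zeroʳ a))) 0∈trivial

    trivial-⊆ : ∀ {W} → IsSubspace W → trivial ⊆ W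
    trivial-⊆ {W} (0∈ , _) = ⊆ᵛ λ v v∈ → subst (_∈ᵛ W) (sym (trivial⁻ v∈)) 0∈

    -- Vectors of W are adjoined to the zero space until none is left outside. Each one enlarges the
    -- set, so `∣ W ∣` serves as fuel.
    subspace-Level : ∀ {W} → IsSubspace W → ∃ λ m → Level m W
    subspace-Level {W} subW = grow ∣ W ∣ trivial-Level (trivial-⊆ subW) (ℕ.m≤n+m _ _)
      where
      grow : ∀ fuel {A m} → Level m A → A ⊆ W → ∣ W ∣ ≤ ∣ A ∣ ℕ.+ fuel → ∃ λ m → Level m W
      grow fuel {A} {m} lA A⊆W bound with ∉-or-⊆ A W
      ... | no ∄ = m , subst (Level m) (⊆-antisym A⊆W (∄⇒⊆ ∄)) lA
      grow zero {A} lA A⊆W bound | yes (v , v∈W , v∉A) =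
        contradiction (ℕ.≤-trans bound (ℕ.≤-reflexive (ℕ.+-identityʳ _)))
                      (ℕ.<⇒≱ (p⊂q⇒∣p∣<∣q∣ (A⊆W , encode v , v∈W , v∉A)))
      grow (suc fuel) {A} lA A⊆W bound | yes (v , v∈W , v∉A) =
        grow fuel (adjoin-Level v lA v∉A) (adjoin-⊆ v subW A⊆W v∈W)
          (ℕ.≤-trans bound (ℕ.≤-trans (ℕ.≤-reflexive (ℕ.+-suc _ fuel))
            (ℕ.+-monoˡ-≤ fuel (p⊂q⇒∣p∣<∣q∣ (⊆-adjoin v , encode v , ∈-adjoin v (proj₁ lA) , v∉A)))))

    ∩-subspace : ∀ {A B} → IsSubspace A → IsSubspace B → IsSubspace (A ∩ B)
    ∩-subspace {A} {B} (0∈A , +∈A , *∈A) (0∈B , +∈B , *∈B) =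
      x∈p∩q⁺ (0∈A , 0∈B) ,
      (λ u v u∈ v∈ → let (u∈A , u∈B) = x∈p∩q⁻ A B u∈ ; (v∈A , v∈B) = x∈p∩q⁻ A B v∈
                     in x∈p∩q⁺ (+∈A u v u∈A v∈A , +∈B u v u∈B v∈B)) ,
      (λ a v v∈ → let (v∈A , v∈B) = x∈p∩q⁻ A B v∈ in x∈p∩q⁺ (*∈A a v v∈A , *∈B a v v∈B))

    adjoin-≡ : ∀ {A W m} v → Level m A → Level (suc m) W → A ⊆ W → v ∈ᵛ W → ¬ v ∈ᵛ A → adjoin A v ≡ W
    adjoin-≡ v lA lW A⊆W v∈W v∉A =
      Level-≡ (adjoin-Level v lA v∉A) lW (adjoin-⊆ v (proj₁ lW) A⊆W v∈W)

    module DistinctPair {m} {W W′ : VectSet} (lW : Level (suc m) W) (lW′ : Level (suc m) W′)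
      {v} (v∈W′ : v ∈ᵛ W′) (v∉W : ¬ v ∈ᵛ W) {u} (u∈W : u ∈ᵛ W) (u∉W′ : ¬ u ∈ᵛ W′) where

      X : VectSet
      X = W ∩ W′

      X⊆W : X ⊆ W
      X⊆W = p∩q⊆p W W′

      X⊆W′ : X ⊆ W′
      X⊆W′ = p∩q⊆q W W′

      meet-dim : ∃ λ x → Level x X
      meet-dim = subspace-Level (∩-subspace (proj₁ lW) (proj₁ lW′))

      x : ℕ
      x = proj₁ meet-dim

      adjoin-Level-X : Level (suc x) (adjoin X u)
      adjoin-Level-X = adjoin-Level u (proj₂ meet-dim) (λ u∈X → u∉W′ (X⊆W′ u∈X))

      adjoin-X⊆W : adjoin X u ⊆ W
      adjoin-X⊆W = adjoin-⊆ u (proj₁ lW) X⊆W u∈W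

      module _ {Y} (lY : Level (suc (suc m)) Y) (W⊆Y : W ⊆ Y) (W′⊆Y : W′ ⊆ Y) where

        -- The modular law by hand: Y is W′ + ⟨u⟩, so some w + c u lies in W′, and it also lies in W
        -- because u does. Hence W = X + ⟨u⟩, which gives X codimension one.
        W⊆adjoin-X : ∀ w → w ∈ᵛ W → w ∈ᵛ adjoin X u
        W⊆adjoin-X w w∈W = adjoin⁺ u (proj₁ c) (x∈p∩q⁺
            (proj₁ (proj₂ (proj₁ lW)) w _ w∈W (proj₂ (proj₂ (proj₁ lW)) (proj₁ c) u u∈W) , proj₂ c))
          where
          c : ∃ λ c → (w +ᵛ (c *ᵛ u)) ∈ᵛ W′
          c = adjoin⁻ u (subst (λ Z → w ∈ᵛ Z) (sym (adjoin-≡ u lW′ lY W′⊆Y (W⊆Y u∈W) u∉W′)) (W⊆Y w∈W))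

        meet-Level : Level m X
        meet-Level = subst (λ y → Level y X) (ℕ.suc-injective suc-x≡) (proj₂ meet-dim)
          where
          suc-x≡ : suc x ≡ suc m
          suc-x≡ = Level-unique (subst (Level (suc x)) (⊆-antisym adjoin-X⊆W (⊆ᵛ W⊆adjoin-X)) adjoin-Level-X) lW

      -- X + ⟨u⟩ still fits into W, which caps the dimension of X at m; the given common lower cover
      -- supplies the opposite inequality.
      meet-Level′ : ∀ {X′} → Level m X′ → X′ ⊆ W → X′ ⊆ W′ → Level m X
      meet-Level′ {X′} lX′ X′⊆W X′⊆W′ = subst (λ y → Level y X) (ℕ.≤-antisym x≤m m≤x) (proj₂ meet-dim)
        where
        x≤m : x ≤ m
        x≤m = ℕ.s≤s⁻¹ (Level-mono adjoin-Level-X lW adjoin-X⊆W)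
        m≤x : m ≤ x
        m≤x = Level-mono {A = X′} {B = X} lX′ (proj₂ meet-dim) (λ i∈ → x∈p∩q⁺ (X′⊆W i∈ , X′⊆W′ i∈))

      -- When X has codimension one, W′ is X + ⟨v⟩, and both summands lie in W + ⟨v⟩.
      W′⊆adjoin : Level m X → W′ ⊆ adjoin W v
      W′⊆adjoin lX = subst (_⊆ adjoin W v)
        (adjoin-≡ v lX lW′ X⊆W′ v∈W′ (λ v∈X → v∉W (X⊆W v∈X)))
        (adjoin-⊆ v (adjoin-subspace v (proj₁ lW)) (λ i∈ → ⊆-adjoin v (X⊆W i∈)) (∈-adjoin v (proj₁ lW)))

    module _ (Level? : ∀ m W → Dec (Level m W)) where

      private
        Cover : VectSet → VectSet → ℕ → VectSet → Set
        Cover A B m W = Level m W × A ⊆ W × W ⊆ B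
        Cover? : ∀ A B m W → Dec (Cover A B m W)
        Cover? A B m W = Level? m W ×-dec (A ⊆? W ×-dec W ⊆? B)

      -- Both sides are multiplied by the number of vectors of W ∖ A: every
      -- vector of B ∖ A lies in exactly one upper cover W of A.
      upper-covers : ∀ {a n A B} → Level a A → Level (a ℕ.+ n) B → A ⊆ B →
                     ∑ (subsets N) (λ W → 𝟙 (Cover? A B (suc a) W)) ≡ gaussian q n
      upper-covers {a} {n} {A} {B} lA lB A⊆B = cancel q refl
        where
        count : ℕ
        count = ∑ (subsets N) (λ W → 𝟙 (Cover? A B (suc a) W))

        new : VectSet → ℕ
        new W = ∑ (allFin N) (λ i → 𝟙 (¬? (i ∈? A)) ℕ.* 𝟙 (i ∈? W))

        ∣∣-new : ∀ {W} → A ⊆ W → ∣ W ∣ ≡ ∣ A ∣ ℕ.+ new W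
        ∣∣-new {W} A⊆W = begin
          ∣ W ∣                                      ≡⟨ ∣∣-∑ W ⟩
          ∑ (allFin N) (λ i → 𝟙 (i ∈? W))            ≡⟨ ∑-cong (allFin N) split ⟩
          ∑ (allFin N) (λ i → 𝟙 (i ∈? A) ℕ.+ 𝟙 (¬? (i ∈? A)) ℕ.* 𝟙 (i ∈? W))
                                                     ≡⟨ ∑-+ (allFin N) _ _ ⟩
          ∑ (allFin N) (λ i → 𝟙 (i ∈? A)) ℕ.+ new W  ≡⟨ cong (ℕ._+ new W) (∣∣-∑ A) ⟨
          ∣ A ∣ ℕ.+ new W                            ∎
          where
          split : ∀ i → 𝟙 (i ∈? W) ≡ 𝟙 (i ∈? A) ℕ.+ 𝟙 (¬? (i ∈? A)) ℕ.* 𝟙 (i ∈? W)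
          split i with i ∈? A
          ... | yes i∈A = 𝟙-yes (i ∈? W) (A⊆W i∈A)
          ... | no  _   = sym (ℕ.+-identityʳ _)

        through : ∀ i → 𝟙 (¬? (i ∈? A)) ℕ.* 𝟙 (i ∈? B) ≡
                        𝟙 (¬? (i ∈? A)) ℕ.* ∑ (subsets N) (λ W → 𝟙 (Cover? A B (suc a) W) ℕ.* 𝟙 (i ∈? W))
        through i = 𝟙*-cong (¬? (i ∈? A)) λ i∉A → trans (unique i∉A) (∑-cong (subsets N) (λ W → 𝟙-× (Cover? A B (suc a) W) (i ∈? W)))
          where
          unique : i ∉ A → 𝟙 (i ∈? B) ≡ ∑ (subsets N) (λ W → 𝟙 (Cover? A B (suc a) W ×-dec (i ∈? W)))
          unique i∉A with i ∈? B
          ... | yes i∈B = sym (∑-unique-1 (λ W → Cover? A B (suc a) W ×-dec (i ∈? W)) (subsets-unique N) (∈-subsets (adjoin A v))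
                  ((adjoin-Level v lA v∉A , ⊆-adjoin v , adjoin-⊆ v (proj₁ lB) A⊆B (∈-decode⁺ i∈B)) , ∈-decode⁻ (∈-adjoin v (proj₁ lA)))
                  (λ ((lW , A⊆W , _) , i∈W) → sym (adjoin-≡ v lA lW A⊆W (∈-decode⁺ i∈W) v∉A)))
            where
            v = decode i
            v∉A : ¬ v ∈ᵛ A
            v∉A v∈A = i∉A (∈-decode⁻ v∈A)
          ... | no i∉B = sym (∑-zero (subsets N) (λ W → 𝟙-no (Cover? A B (suc a) W ×-dec (i ∈? W))
                  (λ ((_ , _ , W⊆B) , i∈W) → i∉B (W⊆B i∈W))))

        double : ∀ D → (∀ W → Cover A B (suc a) W → new W ≡ D) → new B ≡ count ℕ.* D
        double D new≡D = begin
          new B                                                                     ≡⟨ ∑-cong (allFin N) through ⟩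
          ∑ (allFin N) (λ i → 𝟙 (¬? (i ∈? A)) ℕ.* ∑ (subsets N) (λ W → χ W ℕ.* 𝟙 (i ∈? W)))
            ≡⟨ ∑-cong (allFin N) (λ i → trans (*-∑ (subsets N) _ (𝟙 (¬? (i ∈? A)))) (∑-cong (subsets N) λ W → swap (𝟙 (¬? (i ∈? A))) (χ W) (𝟙 (i ∈? W)))) ⟩
          ∑ (allFin N) (λ i → ∑ (subsets N) (λ W → χ W ℕ.* (𝟙 (¬? (i ∈? A)) ℕ.* 𝟙 (i ∈? W))))
            ≡⟨ ∑-comm (allFin N) (subsets N) _ ⟩
          ∑ (subsets N) (λ W → ∑ (allFin N) (λ i → χ W ℕ.* (𝟙 (¬? (i ∈? A)) ℕ.* 𝟙 (i ∈? W))))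
            ≡⟨ ∑-cong (subsets N) (λ W → trans (sym (*-∑ (allFin N) _ (χ W))) (𝟙*-cong (Cover? A B (suc a) W) (new≡D W))) ⟩
          ∑ (subsets N) (λ W → χ W ℕ.* D)                                           ≡⟨ ∑-* (subsets N) χ D ⟨
          count ℕ.* D                                                               ∎
          where
          χ = λ W → 𝟙 (Cover? A B (suc a) W)
          swap : ∀ x y z → x ℕ.* (y ℕ.* z) ≡ y ℕ.* (x ℕ.* z)
          swap x y z = trans (sym (ℕ.*-assoc x y z)) (trans (cong (ℕ._* z) (ℕ.*-comm x y)) (ℕ.*-assoc y x z))

        -- Writing q as r + 2 makes (q - 1) q^a, the number of vectors of a cover outside A, visibly
        -- nonzero, so that it can be cancelled.
        cancel : ∀ p → p ≡ q → count ≡ gaussian q n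
        cancel zero          refl = contradiction 1<q λ ()
        cancel (suc zero)    refl = contradiction 1<q (ℕ.<-irrefl refl)
        cancel (suc (suc r)) refl = ℕ.*-cancelʳ-≡ count (gaussian q n) D (trans (sym (double D new-W)) new-B)
          where
          D = suc r ℕ.* q ℕ.^ a
          instance
            D≢0 : ℕ.NonZero D
            D≢0 = ℕ.m*n≢0 (suc r) (q ℕ.^ a) {{_}} {{ℕ.m^n≢0 q a}}
          new-W : ∀ W → Cover A B (suc a) W → new W ≡ D
          new-W W (lW , A⊆W , _) = ℕ.+-cancelˡ-≡ (q ℕ.^ a) _ _
            (trans (cong (ℕ._+ new W) (sym (∣∣-Level lA))) (trans (sym (∣∣-new A⊆W)) (∣∣-Level lW)))
          new-B : new B ≡ gaussian q n ℕ.* D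
          new-B = ℕ.+-cancelˡ-≡ (q ℕ.^ a) _ _
            (trans (cong (ℕ._+ new B) (sym (∣∣-Level lA)))
              (trans (sym (∣∣-new A⊆B)) (trans (∣∣-Level lB) (^-gaussian (suc r) a n))))

      -- Two distinct W, W′ of the same dimension have at most one common upper
      -- cover, W + W′, and at most one common lower cover, W ∩ W′, and by the
      -- modular law one exists iff the other does.
      common-covers : ∀ {m b A B W W′} → Level b B → Level (suc m) W → Level (suc m) W′ → W ≢ W′ →
                      A ⊆ W → A ⊆ W′ → W ⊆ B → W′ ⊆ B →
                      ∑ (subsets N) (λ Y → 𝟙 (Level? (suc (suc m)) Y ×-dec (W ⊆? Y ×-dec (W′ ⊆? Y ×-dec Y ⊆? B)))) ≡
                      ∑ (subsets N) (λ X → 𝟙 (Level? m X ×-dec (X ⊆? W ×-dec (X ⊆? W′ ×-dec A ⊆? X))))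
      common-covers {m} {b} {A} {B} {W} {W′} lB lW lW′ W≢W′ A⊆W A⊆W′ W⊆B W′⊆B =
        compare (≢⇒∉ lW lW′ W≢W′) (≢⇒∉ lW′ lW (λ p → W≢W′ (sym p)))
        where
        Join Meet : VectSet → Set
        Join Y = Level (suc (suc m)) Y × W ⊆ Y × W′ ⊆ Y × Y ⊆ B
        Meet X = Level m X × X ⊆ W × X ⊆ W′ × A ⊆ X

        Join? : ∀ Y → Dec (Join Y)
        Join? Y = Level? (suc (suc m)) Y ×-dec (W ⊆? Y ×-dec (W′ ⊆? Y ×-dec Y ⊆? B))

        Meet? : ∀ X → Dec (Meet X)
        Meet? X = Level? m X ×-dec (X ⊆? W ×-dec (X ⊆? W′ ×-dec A ⊆? X))

        compare : (∃ λ v → v ∈ᵛ W′ × ¬ v ∈ᵛ W) → (∃ λ u → u ∈ᵛ W × ¬ u ∈ᵛ W′) →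
                  ∑ (subsets N) (λ Y → 𝟙 (Join? Y)) ≡ ∑ (subsets N) (λ X → 𝟙 (Meet? X))
        compare (v , v∈W′ , v∉W) (u , u∈W , u∉W′) = by-cases (Level? m P.X)
          where
          module P = DistinctPair lW lW′ v∈W′ v∉W u∈W u∉W′

          by-cases : Dec (Level m P.X) → ∑ (subsets N) (λ Y → 𝟙 (Join? Y)) ≡ ∑ (subsets N) (λ X → 𝟙 (Meet? X))
          by-cases (yes lX) = trans
              (∑-unique-1 Join? (subsets-unique N) (∈-subsets (adjoin W v)) join join-unique)
              (sym (∑-unique-1 Meet? (subsets-unique N) (∈-subsets P.X) meet meet-unique))
            where
            join : Join (adjoin W v)
            join = adjoin-Level v lW v∉W , ⊆-adjoin v , P.W′⊆adjoin lX , adjoin-⊆ v (proj₁ lB) W⊆B (W′⊆B v∈W′)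
            join-unique : ∀ {Y} → Join Y → Y ≡ adjoin W v
            join-unique (lY , W⊆Y , W′⊆Y , _) = sym (adjoin-≡ v lW lY W⊆Y (W′⊆Y v∈W′) v∉W)
            meet : Meet P.X
            meet = lX , P.X⊆W , P.X⊆W′ , λ i∈ → x∈p∩q⁺ (A⊆W i∈ , A⊆W′ i∈)
            meet-unique : ∀ {X} → Meet X → X ≡ P.X
            meet-unique {X} (lX′ , X⊆W , X⊆W′ , _) =
              Level-≡ {A = X} {B = P.X} lX′ lX (λ i∈ → x∈p∩q⁺ (X⊆W i∈ , X⊆W′ i∈))
          by-cases (no ¬lX) = trans
              (∑-zero (subsets N) (λ Y → 𝟙-no (Join? Y) (λ (lY , W⊆Y , W′⊆Y , _) → ¬lX (P.meet-Level lY W⊆Y W′⊆Y))))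
              (sym (∑-zero (subsets N) (λ X → 𝟙-no (Meet? X) (λ (lX , X⊆W , X⊆W′ , _) → ¬lX (P.meet-Level′ lX X⊆W X⊆W′)))))

    -- No standard basis is written down: the full set is a subspace, so it has some dimension, and
    -- its cardinality q^d determines which.
    full-Level : ∀ {d} → N ≡ q ℕ.^ d → Level d ⊤
    full-Level {d} N≡ = subst (λ m → Level m ⊤) m≡d (proj₂ dim)
      where
      dim : ∃ λ m → Level m ⊤
      dim = subspace-Level (∈⊤ , (λ _ _ _ _ → ∈⊤) , (λ _ _ _ → ∈⊤))
      ^-injective : ∀ {m n} → q ℕ.^ m ≡ q ℕ.^ n → m ≡ n
      ^-injective {m} {n} eq with ℕ.<-cmp m n
      ... | tri< m<n _ _ = contradiction eq (ℕ.<⇒≢ (ℕ.^-monoʳ-< q 1<q m<n))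
      ... | tri≈ _ m≡n _ = m≡n
      ... | tri> _ _ n<m = contradiction (sym eq) (ℕ.<⇒≢ (ℕ.^-monoʳ-< q 1<q n<m))
      m≡d : proj₁ dim ≡ d
      m≡d = ^-injective (trans (sym (∣∣-Level (proj₂ dim))) (trans (∣⊤∣≡n N) N≡))

-- The subspaces of 𝔽_q^d form a geometry.

module SubspaceGeometry {q} (F : FiniteField q) (d : ℕ) where
  open import Data.Fin.Base using (funToFin; finToFun; combine)
  import Data.Bool.Properties as Bool
  open import Data.Fin.Subset using (⊤; _⊆_)
  open import Data.Fin.Subset.Properties using (_⊆?_; ⊆-refl; ⊆-trans; ∈⊤)
  import Data.List.Properties as List
  open import Data.List.Membership.Propositional.Properties using (∈-map⁺)
  open import Data.List.Relation.Unary.Unique.Propositional.Properties using (map⁺)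
  open import Data.Vec.Base as Vec using (Vec; []; _∷_; lookup)
  open import Data.Vec.Properties
  open import Relation.Binary.PropositionalEquality
  open SubsetLemmas
  open ℕSums
  open Subspaces F d
  module F = LinearAlgebra F
  open CommutativeRing F.R using (_+_; _*_; 0#) renaming (semiring to F-semiring)
  module F-ring = CommutativeRing F.R

  encode : ∀ {m} → Vec (Fin q) m → Fin (q ℕ.^ m)
  encode v = funToFin (lookup v)

  decode : ∀ {m} → Fin (q ℕ.^ m) → Vec (Fin q) m
  decode {m} i = Vec.tabulate (finToFun i)

  funToFin-cong : ∀ {m n} {f g : Fin m → Fin n} → (∀ i → f i ≡ g i) → funToFin f ≡ funToFin g
  funToFin-cong {zero}  h = refl
  funToFin-cong {suc m} h = cong₂ combine (h zero) (funToFin-cong (h ∘ suc))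

  encode-decode : ∀ m (i : Fin (q ℕ.^ m)) → encode (decode {m} i) ≡ i
  encode-decode m i =
    trans (funToFin-cong {m} (lookup∘tabulate (finToFun i))) (Fin.funToFin-finToFin {m} i)

  decode-encode : ∀ {m} (v : Vec (Fin q) m) → decode (encode v) ≡ v
  decode-encode v = trans (tabulate-cong (Fin.finToFun-funToFin (lookup v))) (tabulate∘lookup v)

  scalars : ∀ m → List (Vec (Fin q) m)
  scalars m = List.map decode (allFin (q ℕ.^ m))

  scalars-unique : ∀ m → Unique (scalars m)
  scalars-unique m = map⁺ (λ {i} {j} eq → trans (sym (encode-decode m i)) (trans (cong encode eq) (encode-decode m j)))
                          (allFin⁺ (q ℕ.^ m))

  ∈-scalars : ∀ {m} (a : Vec (Fin q) m) → a List.∈ scalars m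
  ∈-scalars {m} a = subst (List._∈ scalars m) (decode-encode a) (∈-map⁺ decode (∈-allFin (encode a)))

  ∑-scalars : ∀ m → ∑ (scalars m) (λ _ → 1) ≡ q ℕ.^ m
  ∑-scalars m = trans (∑-length (scalars m))
    (trans (List.length-map (decode {m}) (allFin (q ℕ.^ m))) (List.length-tabulate (λ i → i)))

  isModule : IsLeftSemimodule F-semiring _≡_ _+ᵛ_ 0ᵛ _*ᵛ_
  isModule = record
    { +ᴹ-isCommutativeMonoid = record
      { isMonoid = record
        { isSemigroup = record
          { isMagma = record { isEquivalence = isEquivalence ; ∙-cong = cong₂ _+ᵛ_ }
          ; assoc = zipWith-assoc F-ring.+-assoc }
        ; identity = zipWith-identityˡ F-ring.+-identityˡ , zipWith-identityʳ F-ring.+-identityʳ }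
      ; comm = zipWith-comm F-ring.+-comm }
    ; isPreleftSemimodule = record
      { *ₗ-cong = cong₂ _*ᵛ_
      ; *ₗ-zeroˡ = zeroˡ
      ; *ₗ-distribʳ = distribʳ
      ; *ₗ-identityˡ = λ v → trans (map-cong F-ring.*-identityˡ v) (map-id v)
      ; *ₗ-assoc = λ a b v → trans (map-cong (F-ring.*-assoc a b) v) (map-∘ (a *_) (b *_) v)
      ; *ₗ-zeroʳ = zeroʳ
      ; *ₗ-distribˡ = distribˡ } }
    where
    zeroˡ : ∀ {n} (v : Vec (Fin q) n) → Vec.map (0# *_) v ≡ Vec.replicate n 0#
    zeroˡ []      = refl
    zeroˡ (x ∷ v) = cong₂ _∷_ (F-ring.zeroˡ x) (zeroˡ v)
    zeroʳ : ∀ {n} a → Vec.map (a *_) (Vec.replicate n 0#) ≡ Vec.replicate n 0#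
    zeroʳ {zero}  a = refl
    zeroʳ {suc n} a = cong₂ _∷_ (F-ring.zeroʳ a) (zeroʳ a)
    distribʳ : ∀ {n} (v : Vec (Fin q) n) a b →
               Vec.map ((a + b) *_) v ≡ Vec.zipWith _+_ (Vec.map (a *_) v) (Vec.map (b *_) v)
    distribʳ []      a b = refl
    distribʳ (x ∷ v) a b = cong₂ _∷_ (F-ring.distribʳ x a b) (distribʳ v a b)
    distribˡ : ∀ {n} a (u v : Vec (Fin q) n) →
               Vec.map (a *_) (Vec.zipWith _+_ u v) ≡ Vec.zipWith _+_ (Vec.map (a *_) u) (Vec.map (a *_) v)
    distribˡ a []      []      = refl
    distribˡ a (x ∷ u) (y ∷ v) = cong₂ _∷_ (F-ring.distribˡ a x y) (distribˡ a u v)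

  module L = F.Finite isModule encode decode (encode-decode d) decode-encode
               scalars scalars-unique ∈-scalars ∑-scalars

  Level? : ∀ m W → Dec (L.Level m W)
  Level? m W = IsSubspace? W ×-dec HasDim? W m

  geometry : Geometry q d
  geometry = record
    { V = VectSet
    ; elements = subsets (q ℕ.^ d)
    ; elements-unique = subsets-unique (q ℕ.^ d)
    ; ∈-elements = ∈-subsets
    ; _≟_ = ≡-dec Bool._≟_
    ; _⊑_ = _⊆_
    ; _⊑?_ = _⊆?_
    ; Level = L.Level
    ; Level? = Level?
    ; ⊑-refl = λ {W} → ⊆-refl {x = W}
    ; ⊑-trans = λ {W} {W′} {W″} → ⊆-trans {i = W} {W′} {W″}
    ; Level-mono = L.Level-mono
    ; Level-≡ = L.Level-≡
    ; bottom = L.trivial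
    ; top = ⊤
    ; bottom-Level = L.trivial-Level
    ; bottom-⊑ = λ lW → L.trivial-⊆ (proj₁ lW)
    ; top-Level = L.full-Level refl
    ; ⊑-top = λ _ → ∈⊤
    ; upper-covers = L.upper-covers Level?
    ; common-covers = L.common-covers Level?
    }

-- Inequalities in an ordered field.

module OrderedField {c ℓ₁ ℓ₂} (K : RealClosedField c ℓ₁ ℓ₂) where
  open RealClosedField K public using (Carrier; _≈_; _+_; _*_; -_; _-_; 0#; 1#; _⁻¹; _≤_; _/_; fromℕ; √_; sum; _^_)
  open RealClosedField K using (commutativeRing; isField; isDecTotalOrder; +-monoˡ-≤; *-nonneg)
  open CommutativeRing commutativeRing public
    using (refl; sym; trans; setoid; +-cong; +-congˡ; +-congʳ; *-cong; *-congˡ; *-congʳ; -‿cong; +-comm; +-assoc;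
           *-comm; *-assoc; +-identityˡ; +-identityʳ; *-identityˡ; *-identityʳ; zeroˡ; zeroʳ; distribˡ; distribʳ; -‿inverseʳ)
    renaming (reflexive to ≈-reflexive)
  open CommutativeRing commutativeRing using (semiring; commutativeSemiring)
  open IsField isField public using (*-inverseʳ; 1≉0)
  open import Relation.Binary.Structures using (IsDecTotalOrder)
  open IsDecTotalOrder isDecTotalOrder public using (total; antisym; _≟_)
    renaming (refl to ≤-refl; reflexive to ≤-reflexive; trans to ≤-trans; ≤-respˡ-≈ to ≤-respˡ; ≤-respʳ-≈ to ≤-respʳ)
  open IntegerCoefficientSolver commutativeRing public using (solve; _:=_; _:+_; _:*_; _:-_; :-_; κ)
  open Sums commutativeSemiring public
  open import Algebra.Properties.Semiring.Mult semiring using (×-homo-+; ×1-homo-*)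
  open import Data.List.Membership.Propositional using (_∈_)
  open import Relation.Binary.Reasoning.Setoid setoid

  x-y≥0 : ∀ {x y} → y ≤ x → 0# ≤ x - y
  x-y≥0 {x} {y} y≤x = ≤-respˡ (-‿inverseʳ y) (+-monoˡ-≤ (- y) y≤x)

  -- Inequalities are proved by exhibiting y - x as a nonnegative expression.
  by-difference : ∀ {x y e} → 0# ≤ e → y ≈ x + e → x ≤ y
  by-difference {x} {y} {e} e≥0 y≈x+e =
    ≤-respʳ (trans (+-comm e x) (sym y≈x+e)) (≤-respˡ (+-identityˡ x) (+-monoˡ-≤ x e≥0))

  +-nonneg : ∀ {x y} → 0# ≤ x → 0# ≤ y → 0# ≤ x + y
  +-nonneg {x} {y} x≥0 y≥0 = ≤-trans y≥0 (by-difference x≥0 (+-comm x y))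

  _*≥_ : ∀ {x y} → 0# ≤ x → 0# ≤ y → 0# ≤ x * y
  _*≥_ = *-nonneg

  _+≥_ : ∀ {x y} → 0# ≤ x → 0# ≤ y → 0# ≤ x + y
  _+≥_ = +-nonneg

  infixl 7 _*≥_
  infixl 6 _+≥_

  +-mono-≤ : ∀ {x y u v} → x ≤ y → u ≤ v → x + u ≤ y + v
  +-mono-≤ {x} {y} {u} {v} x≤y u≤v = by-difference (x-y≥0 x≤y +≥ x-y≥0 u≤v)
    (solve 4 (λ x y u v → y :+ v := x :+ u :+ ((y :- x) :+ (v :- u))) refl x y u v)

  *-monoˡ-≤ : ∀ {x y k} → 0# ≤ k → x ≤ y → k * x ≤ k * y
  *-monoˡ-≤ {x} {y} {k} k≥0 x≤y = by-difference (k≥0 *≥ x-y≥0 x≤y)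
    (solve 3 (λ x y k → k :* y := k :* x :+ k :* (y :- x)) refl x y k)

  *-mono-≤ : ∀ {x y u v} → 0# ≤ x → 0# ≤ u → x ≤ y → u ≤ v → x * u ≤ y * v
  *-mono-≤ {x} {y} {u} {v} x≥0 u≥0 x≤y u≤v =
    by-difference (x≥0 *≥ x-y≥0 u≤v +≥ x-y≥0 x≤y *≥ ≤-trans u≥0 u≤v)
      (solve 4 (λ x y u v → y :* v := x :* u :+ (x :* (v :- u) :+ (y :- x) :* v)) refl x y u v)

  square-nonneg : ∀ x → 0# ≤ x * x
  square-nonneg x with total 0# x
  ... | inj₁ x≥0 = x≥0 *≥ x≥0
  ... | inj₂ x≤0 = ≤-respʳ (solve 1 (λ x → (κ 0 :- x) :* (κ 0 :- x) := x :* x) refl x) (x-y≥0 x≤0 *≥ x-y≥0 x≤0)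

  1≥0 : 0# ≤ 1#
  1≥0 = ≤-respʳ (*-identityˡ 1#) (square-nonneg 1#)

  fromℕ≥0 : ∀ n → 0# ≤ fromℕ n
  fromℕ≥0 zero    = ≤-refl
  fromℕ≥0 (suc n) = 1≥0 +≥ fromℕ≥0 n

  Positive : Carrier → Set _
  Positive x = 0# ≤ x × ¬ x ≈ 0#

  pos-* : ∀ {x y} → Positive x → Positive y → Positive (x * y)
  pos-* {x} {y} (x≥0 , x≉0) (y≥0 , y≉0) = x≥0 *≥ y≥0 , λ xy≈0 → y≉0 (begin
    y                  ≈⟨ *-identityˡ y ⟨
    1# * y             ≈⟨ *-congʳ (*-inverseʳ x x≉0) ⟨
    x * x ⁻¹ * y       ≈⟨ solve 3 (λ x i y → x :* i :* y := i :* (x :* y)) refl x (x ⁻¹) y ⟩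
    x ⁻¹ * (x * y)     ≈⟨ *-congˡ xy≈0 ⟩
    x ⁻¹ * 0#          ≈⟨ zeroʳ _ ⟩
    0#                 ∎)

  pos-+ : ∀ {x y} → Positive x → 0# ≤ y → Positive (x + y)
  pos-+ {x} {y} (x≥0 , x≉0) y≥0 = x≥0 +≥ y≥0 , λ x+y≈0 →
    x≉0 (antisym (≤-respʳ x+y≈0 (by-difference y≥0 refl)) x≥0)

  pos-1 : Positive 1#
  pos-1 = 1≥0 , 1≉0

  pos-fromℕ : ∀ n → Positive (fromℕ (suc n))
  pos-fromℕ n = pos-+ pos-1 (fromℕ≥0 n)

  pos-≥ : ∀ {x y} → Positive x → x ≤ y → Positive y
  pos-≥ {x} {y} (x≥0 , x≉0) x≤y = ≤-trans x≥0 x≤y , λ y≈0 → x≉0 (antisym (≤-respʳ y≈0 x≤y) x≥0)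

  pos-resp : ∀ {x y} → x ≈ y → Positive x → Positive y
  pos-resp x≈y (x≥0 , x≉0) = ≤-respʳ x≈y x≥0 , λ y≈0 → x≉0 (trans x≈y y≈0)

  *-cancel-≈ : ∀ {k x y} → ¬ k ≈ 0# → k * x ≈ k * y → x ≈ y
  *-cancel-≈ {k} {x} {y} k≉0 kx≈ky = begin
    x                  ≈⟨ undo x ⟨
    k ⁻¹ * (k * x)     ≈⟨ *-congˡ kx≈ky ⟩
    k ⁻¹ * (k * y)     ≈⟨ undo y ⟩
    y                  ∎
    where
    undo : ∀ z → k ⁻¹ * (k * z) ≈ z
    undo z = begin
      k ⁻¹ * (k * z)   ≈⟨ solve 3 (λ k i z → i :* (k :* z) := k :* i :* z) refl k (k ⁻¹) z ⟩
      k * k ⁻¹ * z     ≈⟨ *-congʳ (*-inverseʳ k k≉0) ⟩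
      1# * z           ≈⟨ *-identityˡ z ⟩
      z                ∎

  *-cancel-0 : ∀ {k x} → ¬ k ≈ 0# → k * x ≈ 0# → x ≈ 0#
  *-cancel-0 k≉0 kx≈0 = *-cancel-≈ k≉0 (trans kx≈0 (sym (zeroʳ _)))

  *-cancel-≤ : ∀ {k x y} → Positive k → k * x ≤ k * y → x ≤ y
  *-cancel-≤ {k} {x} {y} (k≥0 , k≉0) kx≤ky with total x y
  ... | inj₁ x≤y = x≤y
  ... | inj₂ y≤x = ≤-reflexive (*-cancel-≈ k≉0 (antisym kx≤ky (*-monoˡ-≤ k≥0 y≤x)))

  pos-⁻¹ : ∀ {x} → Positive x → Positive (x ⁻¹)
  pos-⁻¹ {x} (x≥0 , x≉0) = *-cancel-≤ (x≥0 , x≉0) (≤-respˡ (sym (zeroʳ x)) (≤-respʳ (sym (*-inverseʳ x x≉0)) 1≥0)) ,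
    λ x⁻¹≈0 → 1≉0 (trans (sym (*-inverseʳ x x≉0)) (trans (*-congˡ x⁻¹≈0) (zeroʳ x)))

  ≤-/ : ∀ {x y k} → Positive k → k * x ≤ y → x ≤ y / k
  ≤-/ {x} {y} {k} k>0 kx≤y = *-cancel-≤ k>0 (≤-respʳ (begin
    y                ≈⟨ *-identityʳ y ⟨
    y * 1#           ≈⟨ *-congˡ (*-inverseʳ k (proj₂ k>0)) ⟨
    y * (k * k ⁻¹)   ≈⟨ solve 3 (λ y k i → y :* (k :* i) := k :* (y :* i)) refl y k (k ⁻¹) ⟩
    k * (y / k)      ∎) kx≤y)

  */ : ∀ {k} → ¬ k ≈ 0# → ∀ x → k * (x / k) ≈ x
  */ {k} k≉0 x = begin
    k * (x * k ⁻¹)   ≈⟨ solve 3 (λ y k i → k :* (y :* i) := y :* (k :* i)) refl x k (k ⁻¹) ⟩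
    x * (k * k ⁻¹)   ≈⟨ *-congˡ (*-inverseʳ k k≉0) ⟩
    x * 1#           ≈⟨ *-identityʳ x ⟩
    x                ∎

  pos-^ : ∀ {x} n → Positive x → Positive (x ^ n)
  pos-^ zero    x>0 = pos-1
  pos-^ (suc n) x>0 = pos-* x>0 (pos-^ n x>0)

  module _ {a} {A : Set a} where

    ∑-nonneg : (L : List A) {f : A → Carrier} → (∀ x → 0# ≤ f x) → 0# ≤ ∑ L f
    ∑-nonneg []      f≥0 = ≤-refl
    ∑-nonneg (x ∷ L) f≥0 = f≥0 x +≥ ∑-nonneg L f≥0

    ∑-mono : (L : List A) {f g : A → Carrier} → (∀ x → f x ≤ g x) → ∑ L f ≤ ∑ L g
    ∑-mono []      f≤g = ≤-refl
    ∑-mono (x ∷ L) f≤g = +-mono-≤ (f≤g x) (∑-mono L f≤g)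

    ∑-positive : (L : List A) {f : A → Carrier} → (∀ x → 0# ≤ f x) → ∀ {x} → x ∈ L → Positive (f x) → Positive (∑ L f)
    ∑-positive (x ∷ L) f≥0 (here ≡.refl) fx>0 = pos-+ fx>0 (∑-nonneg L f≥0)
    ∑-positive (y ∷ L) f≥0 (there x∈)    fx>0 = pos-resp (+-comm _ _) (pos-+ (∑-positive L f≥0 x∈ fx>0) (f≥0 y))

    ∑≈0⇒≈0 : (L : List A) {f : A → Carrier} → (∀ x → 0# ≤ f x) → ∑ L f ≈ 0# → ∀ {x} → x ∈ L → f x ≈ 0#
    ∑≈0⇒≈0 L {f} f≥0 ∑≈0 {x} x∈ with f x ≟ 0#
    ... | yes fx≈0 = fx≈0
    ... | no fx≉0  = contradiction ∑≈0 (proj₂ (∑-positive L f≥0 x∈ (f≥0 x , fx≉0)))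

  𝟙≥0 : ∀ {p} {P : Set p} (d : Dec P) → 0# ≤ 𝟙 d
  𝟙≥0 (yes _) = 1≥0
  𝟙≥0 (no _)  = ≤-refl

  fromℕ-+ : ∀ m n → fromℕ (m ℕ.+ n) ≈ fromℕ m + fromℕ n
  fromℕ-+ = ×-homo-+ 1#

  fromℕ-* : ∀ m n → fromℕ (m ℕ.* n) ≈ fromℕ m * fromℕ n
  fromℕ-* = ×1-homo-*

  fromℕ-𝟙 : ∀ {p} {P : Set p} (d : Dec P) → fromℕ (ℕSums.𝟙 d) ≈ 𝟙 d
  fromℕ-𝟙 (yes _) = +-identityʳ 1#
  fromℕ-𝟙 (no _)  = refl

  fromℕ-∑ : ∀ {a} {A : Set a} (L : List A) (f : A → ℕ) → fromℕ (ℕSums.∑ L f) ≈ ∑ L (λ x → fromℕ (f x))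
  fromℕ-∑ []      f = refl
  fromℕ-∑ (x ∷ L) f = trans (fromℕ-+ (f x) _) (+-congˡ (fromℕ-∑ L f))

  fromℕ-∑𝟙 : ∀ {a p} {A : Set a} {P : A → Set p} (P? : ∀ x → Dec (P x)) (L : List A) →
             fromℕ (ℕSums.∑ L (λ x → ℕSums.𝟙 (P? x))) ≈ ∑ L (λ x → 𝟙 (P? x))
  fromℕ-∑𝟙 P? L = trans (fromℕ-∑ L _) (∑-cong L (λ x → fromℕ-𝟙 (P? x)))

  -- Lagrange's identity: twice the defect is ∑ wᵢ wⱼ (fᵢ uⱼ - fⱼ uᵢ)².
  cauchy-schwarz : ∀ {a} {A : Set a} (L : List A) (w f u : A → Carrier) → (∀ x → 0# ≤ w x) →
    ∑ L (λ x → w x * (f x * u x)) * ∑ L (λ x → w x * (f x * u x)) ≤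
    ∑ L (λ x → w x * (f x * f x)) * ∑ L (λ x → w x * (u x * u x))
  cauchy-schwarz L w f u w≥0 = *-cancel-≤ {k = 1# + 1#} (pos-+ pos-1 1≥0)
    (by-difference (∑-nonneg L (λ x → ∑-nonneg L (λ y → w≥0 x *≥ w≥0 y *≥ square-nonneg (f x * u y - f y * u x)))) eq)
    where
    FF = λ x → w x * (f x * f x)
    UU = λ x → w x * (u x * u x)
    FU = λ x → w x * (f x * u x)
    eq : (1# + 1#) * (∑ L FF * ∑ L UU) ≈ (1# + 1#) * (∑ L FU * ∑ L FU) +
         ∑ L (λ x → ∑ L (λ y → w x * w y * ((f x * u y - f y * u x) * (f x * u y - f y * u x))))
    eq = begin
      (1# + 1#) * (∑ L FF * ∑ L UU)
        ≈⟨ solve 2 (λ s t → (κ 1 :+ κ 1) :* (s :* t) := s :* t :+ t :* s) refl (∑ L FF) (∑ L UU) ⟩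
      ∑ L FF * ∑ L UU + ∑ L UU * ∑ L FF
        ≈⟨ +-cong (*-∑-*-∑ L L FF UU) (*-∑-*-∑ L L UU FF) ⟩
      ∑ L (λ x → ∑ L (λ y → FF x * UU y)) + ∑ L (λ x → ∑ L (λ y → UU x * FF y))
        ≈⟨ trans (∑-cong L (λ x → ∑-+ L _ _)) (∑-+ L _ _) ⟨
      ∑ L (λ x → ∑ L (λ y → FF x * UU y + UU x * FF y))
        ≈⟨ ∑-cong L (λ x → ∑-cong L (λ y → solve 6 (λ v w f g s t →
             v :* (f :* f) :* (w :* (t :* t)) :+ v :* (s :* s) :* (w :* (g :* g)) :=
             (κ 1 :+ κ 1) :* (v :* (f :* s) :* (w :* (g :* t))) :+
             v :* w :* ((f :* t :- g :* s) :* (f :* t :- g :* s))) refl (w x) (w y) (f x) (f y) (u x) (u y))) ⟩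
      ∑ L (λ x → ∑ L (λ y → (1# + 1#) * (FU x * FU y) + w x * w y * ((f x * u y - f y * u x) * (f x * u y - f y * u x))))
        ≈⟨ trans (∑-cong L (λ x → ∑-+ L _ _)) (∑-+ L _ _) ⟩
      ∑ L (λ x → ∑ L (λ y → (1# + 1#) * (FU x * FU y))) + _
        ≈⟨ +-congʳ (trans (*-congˡ (*-∑-*-∑ L L FU FU)) (trans (*-∑ L _ _) (∑-cong L (λ x → *-∑ L _ _)))) ⟨
      (1# + 1#) * (∑ L FU * ∑ L FU) + _ ∎

-- Moving one level up or down in an interval.

module GeometrySpectrum {c ℓ₁ ℓ₂} (K : RealClosedField c ℓ₁ ℓ₂) {q d} (G : Geometry q d) where
  open OrderedField K
  open Geometry G renaming (_≟_ to _≟ᵛ_)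
  open GaussianIntegers using (gaussian)
  open import Relation.Binary.Reasoning.Setoid setoid

  Q : Carrier
  Q = fromℕ q

  ⟦_⟧ : ℕ → Carrier
  ⟦ n ⟧ = fromℕ (gaussian q n)

  ⟦suc⟧ : ∀ n → ⟦ suc n ⟧ ≈ 1# + Q * ⟦ n ⟧
  ⟦suc⟧ n = +-congˡ (fromℕ-* q (gaussian q n))

  ⟦⟧≥0 : ∀ n → 0# ≤ ⟦ n ⟧
  ⟦⟧≥0 n = fromℕ≥0 (gaussian q n)

  ⟦suc⟧>0 : ∀ n → Positive ⟦ suc n ⟧
  ⟦suc⟧>0 n = pos-fromℕ (q ℕ.* gaussian q n)

  E : (V → Carrier) → Carrier
  E f = ∑ elements f

  E-cong : ∀ {f g} → (∀ W → f W ≈ g W) → E f ≈ E g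
  E-cong = ∑-cong elements

  E-unique : ∀ {P : V → Set} (P? : ∀ W → Dec (P W)) f {W} → P W → (∀ {W′} → P W′ → W′ ≡ W) →
             E (λ W → 𝟙 (P? W) * f W) ≈ f W
  E-unique P? f p only = ∑-unique P? elements-unique f (∈-elements _) p only

  E-unique-1 : ∀ {P : V → Set} (P? : ∀ W → Dec (P W)) {W} → P W → (∀ {W′} → P W′ → W′ ≡ W) →
               E (λ W → 𝟙 (P? W)) ≈ 1#
  E-unique-1 P? p only = ∑-unique-1 P? elements-unique (∈-elements _) p only

  Level-cast : ∀ {m n W} → m ≡ n → Level m W → Level n W
  Level-cast {W = W} = ≡.subst (λ m → Level m W)

  upper-count : ∀ {a n m A B} → Level a A → Level m B → m ≡ a ℕ.+ n → A ⊑ B →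
                E (λ W → 𝟙 (Interval? A B (suc a) W)) ≈ ⟦ n ⟧
  upper-count {a} {A = A} {B} lA lB eq A⊑B =
    trans (sym (fromℕ-∑𝟙 (Interval? A B (suc a)) elements))
          (≈-reflexive (≡.cong fromℕ (upper-covers lA (Level-cast eq lB) A⊑B)))

  -- Counting the pairs A ⋖ L ⊑ X ⋖ W in two ways.
  lower-count : ∀ x {a m A W} → Level a A → Level (suc m) W → A ⊑ W → m ≡ a ℕ.+ x →
                E (λ X → 𝟙 (Interval? A W m X)) ≈ ⟦ suc x ⟧
  lower-count zero {a} {m} {A} {W} lA lW A⊑W eq = begin
    E (λ X → 𝟙 (Interval? A W m X))   ≈⟨ E-unique-1 (Interval? A W m) {A} (lA′ , ⊑-refl , A⊑W)
                                           (λ (lX , A⊑X , _) → ≡.sym (Level-≡ lA′ lX A⊑X)) ⟩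
    1#                                ≈⟨ +-identityʳ 1# ⟨
    1# + 0#                           ≈⟨ +-congˡ (zeroʳ Q) ⟨
    1# + Q * 0#                       ≈⟨ ⟦suc⟧ 0 ⟨
    ⟦ 1 ⟧                             ∎
    where
    lA′ : Level m A
    lA′ = Level-cast (≡.sym (≡.trans eq (ℕ.+-identityʳ a))) lA
  lower-count (suc x) {a} {m} {A} {W} lA lW A⊑W eq = *-cancel-≈ (proj₂ (⟦suc⟧>0 x)) (begin
    ⟦ suc x ⟧ * E (λ X → I A W m X)
      ≈⟨ trans (*-comm _ _) (∑-* elements _ _) ⟩
    E (λ X → I A W m X * ⟦ suc x ⟧)
      ≈⟨ E-cong (λ X → 𝟙*-cong (Interval? A W m X) (λ (lX , A⊑X , _) → upper-count lA lX eq A⊑X)) ⟨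
    E (λ X → I A W m X * E (λ L → I A X (suc a) L))
      ≈⟨ E-cong (λ X → *-∑ elements _ _) ⟩
    E (λ X → E (λ L → I A W m X * I A X (suc a) L))
      ≈⟨ ∑-comm elements elements _ ⟩
    E (λ L → E (λ X → I A W m X * I A X (suc a) L))
      ≈⟨ E-cong (λ L → E-cong (λ X →
           𝟙𝟙-cong (Interval? A W m X) (Interval? A X (suc a) L) (Interval? A W (suc a) L) (Interval? L W m X)
             (λ ((lX , A⊑X , X⊑W) , (lL , A⊑L , L⊑X)) → (lL , A⊑L , ⊑-trans L⊑X X⊑W) , (lX , L⊑X , X⊑W))
             (λ ((lL , A⊑L , L⊑W) , (lX , L⊑X , X⊑W)) → (lX , ⊑-trans A⊑L L⊑X , X⊑W) , (lL , A⊑L , L⊑X)))) ⟩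
    E (λ L → E (λ X → I A W (suc a) L * I L W m X))
      ≈⟨ E-cong (λ L → *-∑ elements _ _) ⟨
    E (λ L → I A W (suc a) L * E (λ X → I L W m X))
      ≈⟨ E-cong (λ L → 𝟙*-cong (Interval? A W (suc a) L) (λ (lL , _ , L⊑W) →
           lower-count x lL lW L⊑W (≡.trans eq (ℕ.+-suc a x)))) ⟩
    E (λ L → I A W (suc a) L * ⟦ suc x ⟧)
      ≈⟨ trans (*-comm _ _) (∑-* elements _ _) ⟨
    ⟦ suc x ⟧ * E (λ L → I A W (suc a) L)
      ≈⟨ *-congˡ (upper-count lA lW (≡.trans (≡.cong suc eq) (≡.sym (ℕ.+-suc a (suc x)))) A⊑W) ⟩
    ⟦ suc x ⟧ * ⟦ suc (suc x) ⟧ ∎)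
    where
    I : V → V → ℕ → V → Carrier
    I A B m W = 𝟙 (Interval? A B m W)

  ζ : V → V → Carrier
  ζ W W′ = 𝟙 (W ⊑? W′)

  δ : V → V → Carrier
  δ W W′ = 𝟙 (W ≟ᵛ W′)

  module FixedInterval {a b A B} (lA : Level a A) (lB : Level b B) (A⊑B : A ⊑ B) where

    χ : ℕ → V → Carrier
    χ m W = 𝟙 (Interval? A B m W)

    χ≥0 : ∀ m W → 0# ≤ χ m W
    χ≥0 m W = 𝟙≥0 (Interval? A B m W)

    up-count : ∀ {m y W} → Interval A B m W → b ≡ m ℕ.+ y → E (λ Y → χ (suc m) Y * ζ W Y) ≈ ⟦ y ⟧
    up-count {m} {y} {W} (lW , A⊑W , W⊑B) eq = trans
      (E-cong (λ Y → trans (sym (𝟙-× (Interval? A B (suc m) Y) (W ⊑? Y)))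
        (𝟙-cong (Interval? A B (suc m) Y ×-dec W ⊑? Y) (Interval? W B (suc m) Y)
          (λ ((lY , _ , Y⊑B) , W⊑Y) → lY , W⊑Y , Y⊑B)
          (λ (lY , W⊑Y , Y⊑B) → (lY , ⊑-trans A⊑W W⊑Y , Y⊑B) , W⊑Y))))
      (upper-count lW lB eq W⊑B)

    down-count : ∀ {m x W} → Interval A B (suc m) W → m ≡ a ℕ.+ x → E (λ X → χ m X * ζ X W) ≈ ⟦ suc x ⟧
    down-count {m} {x} {W} (lW , A⊑W , W⊑B) eq = trans
      (E-cong (λ X → trans (sym (𝟙-× (Interval? A B m X) (X ⊑? W)))
        (𝟙-cong (Interval? A B m X ×-dec X ⊑? W) (Interval? A W m X)
          (λ ((lX , A⊑X , _) , X⊑W) → lX , A⊑X , X⊑W)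
          (λ (lX , A⊑X , X⊑W) → (lX , A⊑X , ⊑-trans X⊑W W⊑B) , X⊑W))))
      (lower-count x lA lW A⊑W eq)

    up-kernel : ℕ → V → V → Carrier
    up-kernel m W W′ = E (λ Y → χ (suc m) Y * (ζ W Y * ζ W′ Y))

    down-kernel : ℕ → V → V → Carrier
    down-kernel m W W′ = E (λ X → χ m X * (ζ X W * ζ X W′))

    -- Entrywise form of up* up + [x+1] = down* down + [y]. On the diagonal the two products count
    -- the [y] upper and the [x+1] lower covers of W; off the diagonal they agree by
    -- `common-covers`. Both corrections are added, so no signs occur.
    kernels : ∀ {m x y W W′} → suc m ≡ a ℕ.+ suc x → b ≡ suc m ℕ.+ y →
              Interval A B (suc m) W → Interval A B (suc m) W′ →
              up-kernel (suc m) W W′ + ⟦ suc x ⟧ * δ W W′ ≈ down-kernel m W W′ + ⟦ y ⟧ * δ W W′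
    kernels {m} {x} {y} {W} {W′} eq eq′ iW@(lW , A⊑W , W⊑B) iW′@(lW′ , A⊑W′ , W′⊑B) with W ≟ᵛ W′
    ... | yes ≡.refl = begin
      up-kernel (suc m) W W + ⟦ suc x ⟧ * 1#   ≈⟨ +-cong up (*-identityʳ _) ⟩
      ⟦ y ⟧ + ⟦ suc x ⟧                        ≈⟨ +-comm _ _ ⟩
      ⟦ suc x ⟧ + ⟦ y ⟧                        ≈⟨ +-cong down (*-identityʳ _) ⟨
      down-kernel m W W + ⟦ y ⟧ * 1#           ∎
      where
      up : up-kernel (suc m) W W ≈ ⟦ y ⟧
      up = trans (E-cong (λ Y → *-congˡ (𝟙-idem (W ⊑? Y)))) (up-count iW eq′)
      down : down-kernel m W W ≈ ⟦ suc x ⟧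
      down = trans (E-cong (λ X → *-congˡ (𝟙-idem (X ⊑? W))))
                   (down-count iW (ℕ.suc-injective (≡.trans eq (ℕ.+-suc a x))))
    ... | no W≢W′ = +-cong kernel (trans (zeroʳ _) (sym (zeroʳ _)))
      where
      joins : ∀ Y → χ (suc (suc m)) Y * (ζ W Y * ζ W′ Y) ≈ 𝟙 (JoinsIn? B W W′ (suc (suc m)) Y)
      joins Y = trans (trans (*-congˡ (sym (𝟙-× (W ⊑? Y) (W′ ⊑? Y)))) (sym (𝟙-× (Interval? A B (suc (suc m)) Y) (W ⊑? Y ×-dec W′ ⊑? Y))))
        (𝟙-cong (Interval? A B (suc (suc m)) Y ×-dec (W ⊑? Y ×-dec W′ ⊑? Y)) (JoinsIn? B W W′ (suc (suc m)) Y)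
          (λ ((lY , _ , Y⊑B) , W⊑Y , W′⊑Y) → lY , W⊑Y , W′⊑Y , Y⊑B)
          (λ (lY , W⊑Y , W′⊑Y , Y⊑B) → (lY , ⊑-trans A⊑W W⊑Y , Y⊑B) , W⊑Y , W′⊑Y))
      meets : ∀ X → χ m X * (ζ X W * ζ X W′) ≈ 𝟙 (MeetsIn? A W W′ m X)
      meets X = trans (trans (*-congˡ (sym (𝟙-× (X ⊑? W) (X ⊑? W′)))) (sym (𝟙-× (Interval? A B m X) (X ⊑? W ×-dec X ⊑? W′))))
        (𝟙-cong (Interval? A B m X ×-dec (X ⊑? W ×-dec X ⊑? W′)) (MeetsIn? A W W′ m X)
          (λ ((lX , A⊑X , _) , X⊑W , X⊑W′) → lX , X⊑W , X⊑W′ , A⊑X)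
          (λ (lX , X⊑W , X⊑W′ , A⊑X) → (lX , A⊑X , ⊑-trans X⊑W W⊑B) , X⊑W , X⊑W′))
      kernel : up-kernel (suc m) W W′ ≈ down-kernel m W W′
      kernel = begin
        up-kernel (suc m) W W′                          ≈⟨ E-cong joins ⟩
        E (λ Y → 𝟙 (JoinsIn? B W W′ (suc (suc m)) Y))    ≈⟨ trans (sym (fromℕ-∑𝟙 (JoinsIn? B W W′ (suc (suc m))) elements))
                                                             (trans (≈-reflexive (≡.cong fromℕ (common-covers lB lW lW′ W≢W′ A⊑W A⊑W′ W⊑B W′⊑B)))
                                                                    (fromℕ-∑𝟙 (MeetsIn? A W W′ m) elements)) ⟩
        E (λ X → 𝟙 (MeetsIn? A W W′ m X))               ≈⟨ E-cong meets ⟨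
        down-kernel m W W′                              ∎

    mean : ℕ → (V → Carrier) → Carrier
    mean m f = E (λ W → χ m W * f W)

    energy : ℕ → (V → Carrier) → Carrier
    energy m f = E (λ W → χ m W * (f W * f W))

    energy≥0 : ∀ m f → 0# ≤ energy m f
    energy≥0 m f = ∑-nonneg elements (λ W → χ≥0 m W *≥ square-nonneg (f W))

    form : ℕ → (V → Carrier) → (V → V → Carrier) → Carrier
    form m f k = E (λ W → E (λ W′ → (χ m W * f W) * (χ m W′ * f W′) * k W W′))

    form-+ : ∀ m f k k′ → form m f (λ W W′ → k W W′ + k′ W W′) ≈ form m f k + form m f k′
    form-+ m f k k′ = trans (E-cong (λ W → trans (E-cong (λ W′ → distribˡ _ _ _)) (∑-+ elements _ _))) (∑-+ elements _ _)

    form-cong : ∀ m f {k k′} → (∀ {W W′} → Interval A B m W → Interval A B m W′ → k W W′ ≈ k′ W W′) →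
                form m f k ≈ form m f k′
    form-cong m f {k} {k′} h = E-cong (λ W → E-cong (λ W′ → begin
      (χ m W * f W) * (χ m W′ * f W′) * k W W′    ≈⟨ regroup (χ m W) (f W) (χ m W′) (f W′) (k W W′) ⟩
      χ m W * (χ m W′ * (f W * f W′ * k W W′))
        ≈⟨ 𝟙*-cong (Interval? A B m W) (λ i → 𝟙*-cong (Interval? A B m W′) (λ i′ → *-congˡ (h i i′))) ⟩
      χ m W * (χ m W′ * (f W * f W′ * k′ W W′))   ≈⟨ regroup (χ m W) (f W) (χ m W′) (f W′) (k′ W W′) ⟨
      (χ m W * f W) * (χ m W′ * f W′) * k′ W W′   ∎))
      where
      regroup : ∀ u f v g k → (u * f) * (v * g) * k ≈ u * (v * (f * g * k))
      regroup = solve 5 (λ u f v g k → (u :* f) :* (v :* g) :* k := u :* (v :* (f :* g :* k))) refl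

    form-δ : ∀ m f s → form m f (λ W W′ → s * δ W W′) ≈ s * energy m f
    form-δ m f s = begin
      E (λ W → E (λ W′ → (χ m W * f W) * (χ m W′ * f W′) * (s * δ W W′)))
        ≈⟨ E-cong (λ W → E-cong (λ W′ → solve 4 (λ u v s d → u :* v :* (s :* d) := d :* (u :* v :* s)) refl
             (χ m W * f W) (χ m W′ * f W′) s (δ W W′))) ⟩
      E (λ W → E (λ W′ → δ W W′ * ((χ m W * f W) * (χ m W′ * f W′) * s)))
        ≈⟨ E-cong (λ W → E-unique (λ W′ → W ≟ᵛ W′) (λ W′ → (χ m W * f W) * (χ m W′ * f W′) * s) ≡.refl ≡.sym) ⟩
      E (λ W → (χ m W * f W) * (χ m W * f W) * s)
        ≈⟨ E-cong (λ W → solve 3 (λ u f s → (u :* f) :* (u :* f) :* s := s :* ((u :* u) :* (f :* f))) refl (χ m W) (f W) s) ⟩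
      E (λ W → s * ((χ m W * χ m W) * (f W * f W)))
        ≈⟨ E-cong (λ W → *-congˡ (*-congʳ (𝟙-idem (Interval? A B m W)))) ⟩
      E (λ W → s * (χ m W * (f W * f W)))
        ≈⟨ *-∑ elements _ s ⟨
      s * energy m f ∎

    transfer : ℕ → (V → Carrier) → (V → V → Carrier) → V → Carrier
    transfer m f z Y = E (λ W → (χ m W * f W) * z W Y)

    -- ‖Z f‖² = ⟨f , Z* Z f⟩ for the operator Z with matrix `z`. It applies to `up` and `down`
    -- alike.
    energy-transfer : ∀ n m f z → energy n (transfer m f z) ≈ form m f (λ W W′ → E (λ Y → χ n Y * (z W Y * z W′ Y)))
    energy-transfer n m f z = begin
      E (λ Y → χ n Y * (transfer m f z Y * transfer m f z Y))
        ≈⟨ E-cong (λ Y → trans (*-congˡ (*-∑-*-∑ elements elements _ _)) (trans (*-∑ elements _ _) (E-cong (λ W → *-∑ elements _ _)))) ⟩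
      E (λ Y → E (λ W → E (λ W′ → χ n Y * ((g W * z W Y) * (g W′ * z W′ Y)))))
        ≈⟨ trans (∑-comm elements elements _) (E-cong (λ W → ∑-comm elements elements _)) ⟩
      E (λ W → E (λ W′ → E (λ Y → χ n Y * ((g W * z W Y) * (g W′ * z W′ Y)))))
        ≈⟨ E-cong (λ W → E-cong (λ W′ → trans (*-∑ elements _ _) (E-cong (λ Y →
             solve 5 (λ c g s h t → g :* h :* (c :* (s :* t)) := c :* ((g :* s) :* (h :* t))) refl
               (χ n Y) (g W) (z W Y) (g W′) (z W′ Y))))) ⟨
      form m f (λ W W′ → E (λ Y → χ n Y * (z W Y * z W′ Y))) ∎
      where g = λ W → χ m W * f W

    up : ℕ → (V → Carrier) → V → Carrier
    up m f = transfer m f ζ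

    down : ℕ → (V → Carrier) → V → Carrier
    down m f = transfer (suc m) f (λ W X → ζ X W)

    adjoint : ∀ m f g → E (λ X → χ m X * (g X * down m f X)) ≈ E (λ W → χ (suc m) W * (f W * up m g W))
    adjoint m f g = begin
      E (λ X → χ m X * (g X * down m f X))
        ≈⟨ E-cong (λ X → trans (sym (*-assoc _ _ _)) (*-∑ elements _ _)) ⟩
      E (λ X → E (λ W → χ m X * g X * ((χ (suc m) W * f W) * ζ X W)))
        ≈⟨ ∑-comm elements elements _ ⟩
      E (λ W → E (λ X → χ m X * g X * ((χ (suc m) W * f W) * ζ X W)))
        ≈⟨ E-cong (λ W → trans (trans (sym (*-assoc _ _ _)) (*-∑ elements _ _)) (E-cong (λ X →
             solve 3 (λ u v z → v :* (u :* z) := u :* (v :* z)) refl (χ m X * g X) (χ (suc m) W * f W) (ζ X W)))) ⟨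
      E (λ W → χ (suc m) W * (f W * up m g W)) ∎

    -- Its purpose is to keep mean zero under `down`, so that the induction hypothesis of `up-bound`
    -- applies to `down m f`.
    mean-down : ∀ {m x} f → m ≡ a ℕ.+ x → mean m (down m f) ≈ ⟦ suc x ⟧ * mean (suc m) f
    mean-down {m} {x} f eq = begin
      E (λ X → χ m X * E (λ W → (χ (suc m) W * f W) * ζ X W))
        ≈⟨ E-cong (λ X → *-∑ elements _ _) ⟩
      E (λ X → E (λ W → χ m X * ((χ (suc m) W * f W) * ζ X W)))
        ≈⟨ ∑-comm elements elements _ ⟩
      E (λ W → E (λ X → χ m X * ((χ (suc m) W * f W) * ζ X W)))
        ≈⟨ E-cong (λ W → trans (E-cong (λ X → regroup (χ m X) (χ (suc m) W) (f W) (ζ X W)))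
             (trans (sym (*-∑ elements _ _)) (*-congˡ (sym (*-∑ elements _ _))))) ⟩
      E (λ W → χ (suc m) W * (f W * E (λ X → χ m X * ζ X W)))
        ≈⟨ E-cong (λ W → 𝟙*-cong (Interval? A B (suc m) W) (λ i → *-congˡ (down-count i eq))) ⟩
      E (λ W → χ (suc m) W * (f W * ⟦ suc x ⟧))
        ≈⟨ trans (*-∑ elements _ _) (E-cong (λ W → solve 3 (λ s u f → s :* (u :* f) := u :* (f :* s)) refl ⟦ suc x ⟧ (χ (suc m) W) (f W))) ⟨
      ⟦ suc x ⟧ * mean (suc m) f ∎
      where
      regroup : ∀ u v f z → u * ((v * f) * z) ≈ v * (f * (u * z))
      regroup = solve 4 (λ u v f z → u :* ((v :* f) :* z) := v :* (f :* (u :* z))) refl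

    -- The eigenvalues of up followed by down, on functions of mean zero, are at
    -- most [x] [y] - [x], as up* up + [x] = down* down + [y].
    up-bound : ∀ x {y m} f → m ≡ a ℕ.+ x → b ≡ m ℕ.+ y → mean m f ≈ 0# →
               energy (suc m) (up m f) + ⟦ x ⟧ * energy m f ≤ ⟦ x ⟧ * ⟦ y ⟧ * energy m f
    -- At height 0 the level consists of A alone, so mean zero forces f to vanish there.
    up-bound zero {y} {m} f eq eq′ mean≈0 = ≤-reflexive (begin
      energy (suc m) (up m f) + ⟦ 0 ⟧ * energy m f   ≈⟨ +-cong up≈0 (zeroˡ _) ⟩
      0# + 0#                                       ≈⟨ +-identityʳ _ ⟩
      0#                                            ≈⟨ trans (*-congʳ (zeroˡ _)) (zeroˡ _) ⟨
      ⟦ 0 ⟧ * ⟦ y ⟧ * energy m f                      ∎)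
      where
      lA′ : Level m A
      lA′ = Level-cast (≡.sym (≡.trans eq (ℕ.+-identityʳ a))) lA
      only-A : ∀ {W} → Interval A B m W → W ≡ A
      only-A (lW , A⊑W , _) = ≡.sym (Level-≡ lA′ lW A⊑W)
      fA≈0 : f A ≈ 0#
      fA≈0 = trans (sym (E-unique (Interval? A B m) f (lA′ , ⊑-refl , A⊑B) only-A)) mean≈0
      χf≈0 : ∀ W → χ m W * f W ≈ 0#
      χf≈0 W = 𝟙*-zero (Interval? A B m W) (λ i → ≡.subst (λ Z → f Z ≈ 0#) (≡.sym (only-A i)) fA≈0)
      up≈0 : energy (suc m) (up m f) ≈ 0#
      up≈0 = trans (energy-transfer (suc m) m f ζ) (∑-zero elements (λ W → ∑-zero elements (λ W′ →
        trans (*-congʳ (trans (*-congʳ (χf≈0 W)) (zeroˡ _))) (zeroˡ _))))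
    up-bound (suc x) {y} {zero} f eq eq′ mean≈0 = contradiction (≡.trans eq (ℕ.+-suc a x)) λ ()
    up-bound (suc x) {y} {suc m} f eq eq′ mean≈0 = ≤-respˡ (sym sl₂) (by-difference (⟦y⟧≥0-x≤) (begin
      ⟦ suc x ⟧ * ⟦ y ⟧ * F                              ≈⟨ *-congʳ (*-congʳ (⟦suc⟧ x)) ⟩
      (1# + Q * ⟦ x ⟧) * ⟦ y ⟧ * F
        ≈⟨ solve 5 (λ q x y f d → (κ 1 :+ q :* x) :* y :* f := d :+ y :* f :+ (x :* (q :* y) :* f :- d)) refl Q ⟦ x ⟧ ⟦ y ⟧ F D ⟩
      D + ⟦ y ⟧ * F + (⟦ x ⟧ * (Q * ⟦ y ⟧) * F - D)      ∎))
      where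
      eq₁ : m ≡ a ℕ.+ x
      eq₁ = ℕ.suc-injective (≡.trans eq (ℕ.+-suc a x))
      F = energy (suc m) f
      h = down m f
      D = energy m h
      U = energy (suc m) (up m h)
      -- The relation between up* up and down* down, an analogue of the commutation relation of sl₂,
      -- evaluated on f.
      sl₂ : energy (suc (suc m)) (up (suc m) f) + ⟦ suc x ⟧ * F ≈ D + ⟦ y ⟧ * F
      sl₂ = begin
        energy (suc (suc m)) (up (suc m) f) + ⟦ suc x ⟧ * F
          ≈⟨ +-cong (energy-transfer (suc (suc m)) (suc m) f ζ) (sym (form-δ (suc m) f ⟦ suc x ⟧)) ⟩
        form (suc m) f (up-kernel (suc m)) + form (suc m) f (λ W W′ → ⟦ suc x ⟧ * δ W W′)
          ≈⟨ form-+ (suc m) f _ _ ⟨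
        form (suc m) f (λ W W′ → up-kernel (suc m) W W′ + ⟦ suc x ⟧ * δ W W′)
          ≈⟨ form-cong (suc m) f (λ i i′ → kernels eq eq′ i i′) ⟩
        form (suc m) f (λ W W′ → down-kernel m W W′ + ⟦ y ⟧ * δ W W′)
          ≈⟨ form-+ (suc m) f _ _ ⟩
        form (suc m) f (down-kernel m) + form (suc m) f (λ W W′ → ⟦ y ⟧ * δ W W′)
          ≈⟨ +-cong (sym (energy-transfer m (suc m) f (λ W X → ζ X W))) (form-δ (suc m) f ⟦ y ⟧) ⟩
        D + ⟦ y ⟧ * F ∎
      -- The induction hypothesis for h = down f, one level lower and hence of depth y + 1: the
      -- factor [x] [y+1] - [x] equals [x] q [y].
      U≤ : U ≤ ⟦ x ⟧ * (Q * ⟦ y ⟧) * D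
      U≤ = by-difference (x-y≥0 (up-bound x h eq₁ (≡.trans eq′ (≡.sym (ℕ.+-suc m y)))
             (trans (mean-down f eq₁) (trans (*-congˡ mean≈0) (zeroʳ _))))) (begin
        ⟦ x ⟧ * (Q * ⟦ y ⟧) * D
          ≈⟨ solve 5 (λ q x y d u → x :* (q :* y) :* d := u :+ (x :* (κ 1 :+ q :* y) :* d :- (u :+ x :* d))) refl Q ⟦ x ⟧ ⟦ y ⟧ D U ⟩
        U + (⟦ x ⟧ * (1# + Q * ⟦ y ⟧) * D - (U + ⟦ x ⟧ * D))
          ≈⟨ +-congˡ (+-congʳ (*-congʳ (*-congˡ (⟦suc⟧ y)))) ⟨
        U + (⟦ x ⟧ * ⟦ suc y ⟧ * D - (U + ⟦ x ⟧ * D)) ∎)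
      -- By adjointness ‖h‖² = ⟨f , up h⟩, so Cauchy-Schwarz turns the bound on `up` into one on
      -- `down`; dividing by ‖h‖² leaves ‖down f‖² ≤ [x] q [y] ‖f‖².
      D²≤ : D * D ≤ F * U
      D²≤ = ≤-respˡ (*-cong (sym D≈) (sym D≈)) (cauchy-schwarz elements (χ (suc m)) f (up m h) (χ≥0 (suc m)))
        where
        D≈ : D ≈ E (λ W → χ (suc m) W * (f W * up m h W))
        D≈ = adjoint m f h
      c≥0 : 0# ≤ ⟦ x ⟧ * (Q * ⟦ y ⟧)
      c≥0 = ⟦⟧≥0 x *≥ (fromℕ≥0 q *≥ ⟦⟧≥0 y)
      D≤ : D ≤ ⟦ x ⟧ * (Q * ⟦ y ⟧) * F
      D≤ with D ≟ 0#
      ... | yes D≈0 = ≤-respˡ (sym D≈0) (c≥0 *≥ energy≥0 (suc m) f)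
      ... | no D≉0  = *-cancel-≤ (energy≥0 m h , D≉0) (≤-trans D²≤
              (≤-respʳ (solve 3 (λ f c d → f :* (c :* d) := d :* (c :* f)) refl F (⟦ x ⟧ * (Q * ⟦ y ⟧)) D)
                (*-monoˡ-≤ (energy≥0 (suc m) f) U≤)))
      ⟦y⟧≥0-x≤ : 0# ≤ ⟦ x ⟧ * (Q * ⟦ y ⟧) * F - D
      ⟦y⟧≥0-x≤ = x-y≥0 D≤

-- Inclusions between two distant levels of an interval.

module InclusionBound {c ℓ₁ ℓ₂} (K : RealClosedField c ℓ₁ ℓ₂) {q d} (G : Geometry q d) where
  open OrderedField K
  open Geometry G
  open GeometrySpectrum K G
  open import Relation.Binary.Reasoning.Setoid setoid

  -- The Gaussian binomial coefficient [ x + y choose x ].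
  binomial : ℕ → ℕ → Carrier
  binomial zero    y = 1#
  binomial (suc x) y = binomial x (suc y) * ⟦ suc y ⟧ / ⟦ suc x ⟧

  binomial>0 : ∀ x y → Positive (binomial x y)
  binomial>0 zero    y = pos-1
  binomial>0 (suc x) y = pos-* (pos-* (binomial>0 x (suc y)) (⟦suc⟧>0 y)) (pos-⁻¹ (⟦suc⟧>0 x))

  binomial-suc : ∀ x y → ⟦ suc x ⟧ * binomial (suc x) y ≈ binomial x (suc y) * ⟦ suc y ⟧
  binomial-suc x y = */ (proj₂ (⟦suc⟧>0 x)) _

  -- The recursion in the second argument. In `energy-up` one of the two degrees of the inclusion
  -- relation grows by `binomial-suc` and the other by this.
  binomial-sucʳ : ∀ x y → ⟦ suc y ⟧ * binomial x (suc y) ≈ binomial x y * ⟦ suc (x ℕ.+ y) ⟧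
  binomial-sucʳ zero    y = trans (*-identityʳ _) (sym (*-identityˡ _))
  binomial-sucʳ (suc x) y = *-cancel-≈ (proj₂ (⟦suc⟧>0 x)) (begin
    ⟦ suc x ⟧ * (⟦ suc y ⟧ * binomial (suc x) (suc y))
      ≈⟨ solve 3 (λ s t b → s :* (t :* b) := t :* (s :* b)) refl ⟦ suc x ⟧ ⟦ suc y ⟧ (binomial (suc x) (suc y)) ⟩
    ⟦ suc y ⟧ * (⟦ suc x ⟧ * binomial (suc x) (suc y))
      ≈⟨ *-congˡ (trans (binomial-suc x (suc y)) (trans (*-comm _ _) (binomial-sucʳ x (suc y)))) ⟩
    ⟦ suc y ⟧ * (binomial x (suc y) * ⟦ suc (x ℕ.+ suc y) ⟧)
      ≈⟨ *-congˡ (*-congˡ (≈-reflexive (≡.cong (λ n → ⟦ suc n ⟧) (ℕ.+-suc x y)))) ⟩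
    ⟦ suc y ⟧ * (binomial x (suc y) * ⟦ suc (suc x ℕ.+ y) ⟧)
      ≈⟨ solve 3 (λ t b u → t :* (b :* u) := (b :* t) :* u) refl ⟦ suc y ⟧ (binomial x (suc y)) ⟦ suc (suc x ℕ.+ y) ⟧ ⟩
    (binomial x (suc y) * ⟦ suc y ⟧) * ⟦ suc (suc x ℕ.+ y) ⟧
      ≈⟨ *-congʳ (binomial-suc x y) ⟨
    (⟦ suc x ⟧ * binomial (suc x) y) * ⟦ suc (suc x ℕ.+ y) ⟧
      ≈⟨ *-assoc _ _ _ ⟩
    ⟦ suc x ⟧ * (binomial (suc x) y * ⟦ suc (suc x ℕ.+ y) ⟧) ∎)

  binomial-0ʳ : ∀ x → binomial x 0 ≈ 1#
  binomial-0ʳ zero    = refl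
  binomial-0ʳ (suc x) = *-cancel-≈ (proj₂ (⟦suc⟧>0 x)) (begin
    ⟦ suc x ⟧ * binomial (suc x) 0      ≈⟨ binomial-suc x 0 ⟩
    binomial x 1 * ⟦ 1 ⟧                ≈⟨ *-comm _ _ ⟩
    ⟦ 1 ⟧ * binomial x 1                ≈⟨ binomial-sucʳ x 0 ⟩
    binomial x 0 * ⟦ suc (x ℕ.+ 0) ⟧    ≈⟨ *-cong (binomial-0ʳ x) (≈-reflexive (≡.cong (λ n → ⟦ suc n ⟧) (ℕ.+-identityʳ x))) ⟩
    1# * ⟦ suc x ⟧                      ≈⟨ *-comm _ _ ⟩
    ⟦ suc x ⟧ * 1#                      ∎)

  -- Double counting of the covers X ⋖ W between consecutive levels: W has [x+1] lower covers and X
  -- has [y+1] upper ones, which is the recursion of `binomial`.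
  interval-count : ∀ x {y a m b A B} → Level a A → Level b B → A ⊑ B → m ≡ a ℕ.+ x → b ≡ m ℕ.+ y →
                   E (λ W → 𝟙 (Interval? A B m W)) ≈ binomial x y
  interval-count zero {y} {a} {m} {A = A} {B} lA lB A⊑B eq eq′ =
    E-unique-1 (Interval? A B m) (lA′ , ⊑-refl , A⊑B) (λ (lW , A⊑W , _) → ≡.sym (Level-≡ lA′ lW A⊑W))
    where
    lA′ : Level m A
    lA′ = Level-cast (≡.sym (≡.trans eq (ℕ.+-identityʳ a))) lA
  interval-count (suc x) {y} {a} {zero} lA lB A⊑B eq eq′ = contradiction (≡.trans eq (ℕ.+-suc a x)) λ ()
  interval-count (suc x) {y} {a} {suc m} lA lB A⊑B eq eq′ = *-cancel-≈ (proj₂ (⟦suc⟧>0 x)) (begin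
    ⟦ suc x ⟧ * E (χ (suc m))                                    ≈⟨ trans (*-comm _ _) (∑-* elements _ _) ⟩
    E (λ W → χ (suc m) W * ⟦ suc x ⟧)
      ≈⟨ E-cong (λ W → 𝟙*-cong (Interval? _ _ (suc m) W) (λ i → down-count i eq₁)) ⟨
    E (λ W → χ (suc m) W * E (λ X → χ m X * ζ X W))              ≈⟨ E-cong (λ W → *-∑ elements _ _) ⟩
    E (λ W → E (λ X → χ (suc m) W * (χ m X * ζ X W)))            ≈⟨ ∑-comm elements elements _ ⟩
    E (λ X → E (λ W → χ (suc m) W * (χ m X * ζ X W)))
      ≈⟨ E-cong (λ X → trans (*-∑ elements _ _) (E-cong (λ W →
           solve 3 (λ u v z → u :* (v :* z) := v :* (u :* z)) refl (χ m X) (χ (suc m) W) (ζ X W)))) ⟨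
    E (λ X → χ m X * E (λ W → χ (suc m) W * ζ X W))
      ≈⟨ E-cong (λ X → 𝟙*-cong (Interval? _ _ m X) (λ i → up-count i (≡.trans eq′ (≡.sym (ℕ.+-suc m y))))) ⟩
    E (λ X → χ m X * ⟦ suc y ⟧)                                  ≈⟨ ∑-* elements _ _ ⟨
    E (χ m) * ⟦ suc y ⟧
      ≈⟨ *-congʳ (interval-count x lA lB A⊑B eq₁ (≡.trans eq′ (≡.sym (ℕ.+-suc m y)))) ⟩
    binomial x (suc y) * ⟦ suc y ⟧                               ≈⟨ binomial-suc x y ⟨
    ⟦ suc x ⟧ * binomial (suc x) y                               ∎)
    where
    open FixedInterval lA lB A⊑B
    eq₁ : m ≡ a ℕ.+ x
    eq₁ = ℕ.suc-injective (≡.trans eq (ℕ.+-suc a x))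

  module Iterated {a b A B} (lA : Level a A) (lB : Level b B) (A⊑B : A ⊑ B)
                  {x₀ n} (n≡a+x₀ : n ≡ a ℕ.+ x₀) where
    open FixedInterval lA lB A⊑B

    energy-cong : ∀ m {f g} → (∀ {W} → Interval A B m W → f W ≈ g W) → energy m f ≈ energy m g
    energy-cong m h = E-cong (λ W → 𝟙*-cong (Interval? A B m W) (λ i → *-cong (h i) (h i)))

    energy-scale : ∀ m s f → energy m (λ W → s * f W) ≈ s * s * energy m f
    energy-scale m s f = trans
      (E-cong (λ W → solve 3 (λ u s f → u :* (s :* f :* (s :* f)) := s :* s :* (u :* (f :* f))) refl (χ m W) s (f W)))
      (sym (*-∑ elements _ _))

    up-same-level : ∀ f {W} → Interval A B n W → up n f W ≈ f W
    up-same-level f {W} iW@(lW , _ , _) = trans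
      (E-cong (λ U → trans (solve 3 (λ u f z → u :* f :* z := (u :* z) :* f) refl (χ n U) (f U) (ζ U W))
                           (*-congʳ (sym (𝟙-× (Interval? A B n U) (U ⊑? W))))))
      (E-unique (λ U → Interval? A B n U ×-dec U ⊑? W) f (iW , ⊑-refl)
                (λ ((lU , _ , _) , U⊑W) → Level-≡ lU lW U⊑W))

    -- Every U ⊑ Y of codimension j + 1 lies in [j + 1] hyperplanes of Y.
    up-up : ∀ {j m} f {Y} → m ≡ n ℕ.+ j → Interval A B (suc m) Y → up m (up n f) Y ≈ ⟦ suc j ⟧ * up n f Y
    up-up {j} {m} f {Y} eq (lY , A⊑Y , Y⊑B) = begin
      E (λ W → (χ m W * E (λ U → g U * ζ U W)) * ζ W Y)
        ≈⟨ E-cong (λ W → trans (*-congʳ (*-∑ elements _ _)) (∑-* elements _ _)) ⟩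
      E (λ W → E (λ U → (χ m W * (g U * ζ U W)) * ζ W Y))
        ≈⟨ ∑-comm elements elements _ ⟩
      E (λ U → E (λ W → (χ m W * (g U * ζ U W)) * ζ W Y))
        ≈⟨ E-cong (λ U → trans (sym (*-assoc _ _ _)) (trans (*-∑ elements _ _) (E-cong (λ W →
             solve 5 (λ u f v z y → u :* f :* (v :* (z :* y)) := (v :* (u :* f :* z)) :* y) refl (χ n U) (f U) (χ m W) (ζ U W) (ζ W Y))))) ⟨
      E (λ U → χ n U * (f U * E (λ W → χ m W * (ζ U W * ζ W Y))))
        ≈⟨ E-cong (λ U → 𝟙*-cong (Interval? A B n U) (λ i → *-congˡ (count i))) ⟩
      E (λ U → χ n U * (f U * (ζ U Y * ⟦ suc j ⟧)))
        ≈⟨ E-cong (λ U → solve 4 (λ u f z s → u :* (f :* (z :* s)) := s :* (u :* f :* z)) refl (χ n U) (f U) (ζ U Y) ⟦ suc j ⟧) ⟩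
      E (λ U → ⟦ suc j ⟧ * (g U * ζ U Y))
        ≈⟨ *-∑ elements _ _ ⟨
      ⟦ suc j ⟧ * up n f Y ∎
      where
      g = λ U → χ n U * f U
      count : ∀ {U} → Interval A B n U → E (λ W → χ m W * (ζ U W * ζ W Y)) ≈ ζ U Y * ⟦ suc j ⟧
      count {U} (lU , A⊑U , U⊑B) = begin
        E (λ W → χ m W * (ζ U W * ζ W Y))
          ≈⟨ E-cong (λ W → trans (trans (*-congˡ (sym (𝟙-× (U ⊑? W) (W ⊑? Y)))) (sym (𝟙-× (Interval? A B m W) (U ⊑? W ×-dec W ⊑? Y))))
               (trans (𝟙-cong (Interval? A B m W ×-dec (U ⊑? W ×-dec W ⊑? Y)) (U ⊑? Y ×-dec Interval? U Y m W)
                        (λ ((lW , _ , _) , U⊑W , W⊑Y) → ⊑-trans U⊑W W⊑Y , lW , U⊑W , W⊑Y)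
                        (λ (_ , lW , U⊑W , W⊑Y) → (lW , ⊑-trans A⊑U U⊑W , ⊑-trans W⊑Y Y⊑B) , U⊑W , W⊑Y))
                      (𝟙-× (U ⊑? Y) (Interval? U Y m W)))) ⟩
        E (λ W → ζ U Y * 𝟙 (Interval? U Y m W))
          ≈⟨ *-∑ elements _ _ ⟨
        ζ U Y * E (λ W → 𝟙 (Interval? U Y m W))
          ≈⟨ 𝟙*-cong (U ⊑? Y) (λ U⊑Y → lower-count j lU lY U⊑Y eq) ⟩
        ζ U Y * ⟦ suc j ⟧ ∎

    above-count : ∀ {j m y U} → m ≡ n ℕ.+ j → b ≡ m ℕ.+ y → Interval A B n U → E (λ W → χ m W * ζ U W) ≈ binomial j y
    above-count {j} {m} {y} {U} eq eq′ (lU , A⊑U , U⊑B) = trans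
      (E-cong (λ W → trans (sym (𝟙-× (Interval? A B m W) (U ⊑? W)))
        (𝟙-cong (Interval? A B m W ×-dec U ⊑? W) (Interval? U B m W)
          (λ ((lW , _ , W⊑B) , U⊑W) → lW , U⊑W , W⊑B)
          (λ (lW , U⊑W , W⊑B) → (lW , ⊑-trans A⊑U U⊑W , W⊑B) , U⊑W))))
      (interval-count j lU lB U⊑B eq eq′)

    below-count : ∀ {j m W} → m ≡ n ℕ.+ j → Interval A B m W → E (λ U → χ n U * ζ U W) ≈ binomial x₀ j
    below-count {j} {m} {W} eq (lW , A⊑W , W⊑B) = trans
      (E-cong (λ U → trans (sym (𝟙-× (Interval? A B n U) (U ⊑? W)))
        (𝟙-cong (Interval? A B n U ×-dec U ⊑? W) (Interval? A W n U)
          (λ ((lU , A⊑U , _) , U⊑W) → lU , A⊑U , U⊑W)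
          (λ (lU , A⊑U , U⊑W) → (lU , A⊑U , ⊑-trans U⊑W W⊑B) , U⊑W))))
      (interval-count x₀ lA lW A⊑W n≡a+x₀ eq)

    mean-up : ∀ {j m y} f → m ≡ n ℕ.+ j → b ≡ m ℕ.+ y → mean m (up n f) ≈ binomial j y * mean n f
    mean-up {j} {m} {y} f eq eq′ = begin
      E (λ W → χ m W * E (λ U → (χ n U * f U) * ζ U W))     ≈⟨ E-cong (λ W → *-∑ elements _ _) ⟩
      E (λ W → E (λ U → χ m W * ((χ n U * f U) * ζ U W)))   ≈⟨ ∑-comm elements elements _ ⟩
      E (λ U → E (λ W → χ m W * ((χ n U * f U) * ζ U W)))
        ≈⟨ E-cong (λ U → trans (sym (*-assoc _ _ _)) (trans (*-∑ elements _ _) (E-cong (λ W →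
             solve 4 (λ u f v z → u :* f :* (v :* z) := v :* (u :* f :* z)) refl (χ n U) (f U) (χ m W) (ζ U W))))) ⟨
      E (λ U → χ n U * (f U * E (λ W → χ m W * ζ U W)))
        ≈⟨ E-cong (λ U → 𝟙*-cong (Interval? A B n U) (λ i → *-congˡ (above-count eq eq′ i))) ⟩
      E (λ U → χ n U * (f U * binomial j y))
        ≈⟨ trans (*-∑ elements _ _) (E-cong (λ U → solve 3 (λ s u f → s :* (u :* f) := u :* (f :* s)) refl (binomial j y) (χ n U) (f U))) ⟨
      binomial j y * mean n f ∎

    -- Induction on the number of levels. By `up-up` one further step multiplies the direct map by
    -- [j+1], and `up-bound` controls that step because mean zero survives `up`. The two binomials
    -- are the numbers of subspaces above and below a given one, so after normalisation the squared
    -- norm is at most q^(-j).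
    energy-up : ∀ j {m y} f → m ≡ n ℕ.+ j → b ≡ m ℕ.+ y → mean n f ≈ 0# →
                Q ^ j * energy m (up n f) ≤ binomial j y * binomial x₀ j * energy n f
    energy-up zero {m} {y} f eq eq′ mean≈0 = ≤-reflexive (begin
      1# * energy m (up n f)                   ≡⟨ ≡.cong (λ k → 1# * energy k (up n f)) (≡.trans eq (ℕ.+-identityʳ n)) ⟩
      1# * energy n (up n f)                   ≈⟨ *-congˡ (energy-cong n (up-same-level f)) ⟩
      1# * energy n f                          ≈⟨ *-congʳ (trans (*-identityˡ _) (binomial-0ʳ x₀)) ⟨
      1# * binomial x₀ 0 * energy n f          ∎)
    energy-up (suc j) {zero} f eq eq′ mean≈0 = contradiction (≡.trans eq (ℕ.+-suc n j)) λ ()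
    energy-up (suc j) {suc m} {y} f eq eq′ mean≈0 =
      *-cancel-≤ (pos-* (⟦suc⟧>0 j) (⟦suc⟧>0 j)) (≤-respˡ lhs (≤-respʳ rhs (≤-trans step₁ step₂)))
      where
      eq₁ : m ≡ n ℕ.+ j
      eq₁ = ℕ.suc-injective (≡.trans eq (ℕ.+-suc n j))
      eq₂ : b ≡ m ℕ.+ suc y
      eq₂ = ≡.trans eq′ (≡.sym (ℕ.+-suc m y))
      eq₃ : m ≡ a ℕ.+ (x₀ ℕ.+ j)
      eq₃ = ≡.trans eq₁ (≡.trans (≡.cong (ℕ._+ j) n≡a+x₀) (ℕ.+-assoc a x₀ j))
      x = x₀ ℕ.+ j
      s = up n f
      F = energy n f
      T = energy m s
      T′ = energy (suc m) s
      U = energy (suc m) (up m s)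
      U≤ : U ≤ ⟦ x ⟧ * (Q * ⟦ y ⟧) * T
      U≤ = by-difference (x-y≥0 (up-bound x s eq₃ eq₂ (trans (mean-up f eq₁ eq₂) (trans (*-congˡ mean≈0) (zeroʳ _))))) (begin
        ⟦ x ⟧ * (Q * ⟦ y ⟧) * T
          ≈⟨ solve 5 (λ q x y d u → x :* (q :* y) :* d := u :+ (x :* (κ 1 :+ q :* y) :* d :- (u :+ x :* d))) refl Q ⟦ x ⟧ ⟦ y ⟧ T U ⟩
        U + (⟦ x ⟧ * (1# + Q * ⟦ y ⟧) * T - (U + ⟦ x ⟧ * T))
          ≈⟨ +-congˡ (+-congʳ (*-congʳ (*-congˡ (⟦suc⟧ y)))) ⟨
        U + (⟦ x ⟧ * ⟦ suc y ⟧ * T - (U + ⟦ x ⟧ * T)) ∎)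
      -- The gain of 1/q in a single step: q · [x] q [y] is at most (1 + q [x]) (1 + q [y]) = [x+1]
      -- [y+1].
      QU≤ : Q * U ≤ ⟦ suc x ⟧ * ⟦ suc y ⟧ * T
      QU≤ = ≤-trans (*-monoˡ-≤ (fromℕ≥0 q) U≤) (by-difference ((1≥0 +≥ Qx≥0 +≥ Qy≥0) *≥ energy≥0 m s) (begin
        ⟦ suc x ⟧ * ⟦ suc y ⟧ * T                         ≈⟨ *-congʳ (*-cong (⟦suc⟧ x) (⟦suc⟧ y)) ⟩
        (1# + Q * ⟦ x ⟧) * (1# + Q * ⟦ y ⟧) * T
          ≈⟨ solve 4 (λ q x y t → (κ 1 :+ q :* x) :* (κ 1 :+ q :* y) :* t :=
               q :* (x :* (q :* y) :* t) :+ (κ 1 :+ q :* x :+ q :* y) :* t) refl Q ⟦ x ⟧ ⟦ y ⟧ T ⟩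
        Q * (⟦ x ⟧ * (Q * ⟦ y ⟧) * T) + (1# + Q * ⟦ x ⟧ + Q * ⟦ y ⟧) * T ∎))
        where
        Qx≥0 = fromℕ≥0 q *≥ ⟦⟧≥0 x
        Qy≥0 = fromℕ≥0 q *≥ ⟦⟧≥0 y
      Qʲ≥0 : 0# ≤ Q ^ j
      Qʲ≥0 = nonneg j
        where
        nonneg : ∀ j → 0# ≤ Q ^ j
        nonneg zero    = 1≥0
        nonneg (suc j) = fromℕ≥0 q *≥ nonneg j
      step₁ : Q ^ j * (Q * U) ≤ ⟦ suc x ⟧ * ⟦ suc y ⟧ * (Q ^ j * T)
      step₁ = ≤-respʳ (solve 4 (λ p s t e → p :* (s :* t :* e) := s :* t :* (p :* e)) refl (Q ^ j) ⟦ suc x ⟧ ⟦ suc y ⟧ T)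
                (*-monoˡ-≤ Qʲ≥0 QU≤)
      step₂ : ⟦ suc x ⟧ * ⟦ suc y ⟧ * (Q ^ j * T) ≤ ⟦ suc x ⟧ * ⟦ suc y ⟧ * (binomial j (suc y) * binomial x₀ j * F)
      step₂ = *-monoˡ-≤ (⟦⟧≥0 (suc x) *≥ ⟦⟧≥0 (suc y)) (energy-up j f eq₁ eq₂ mean≈0)
      U≈ : U ≈ ⟦ suc j ⟧ * ⟦ suc j ⟧ * T′
      U≈ = trans (energy-cong (suc m) (up-up f eq₁)) (energy-scale (suc m) ⟦ suc j ⟧ s)
      lhs : Q ^ j * (Q * U) ≈ ⟦ suc j ⟧ * ⟦ suc j ⟧ * (Q ^ suc j * T′)
      lhs = trans (*-congˡ (*-congˡ U≈))
        (solve 4 (λ p q s t → p :* (q :* (s :* s :* t)) := s :* s :* (q :* p :* t)) refl (Q ^ j) Q ⟦ suc j ⟧ T′)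
      rhs : ⟦ suc x ⟧ * ⟦ suc y ⟧ * (binomial j (suc y) * binomial x₀ j * F) ≈
            ⟦ suc j ⟧ * ⟦ suc j ⟧ * (binomial (suc j) y * binomial x₀ (suc j) * F)
      rhs = begin
        ⟦ suc x ⟧ * ⟦ suc y ⟧ * (binomial j (suc y) * binomial x₀ j * F)
          ≈⟨ solve 5 (λ s t p r f → s :* t :* (p :* r :* f) := (p :* t) :* (r :* s) :* f) refl
               ⟦ suc x ⟧ ⟦ suc y ⟧ (binomial j (suc y)) (binomial x₀ j) F ⟩
        (binomial j (suc y) * ⟦ suc y ⟧) * (binomial x₀ j * ⟦ suc x ⟧) * F
          ≈⟨ *-congʳ (*-cong (binomial-suc j y) (binomial-sucʳ x₀ j)) ⟨
        (⟦ suc j ⟧ * binomial (suc j) y) * (⟦ suc j ⟧ * binomial x₀ (suc j)) * F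
          ≈⟨ solve 4 (λ s p r f → (s :* p) :* (s :* r) :* f := s :* s :* (p :* r :* f)) refl
               ⟦ suc j ⟧ (binomial (suc j) y) (binomial x₀ (suc j)) F ⟩
        ⟦ suc j ⟧ * ⟦ suc j ⟧ * (binomial (suc j) y * binomial x₀ (suc j) * F) ∎

    module _ {ρ} (ρ>0 : Positive ρ) (ρρQ≈1 : ρ * ρ * Q ≈ 1#) where

      ρ^-inverse : ∀ j → ρ ^ j * ρ ^ j * Q ^ j ≈ 1#
      ρ^-inverse zero    = trans (*-identityʳ _) (*-identityʳ _)
      ρ^-inverse (suc j) = trans
        (solve 4 (λ r s q p → r :* s :* (r :* s) :* (q :* p) := (r :* r :* q) :* (s :* s :* p)) refl ρ (ρ ^ j) Q (Q ^ j))
        (trans (*-cong ρρQ≈1 (ρ^-inverse j)) (*-identityʳ _))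

      -- Expanding ‖up f - t g‖² ≥ 0 gives 2 t ⟨up f , g⟩ ≤ ‖up f‖² + t² ‖g‖². The first term is
      -- bounded by `energy-up`, where ρ^(2j) cancels q^j, and then t is divided out. The
      -- coefficients of the two energies are the degrees of the inclusion relation, that is, the
      -- vertex weights of the two colors up to a common factor.
      inclusion-bound : ∀ {j m y} f g → m ≡ n ℕ.+ j → b ≡ m ℕ.+ y → mean n f ≈ 0# →
        (1# + 1#) * E (λ W → χ m W * (up n f W * g W)) ≤
        ρ ^ j * (binomial j y * energy n f + binomial x₀ j * energy m g)
      inclusion-bound {j} {m} {y} f g eq eq′ mean≈0 = *-cancel-≤ t>0
        (by-difference (x-y≥0 T≤ +≥ square≥0) (begin
          t * (r * (n₁ * F + n₂ * H))
            ≈⟨ solve 7 (λ r n₁ n₂ f h p e → r :* n₂ :* (r :* (n₁ :* f :+ n₂ :* h)) :=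
                 r :* n₂ :* ((κ 1 :+ κ 1) :* p) :+ ((r :* r :* (n₁ :* n₂ :* f) :- e) :+ (e :- (κ 1 :+ κ 1) :* (r :* n₂) :* p :+ (r :* n₂) :* (r :* n₂) :* h)))
                 refl r n₁ n₂ F H P T ⟩
          t * ((1# + 1#) * P) + ((r * r * (n₁ * n₂ * F) - T) + (T - (1# + 1#) * t * P + t * t * H)) ∎))
        where
        r = ρ ^ j
        n₁ = binomial j y
        n₂ = binomial x₀ j
        s = up n f
        F = energy n f
        H = energy m g
        T = energy m s
        P = E (λ W → χ m W * (s W * g W))
        -- The choice that leaves the same factor t in both terms: r² n₁ n₂ F = t (r n₁ F) and t² H
        -- = t (r n₂ H).
        t = r * n₂
        t>0 : Positive t
        t>0 = pos-* (pos-^ j ρ>0) (binomial>0 x₀ j)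
        T≤ : T ≤ r * r * (n₁ * n₂ * F)
        T≤ = ≤-respˡ (begin
            r * r * (Q ^ j * T)   ≈⟨ *-assoc _ _ _ ⟨
            r * r * Q ^ j * T     ≈⟨ *-congʳ (ρ^-inverse j) ⟩
            1# * T                ≈⟨ *-identityˡ T ⟩
            T                     ∎)
          (*-monoˡ-≤ (square-nonneg r) (energy-up j f eq eq′ mean≈0))
        square≥0 : 0# ≤ T - (1# + 1#) * t * P + t * t * H
        square≥0 = ≤-respʳ (begin
            E (λ W → χ m W * ((s W - t * g W) * (s W - t * g W)))
              ≈⟨ E-cong (λ W → solve 4 (λ u s g t → u :* ((s :- t :* g) :* (s :- t :* g)) :=
                   u :* (s :* s) :+ (:- ((κ 1 :+ κ 1) :* t)) :* (u :* (s :* g)) :+ t :* t :* (u :* (g :* g))) refl (χ m W) (s W) (g W) t) ⟩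
            E (λ W → χ m W * (s W * s W) + (- ((1# + 1#) * t)) * (χ m W * (s W * g W)) + t * t * (χ m W * (g W * g W)))
              ≈⟨ trans (∑-+ elements _ _) (+-cong (trans (∑-+ elements _ _) (+-congˡ (sym (*-∑ elements _ _)))) (sym (*-∑ elements _ _))) ⟩
            T + (- ((1# + 1#) * t)) * P + t * t * H
              ≈⟨ solve 4 (λ e s p h → e :+ (:- s) :* p :+ h := e :- s :* p :+ h) refl T ((1# + 1#) * t) P (t * t * H) ⟩
            T - (1# + 1#) * t * P + t * t * H ∎)
          (∑-nonneg elements (λ W → χ≥0 m W *≥ square-nonneg (s W - t * g W)))

-- Finding the nearest color of a given kind.

module FinExtrema where
  open import Data.Fin.Base using (_≤_)
  open import Data.Nat.Base using (z≤n; s≤s)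

  least : ∀ {k p} {P : Fin k → Set p} → (∀ i → Dec (P i)) →
          (∀ i → ¬ P i) ⊎ (∃ λ i → P i × ∀ j → P j → i ≤ j)
  least {zero}  P? = inj₁ λ ()
  least {suc k} P? with P? zero
  ... | yes p = inj₂ (zero , p , λ _ _ → z≤n)
  ... | no ¬p with least (λ i → P? (suc i))
  ... | inj₁ none = inj₁ λ { zero → ¬p ; (suc i) → none i }
  ... | inj₂ (i , p , min) = inj₂ (suc i , p , λ { zero p₀ → contradiction p₀ ¬p ; (suc j) pj → s≤s (min j pj) })

  greatest : ∀ {k p} {P : Fin k → Set p} → (∀ i → Dec (P i)) →
             (∀ i → ¬ P i) ⊎ (∃ λ i → P i × ∀ j → P j → j ≤ i)
  greatest {zero}  P? = inj₁ λ ()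
  greatest {suc k} P? with greatest (λ i → P? (suc i))
  ... | inj₂ (i , p , max) = inj₂ (suc i , p , λ { zero _ → z≤n ; (suc j) pj → s≤s (max j pj) })
  ... | inj₁ none with P? zero
  ... | yes p = inj₂ (zero , p , λ { zero _ → z≤n ; (suc j) pj → contradiction pj (none j) })
  ... | no ¬p = inj₁ λ { zero → ¬p ; (suc i) → none i }

-- From sums over a link to sums over the complex.

module LinkSum {c ℓ₁ ℓ₂} (K : RealClosedField c ℓ₁ ℓ₂) where
  open OrderedField K
  open import Data.Fin.Subset using (Subset; inside; outside; _∈_; _⊆_; _∪_; _∩_; Nonempty)
  open import Data.Fin.Subset.Properties using (_⊆?_; nonempty?; drop-∷-⊆)
  open import Data.Vec.Base using ([]; _∷_; here; there)
  open import Relation.Binary.Reasoning.Setoid setoid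

  -- T ↦ T ∪ t is a bijection from the sets disjoint from t to those containing t.
  ∑-disjoint : ∀ {N} (t : Subset N) (h : Subset N → Carrier) →
    ∑ (subsets N) (λ T → 𝟙 (¬? (nonempty? (T ∩ t))) * h (T ∪ t)) ≈ ∑ (subsets N) (λ T → 𝟙 (t ⊆? T) * h T)
  ∑-disjoint {zero} [] h = +-congʳ (*-congʳ (trans (𝟙-yes (¬? (nonempty? [])) λ ()) (sym (𝟙-yes ([] ⊆? []) (λ z → z)))))
  ∑-disjoint {suc N} (x ∷ t) h = begin
    ∑ (subsets (suc N)) lhs
      ≈⟨ split lhs ⟩
    ∑ (subsets N) (λ T → lhs (outside ∷ T)) + ∑ (subsets N) (λ T → lhs (inside ∷ T))
      ≈⟨ halves x ⟩
    ∑ (subsets N) (λ T → rhs x (outside ∷ T)) + ∑ (subsets N) (λ T → rhs x (inside ∷ T))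
      ≈⟨ split (rhs x) ⟨
    ∑ (subsets (suc N)) (rhs x) ∎
    where
    lhs′ : ∀ x → Subset (suc N) → Carrier
    lhs′ x T = 𝟙 (¬? (nonempty? (T ∩ (x ∷ t)))) * h (T ∪ (x ∷ t))
    lhs = lhs′ x
    rhs : ∀ x → Subset (suc N) → Carrier
    rhs x T = 𝟙 ((x ∷ t) ⊆? T) * h T
    split : ∀ f → ∑ (subsets (suc N)) f ≈ ∑ (subsets N) (λ T → f (outside ∷ T)) + ∑ (subsets N) (λ T → f (inside ∷ T))
    split f = trans (∑-++ (List.map (outside ∷_) (subsets N)) _ f) (+-cong (∑-map (outside ∷_) (subsets N) f) (∑-map (inside ∷_) (subsets N) f))
    empty-tail : ∀ {T} y → ¬ Nonempty (T ∩ t) → ¬ Nonempty ((outside ∷ T) ∩ (y ∷ t))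
    empty-tail y e (suc i , there p) = e (i , p)
    empty-tail′ : ∀ {T} → ¬ Nonempty (T ∩ t) → ¬ Nonempty ((inside ∷ T) ∩ (outside ∷ t))
    empty-tail′ e (suc i , there p) = e (i , p)
    nonempty-tail : ∀ {T x y} → Nonempty (T ∩ t) → Nonempty ((x ∷ T) ∩ (y ∷ t))
    nonempty-tail (i , p) = suc i , there p
    ⊆-out : ∀ {T y} → t ⊆ T → (outside ∷ t) ⊆ (y ∷ T)
    ⊆-out t⊆T (there p) = there (t⊆T p)
    ⊆-in : ∀ {T} → t ⊆ T → (inside ∷ t) ⊆ (inside ∷ T)
    ⊆-in t⊆T here      = here
    ⊆-in t⊆T (there p) = there (t⊆T p)
    halves : ∀ x → ∑ (subsets N) (λ T → lhs′ x (outside ∷ T)) + ∑ (subsets N) (λ T → lhs′ x (inside ∷ T)) ≈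
                   ∑ (subsets N) (λ T → rhs x (outside ∷ T)) + ∑ (subsets N) (λ T → rhs x (inside ∷ T))
    halves outside = +-cong
      (trans (∑-cong (subsets N) (λ T → *-congʳ (𝟙-cong (¬? (nonempty? ((outside ∷ T) ∩ (outside ∷ t)))) (¬? (nonempty? (T ∩ t))) (λ e ne → e (nonempty-tail {T} {outside} {outside} ne)) (empty-tail outside))))
        (trans (∑-disjoint t (λ T → h (outside ∷ T)))
               (∑-cong (subsets N) (λ T → *-congʳ (𝟙-cong (t ⊆? T) ((outside ∷ t) ⊆? (outside ∷ T)) ⊆-out drop-∷-⊆)))))
      (trans (∑-cong (subsets N) (λ T → *-congʳ (𝟙-cong (¬? (nonempty? ((inside ∷ T) ∩ (outside ∷ t)))) (¬? (nonempty? (T ∩ t))) (λ e ne → e (nonempty-tail {T} {inside} {outside} ne)) empty-tail′)))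
        (trans (∑-disjoint t (λ T → h (inside ∷ T)))
               (∑-cong (subsets N) (λ T → *-congʳ (𝟙-cong (t ⊆? T) ((outside ∷ t) ⊆? (inside ∷ T)) ⊆-out drop-∷-⊆)))))
    -- When the first element belongs to t, the sets T without it on the left correspond to the sets
    -- with it on the right, so the halves change places; the other two halves vanish.
    halves inside = trans (+-comm _ _) (+-cong
      (trans (∑-zero (subsets N) (λ T → 𝟙*-no (¬? (nonempty? ((inside ∷ T) ∩ (inside ∷ t)))) (λ e → e (zero , here)) _))
        (sym (∑-zero (subsets N) (λ T → 𝟙*-no ((inside ∷ t) ⊆? (outside ∷ T)) (λ sub → absurd (sub here)) _))))
      (trans (∑-cong (subsets N) (λ T → *-congʳ (𝟙-cong (¬? (nonempty? ((outside ∷ T) ∩ (inside ∷ t)))) (¬? (nonempty? (T ∩ t))) (λ e ne → e (nonempty-tail {T} {outside} {inside} ne)) (empty-tail inside))))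
        (trans (∑-disjoint t (λ T → h (inside ∷ T)))
               (∑-cong (subsets N) (λ T → *-congʳ (𝟙-cong (t ⊆? T) ((inside ∷ t) ⊆? (inside ∷ T)) ⊆-in drop-∷-⊆))))))
      where
      absurd : ∀ {T : Subset N} → ¬ (zero ∈ outside ∷ T)
      absurd ()

-- An interface to the complex of flags.

module FlagComplexDefinition where
  open import Data.Nat.Base using (_<_)
  open import Data.Fin.Base using () renaming (_<_ to _<ᶠ_)
  open import Data.Fin.Subset using (Subset; _∈_)

  -- Hides how vertices are listed: a vertex is determined by its color and its subspace, and every
  -- subspace of the right level occurs. `Nested` asks only for ⊑, since strictness of the chain
  -- follows from the ranks.
  record FlagComplex {q d} (G : Geometry q d) (N k : ℕ) (rank : Fin k → ℕ) : Set₁ where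
    open Geometry G using (V; _⊑_; Level)
    field
      rank-mono   : ∀ {i j} → i <ᶠ j → rank i < rank j
      rank<d      : ∀ i → rank i < d
      color       : Fin N → Fin k
      space       : Fin N → V
      space-Level : ∀ v → Level (rank (color v)) (space v)
      vertex-≡    : ∀ {u v} → color u ≡ color v → space u ≡ space v → u ≡ v
      vertex      : ∀ c {W} → Level (rank c) W → ∃ λ v → color v ≡ c × space v ≡ W

    Distinct : Subset N → Set
    Distinct T = ∀ {u v} → u ∈ T → v ∈ T → color u ≡ color v → u ≡ v

    Nested : Subset N → Set
    Nested T = ∀ {u v} → u ∈ T → v ∈ T → color u <ᶠ color v → space u ⊑ space v

    Full : Subset N → Set
    Full T = ∀ c → ∃ λ v → v ∈ T × color v ≡ c

    field
      Flag  : Subset N → Set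
      Flag? : ∀ T → Dec (Flag T)
      flag⁺ : ∀ {T} → Full T → Distinct T → Nested T → Flag T
      flag⁻ : ∀ {T} → Flag T → Full T × Distinct T × Nested T

open FlagComplexDefinition using (FlagComplex) public

-- Counting the flags through a chain.

module FlagCounts {c ℓ₁ ℓ₂} (K : RealClosedField c ℓ₁ ℓ₂) {q d} {G : Geometry q d} {N k rank}
                  (X : FlagComplex G N k rank) where
  open OrderedField K hiding (_≤_)
  open Geometry G renaming (_≟_ to _≟ᵛ_)
  open GeometrySpectrum K G
  open InclusionBound K G
  open FlagComplex X
  open SubsetLemmas
  open FinExtrema
  open LinkSum K
  import Data.Fin.Base as Fin
  open import Data.Fin.Base using () renaming (_<_ to _<ᶠ_)
  open import Data.Fin.Subset using (Subset; _∈_; _⊆_; _∪_; ⁅_⁆)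
  open import Data.Fin.Subset.Properties
    using (_∈?_; _⊆?_; x∈p∪q⁻; x∈⁅x⁆; x∈⁅y⁆⇒x≡y; p⊆p∪q; q⊆p∪q; ⊆-antisym)
  import Data.List.Relation.Unary.All as All
  open import Data.List.Membership.DecPropositional (Fin._≟_ {k}) using () renaming (_∈?_ to _∈ˡ?_)
  open import Data.Nat.Base using (_≤_; _∸_)
  open import Relation.Binary.Reasoning.Setoid setoid

  ∑ᵥ : (Fin N → Carrier) → Carrier
  ∑ᵥ f = ∑ (allFin N) f

  ∑ₛ : (Subset N → Carrier) → Carrier
  ∑ₛ f = ∑ (subsets N) f

  ∑ᵥ-unique : ∀ {P : Fin N → Set} (P? : ∀ v → Dec (P v)) f {v} → P v → (∀ {u} → P u → u ≡ v) →
              ∑ᵥ (λ u → 𝟙 (P? u) * f u) ≈ f v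
  ∑ᵥ-unique P? f {v} p only = ∑-unique P? (allFin⁺ N) f (∈-allFin v) p only

  [_≐_] : Fin N → Fin k → Carrier
  [ v ≐ c ] = 𝟙 (color v Fin.≟ c)

  extend : Fin k → (Fin N → Carrier) → V → Carrier
  extend c f W = ∑ᵥ (λ v → 𝟙 ((color v Fin.≟ c) ×-dec (space v ≟ᵛ W)) * f v)

  extend-space : ∀ {c} f {v} → color v ≡ c → extend c f (space v) ≈ f v
  extend-space {c} f {v} cv = ∑ᵥ-unique (λ u → (color u Fin.≟ c) ×-dec (space u ≟ᵛ space v)) f (cv , ≡.refl)
    (λ (cu , su) → vertex-≡ (≡.trans cu (≡.sym cv)) su)

  -- The passage from the complex to the geometry: vertices of one color are the same as subspaces
  -- of one level.
  ∑ᵥ-spaces : ∀ c (φ : V → Carrier) → ∑ᵥ (λ v → [ v ≐ c ] * φ (space v)) ≈ E (λ W → 𝟙 (Level? (rank c) W) * φ W)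
  ∑ᵥ-spaces c φ = begin
    ∑ᵥ (λ v → [ v ≐ c ] * φ (space v))
      ≈⟨ ∑-cong (allFin N) (λ v → *-congˡ (sym (E-unique (λ W → space v ≟ᵛ W) φ ≡.refl ≡.sym))) ⟩
    ∑ᵥ (λ v → [ v ≐ c ] * E (λ W → 𝟙 (space v ≟ᵛ W) * φ W))
      ≈⟨ ∑-cong (allFin N) (λ v → *-∑ elements _ _) ⟩
    ∑ᵥ (λ v → E (λ W → [ v ≐ c ] * (𝟙 (space v ≟ᵛ W) * φ W)))
      ≈⟨ ∑-comm (allFin N) elements _ ⟩
    E (λ W → ∑ᵥ (λ v → [ v ≐ c ] * (𝟙 (space v ≟ᵛ W) * φ W)))
      ≈⟨ E-cong (λ W → ∑-cong (allFin N) (λ v → trans (sym (*-assoc _ _ _)) (*-congʳ (sym (𝟙-× (color v Fin.≟ c) (space v ≟ᵛ W)))))) ⟩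
    E (λ W → ∑ᵥ (λ v → 𝟙 ((color v Fin.≟ c) ×-dec (space v ≟ᵛ W)) * φ W))
      ≈⟨ E-cong at ⟩
    E (λ W → 𝟙 (Level? (rank c) W) * φ W) ∎
    where
    at : ∀ W → ∑ᵥ (λ v → 𝟙 ((color v Fin.≟ c) ×-dec (space v ≟ᵛ W)) * φ W) ≈ 𝟙 (Level? (rank c) W) * φ W
    at W with Level? (rank c) W
    ... | yes l with vertex c l
    ... | v , cv , ≡.refl = trans (∑ᵥ-unique (λ u → (color u Fin.≟ c) ×-dec (space u ≟ᵛ space v)) (λ _ → φ (space v)) (cv , ≡.refl)
            (λ (cu , su) → vertex-≡ (≡.trans cu (≡.sym cv)) su)) (sym (*-identityˡ _))
    at W | no ¬l = trans (∑-none (λ u → (color u Fin.≟ c) ×-dec (space u ≟ᵛ W)) (allFin N) _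
            (λ {u} (cu , su) → ¬l (≡.subst₂ (λ i Z → Level (rank i) Z) cu su (space-Level u)))) (sym (zeroˡ _))

  Chain : Subset N → Set
  Chain r = Distinct r × Nested r

  HasColor : Subset N → Fin k → Set
  HasColor r c = ∃ λ v → v ∈ r × color v ≡ c

  hasColor? : ∀ r c → Dec (HasColor r c)
  hasColor? r c = Fin.any? (λ v → (v ∈? r) ×-dec (color v Fin.≟ c))

  HasColors : Subset N → (Fin k → Set) → Set
  HasColors r C = ∀ c → (C c → HasColor r c) × (HasColor r c → C c)

  ⊆-Chain : ∀ {r T} → r ⊆ T → Chain T → Chain r
  ⊆-Chain r⊆T (dis , nest) = (λ u∈ v∈ → dis (r⊆T u∈) (r⊆T v∈)) , (λ u∈ v∈ → nest (r⊆T u∈) (r⊆T v∈))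

  Flag⇒Chain : ∀ {T} → Flag T → Chain T
  Flag⇒Chain flag = proj₂ (flag⁻ flag)

  Below : Subset N → Fin k → V → Set
  Below r c W = ∀ {w} → w ∈ r → color w <ᶠ c → space w ⊑ W

  Above : Subset N → Fin k → V → Set
  Above r c W = ∀ {w} → w ∈ r → c <ᶠ color w → W ⊑ space w

  Compatible : Subset N → Fin N → Set
  Compatible r v = Below r (color v) (space v) × Above r (color v) (space v)

  compatible? : ∀ r v → Dec (Compatible r v)
  compatible? r v =
    map′ (λ h {w} → h w) (λ h w → h {w}) (Fin.all? (λ w → (w ∈? r) →-dec ((color w Fin.<? color v) →-dec (space w ⊑? space v))))
    ×-dec
    map′ (λ h {w} → h w) (λ h w → h {w}) (Fin.all? (λ w → (w ∈? r) →-dec ((color v Fin.<? color w) →-dec (space v ⊑? space w))))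

  -- The largest member of the chain of color below c, or `bottom` if there is none; lying above it
  -- is the whole of `Below`. Together with `UpperNeighbour` it turns compatibility into membership
  -- in an interval.
  record LowerNeighbour (r : Subset N) (c : Fin k) (a : ℕ) : Set where
    field
      neighbour : V
      level     : Level a neighbour
      below⁺    : ∀ {m W} → Level m W → neighbour ⊑ W → Below r c W
      below⁻    : ∀ {m W} → Level m W → Below r c W → neighbour ⊑ W

  record UpperNeighbour (r : Subset N) (c : Fin k) (b : ℕ) : Set where
    field
      neighbour : V
      level     : Level b neighbour
      above⁺    : ∀ {W} → W ⊑ neighbour → Above r c W
      above⁻    : ∀ {W} → Above r c W → W ⊑ neighbour

  module _ {C : Fin k → Set} (C? : ∀ c → Dec (C c)) (c : Fin k) where

    -- The level `a` is chosen before `r`: it is read off from the set of colors alone, which makes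
    -- all later counts independent of the chain.
    lower-neighbour : ∃ λ a → a ≤ rank c × ∀ r → Chain r → HasColors r C → LowerNeighbour r c a
    lower-neighbour with greatest (λ c′ → C? c′ ×-dec (c′ Fin.<? c))
    ... | inj₁ none = 0 , ℕ.z≤n , λ r chain colors → record
      { neighbour = bottom
      ; level     = bottom-Level
      ; below⁺    = λ _ _ {w} w∈ cw<c → contradiction (proj₂ (colors (color w)) (w , w∈ , ≡.refl) , cw<c) (none (color w))
      ; below⁻    = λ l _ → bottom-⊑ l
      }
    ... | inj₂ (c⁻ , (Cc⁻ , c⁻<c) , max) = rank c⁻ , ℕ.<⇒≤ (rank-mono c⁻<c) , nearest
      where
      nearest : ∀ r → Chain r → HasColors r C → LowerNeighbour r c (rank c⁻)
      nearest r (dis , nest) colors with proj₁ (colors c⁻) Cc⁻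
      ... | v , v∈ , ≡.refl = record
        { neighbour = space v
        ; level     = space-Level v
        ; below⁺    = λ _ v⊑W {w} w∈ cw<c → ⊑-trans (w⊑v w∈ cw<c) v⊑W
        ; below⁻    = λ _ below → below v∈ c⁻<c
        }
        where
        w⊑v : ∀ {w} → w ∈ r → color w <ᶠ c → space w ⊑ space v
        w⊑v {w} w∈ cw<c with Fin.<-cmp (color w) (color v)
        ... | tri< lt _ _ = nest w∈ v∈ lt
        ... | tri≈ _ eq _ = ≡.subst (λ u → space w ⊑ space u) (dis w∈ v∈ eq) ⊑-refl
        ... | tri> _ _ gt = contradiction (max (color w) (proj₂ (colors (color w)) (w , w∈ , ≡.refl) , cw<c)) (ℕ.<⇒≱ gt)

    upper-neighbour : ∃ λ b → rank c ≤ b × ∀ r → Chain r → HasColors r C → UpperNeighbour r c b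
    upper-neighbour with least (λ c′ → C? c′ ×-dec (c Fin.<? c′))
    ... | inj₁ none = d , ℕ.<⇒≤ (rank<d c) , λ r chain colors → record
      { neighbour = top
      ; level     = top-Level
      ; above⁺    = λ _ {w} w∈ c<cw → contradiction (proj₂ (colors (color w)) (w , w∈ , ≡.refl) , c<cw) (none (color w))
      ; above⁻    = λ _ → ⊑-top
      }
    ... | inj₂ (c⁺ , (Cc⁺ , c<c⁺) , min) = rank c⁺ , ℕ.<⇒≤ (rank-mono c<c⁺) , nearest
      where
      nearest : ∀ r → Chain r → HasColors r C → UpperNeighbour r c (rank c⁺)
      nearest r (dis , nest) colors with proj₁ (colors c⁺) Cc⁺
      ... | v , v∈ , ≡.refl = record
        { neighbour = space v
        ; level     = space-Level v
        ; above⁺    = λ W⊑v {w} w∈ c<cw → ⊑-trans W⊑v (v⊑w w∈ c<cw)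
        ; above⁻    = λ above → above v∈ c<c⁺
        }
        where
        v⊑w : ∀ {w} → w ∈ r → c <ᶠ color w → space v ⊑ space w
        v⊑w {w} w∈ c<cw with Fin.<-cmp (color w) (color v)
        ... | tri< lt _ _ = contradiction (min (color w) (proj₂ (colors (color w)) (w , w∈ , ≡.refl) , c<cw)) (ℕ.<⇒≱ lt)
        ... | tri≈ _ eq _ = ≡.subst (λ u → space v ⊑ space u) (≡.sym (dis w∈ v∈ eq)) ⊑-refl
        ... | tri> _ _ gt = nest v∈ w∈ gt

  lower⊑upper : ∀ {r c c′ a b} → c Fin.≤ c′ → Chain r →
                (L : LowerNeighbour r c a) (U : UpperNeighbour r c′ b) →
                LowerNeighbour.neighbour L ⊑ UpperNeighbour.neighbour U
  lower⊑upper c≤c′ (_ , nest) L U = UpperNeighbour.above⁻ U (λ {w′} w′∈ c′<w′ →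
    LowerNeighbour.below⁻ L (space-Level w′) (λ w∈ w<c → nest w∈ w′∈ (ℕ.<-≤-trans w<c (ℕ.≤-trans c≤c′ (ℕ.<⇒≤ c′<w′)))))

  -- The compatible vertices of color c are one level of the interval between the two neighbours.
  -- Its size is a Gaussian binomial in levels that depend only on the colors.
  compatible-count : ∀ {C : Fin k → Set} (C? : ∀ c → Dec (C c)) c →
    ∃ λ γ → Positive γ × ∀ r → Chain r → HasColors r C → ∑ᵥ (λ v → [ v ≐ c ] * 𝟙 (compatible? r v)) ≈ γ
  compatible-count C? c with lower-neighbour C? c | upper-neighbour C? c
  ... | a , a≤ , low | b , ≤b , upp = binomial (rank c ∸ a) (b ∸ rank c) , binomial>0 (rank c ∸ a) (b ∸ rank c) , count
    where
    count : ∀ r → Chain r → HasColors r _ → _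
    count r chain colors = begin
      ∑ᵥ (λ v → [ v ≐ c ] * 𝟙 (compatible? r v))
        ≈⟨ ∑-cong (allFin N) (λ v → 𝟙*-cong (color v Fin.≟ c) (λ { ≡.refl → 𝟙-cong (compatible? r v) ((A ⊑? space v) ×-dec (space v ⊑? B))
             (λ (bel , abv) → below⁻ (space-Level v) bel , above⁻ abv) (λ (A⊑ , ⊑B) → below⁺ (space-Level v) A⊑ , above⁺ ⊑B) })) ⟩
      ∑ᵥ (λ v → [ v ≐ c ] * 𝟙 ((A ⊑? space v) ×-dec (space v ⊑? B)))
        ≈⟨ ∑ᵥ-spaces c (λ W → 𝟙 ((A ⊑? W) ×-dec (W ⊑? B))) ⟩
      E (λ W → 𝟙 (Level? (rank c) W) * 𝟙 ((A ⊑? W) ×-dec (W ⊑? B)))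
        ≈⟨ E-cong (λ W → 𝟙-× (Level? (rank c) W) ((A ⊑? W) ×-dec (W ⊑? B))) ⟨
      E (λ W → 𝟙 (Interval? A B (rank c) W))
        ≈⟨ interval-count (rank c ∸ a) (LowerNeighbour.level L) (UpperNeighbour.level U) (lower⊑upper ℕ.≤-refl chain L U)
             (≡.sym (ℕ.m+[n∸m]≡n a≤)) (≡.sym (ℕ.m+[n∸m]≡n ≤b)) ⟩
      binomial (rank c ∸ a) (b ∸ rank c) ∎
      where
      L = low r chain colors
      U = upp r chain colors
      open LowerNeighbour L using (below⁺; below⁻) renaming (neighbour to A)
      open UpperNeighbour U using (above⁺; above⁻) renaming (neighbour to B)

  adjoin-Chain : ∀ {r v} → Chain r → ¬ HasColor r (color v) → Compatible r v → Chain (r ∪ ⁅ v ⁆)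
  adjoin-Chain {r} {v} (dis , nest) fresh (bel , abv) = dis′ , nest′
    where
    split : ∀ {u} → u ∈ r ∪ ⁅ v ⁆ → u ∈ r ⊎ u ≡ v
    split {u} u∈ with x∈p∪q⁻ r ⁅ v ⁆ u∈
    ... | inj₁ u∈r = inj₁ u∈r
    ... | inj₂ u∈v = inj₂ (x∈⁅y⁆⇒x≡y v u∈v)
    dis′ : Distinct (r ∪ ⁅ v ⁆)
    dis′ {u} {w} u∈ w∈ eq with split u∈ | split w∈
    ... | inj₁ u∈r | inj₁ w∈r = dis u∈r w∈r eq
    ... | inj₁ u∈r | inj₂ ≡.refl = contradiction (u , u∈r , eq) fresh
    ... | inj₂ ≡.refl | inj₁ w∈r = contradiction (w , w∈r , ≡.sym eq) fresh
    ... | inj₂ ≡.refl | inj₂ ≡.refl = ≡.refl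
    nest′ : Nested (r ∪ ⁅ v ⁆)
    nest′ u∈ w∈ lt with split u∈ | split w∈
    ... | inj₁ u∈r | inj₁ w∈r = nest u∈r w∈r lt
    ... | inj₁ u∈r | inj₂ ≡.refl = bel u∈r lt
    ... | inj₂ ≡.refl | inj₁ w∈r = abv w∈r lt
    ... | inj₂ ≡.refl | inj₂ ≡.refl = contradiction lt (ℕ.<-irrefl ≡.refl)

  Chain⇒Compatible : ∀ {r v} → Chain (r ∪ ⁅ v ⁆) → Compatible r v
  Chain⇒Compatible {r} {v} (_ , nest) =
    (λ w∈ → nest (p⊆p∪q ⁅ v ⁆ w∈) v∈) , (λ w∈ → nest v∈ (p⊆p∪q ⁅ v ⁆ w∈))
    where
    v∈ : v ∈ r ∪ ⁅ v ⁆
    v∈ = q⊆p∪q r ⁅ v ⁆ (x∈⁅x⁆ v)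

  ∪⁅⁆-⊆ : ∀ {r T : Subset N} {v} → r ⊆ T → v ∈ T → r ∪ ⁅ v ⁆ ⊆ T
  ∪⁅⁆-⊆ {r} {T} {v} r⊆T v∈T {x} x∈ with x∈p∪q⁻ r ⁅ v ⁆ x∈
  ... | inj₁ x∈r = r⊆T x∈r
  ... | inj₂ x∈v = ≡.subst (_∈ T) (≡.sym (x∈⁅y⁆⇒x≡y v x∈v)) v∈T

  extensions : Subset N → Carrier
  extensions r = ∑ₛ (λ T → 𝟙 (Flag? T) * 𝟙 (r ⊆? T))

  extensions-0 : ∀ {r} → ¬ Chain r → extensions r ≈ 0#
  extensions-0 {r} ¬chain = ∑-zero (subsets N) (λ T → 𝟙*-zero (Flag? T) (λ flag →
    𝟙-no (r ⊆? T) (λ r⊆T → ¬chain (⊆-Chain r⊆T (Flag⇒Chain flag)))))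

  -- A flag has exactly one vertex of color c, and the flags through r are sorted by it.
  extensions-∪ : ∀ r c → extensions r ≈ ∑ᵥ (λ v → [ v ≐ c ] * extensions (r ∪ ⁅ v ⁆))
  extensions-∪ r c = begin
    ∑ₛ (λ T → 𝟙 (Flag? T) * 𝟙 (r ⊆? T))
      ≈⟨ ∑-cong (subsets N) (λ T → 𝟙*-cong (Flag? T) (λ flag → sym (choose flag))) ⟩
    ∑ₛ (λ T → 𝟙 (Flag? T) * ∑ᵥ (λ v → [ v ≐ c ] * 𝟙 ((r ∪ ⁅ v ⁆) ⊆? T)))
      ≈⟨ ∑-cong (subsets N) (λ T → trans (*-∑ (allFin N) _ _) (∑-cong (allFin N) (λ v →
           solve 3 (λ f c i → f :* (c :* i) := c :* (f :* i)) refl (𝟙 (Flag? T)) [ v ≐ c ] (𝟙 ((r ∪ ⁅ v ⁆) ⊆? T))))) ⟩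
    ∑ₛ (λ T → ∑ᵥ (λ v → [ v ≐ c ] * (𝟙 (Flag? T) * 𝟙 ((r ∪ ⁅ v ⁆) ⊆? T))))
      ≈⟨ ∑-comm (subsets N) (allFin N) _ ⟩
    ∑ᵥ (λ v → ∑ₛ (λ T → [ v ≐ c ] * (𝟙 (Flag? T) * 𝟙 ((r ∪ ⁅ v ⁆) ⊆? T))))
      ≈⟨ ∑-cong (allFin N) (λ v → *-∑ (subsets N) _ _) ⟨
    ∑ᵥ (λ v → [ v ≐ c ] * extensions (r ∪ ⁅ v ⁆)) ∎
    where
    choose : ∀ {T} → Flag T → ∑ᵥ (λ v → [ v ≐ c ] * 𝟙 ((r ∪ ⁅ v ⁆) ⊆? T)) ≈ 𝟙 (r ⊆? T)
    choose {T} flag with flag⁻ flag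
    ... | full , dis , _ with full c
    ... | v , v∈ , ≡.refl = trans
      (∑-cong (allFin N) (λ u → 𝟙𝟙-cong (color u Fin.≟ color v) ((r ∪ ⁅ u ⁆) ⊆? T) (u Fin.≟ v) (r ⊆? T)
        (λ (cu , sub) → dis (sub (q⊆p∪q r ⁅ u ⁆ (x∈⁅x⁆ u))) v∈ cu , λ x∈ → sub (p⊆p∪q ⁅ u ⁆ x∈))
        (λ { (≡.refl , r⊆T) → ≡.refl , ∪⁅⁆-⊆ r⊆T v∈ })))
      (∑ᵥ-unique (Fin._≟ v) (λ _ → 𝟙 (r ⊆? T)) ≡.refl (λ eq → eq))

  -- By induction on the list L of the colors missing from r.
  extensions-const : ∀ L → Unique L →
    ∃ λ κ′ → Positive κ′ × ∀ r → Chain r → HasColors r (λ c → ¬ c List.∈ L) → extensions r ≈ κ′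
  extensions-const [] _ = 1# , pos-1 , λ r (dis , nest) colors →
    let full : Full r
        full c = proj₁ (colors c) λ ()
    in trans (∑-cong (subsets N) (λ T → sym (𝟙-× (Flag? T) (r ⊆? T))))
         (∑-unique-1 (λ T → Flag? T ×-dec (r ⊆? T)) (subsets-unique N) (∈-subsets r) (flag⁺ full dis nest , λ x∈ → x∈)
            (λ {T} (flag , r⊆T) → ⊆-antisym (T⊆r full flag r⊆T) r⊆T))
    where
    T⊆r : ∀ {r T} → Full r → Flag T → r ⊆ T → T ⊆ r
    T⊆r {r} full flag r⊆T {x} x∈ with full (color x)
    ... | v , v∈ , cv = ≡.subst (_∈ r) (proj₁ (Flag⇒Chain flag) (r⊆T v∈) x∈ cv) v∈
  extensions-const (c ∷ L) (c∉L ∷ uL)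
    with extensions-const L uL | compatible-count (λ c′ → ¬? (c′ ∈ˡ? (c ∷ L))) c
  -- Color c can be filled in by γ compatible vertices, and each enlarged chain lies in κ′ flags.
  ... | κ′ , κ′>0 , const | γ , γ>0 , count = γ * κ′ , pos-* γ>0 κ′>0 , λ r chain colors → begin
    extensions r
      ≈⟨ extensions-∪ r c ⟩
    ∑ᵥ (λ v → [ v ≐ c ] * extensions (r ∪ ⁅ v ⁆))
      ≈⟨ ∑-cong (allFin N) (λ v → trans (𝟙*-cong (color v Fin.≟ c) (λ cv → step r chain colors v cv)) (sym (*-assoc _ _ _))) ⟩
    ∑ᵥ (λ v → [ v ≐ c ] * 𝟙 (compatible? r v) * κ′)
      ≈⟨ ∑-* (allFin N) _ κ′ ⟨
    ∑ᵥ (λ v → [ v ≐ c ] * 𝟙 (compatible? r v)) * κ′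
      ≈⟨ *-congʳ (count r chain colors) ⟩
    γ * κ′ ∎
    where
    step : ∀ r → Chain r → HasColors r (λ c′ → ¬ c′ List.∈ (c ∷ L)) → ∀ v → color v ≡ c →
           extensions (r ∪ ⁅ v ⁆) ≈ 𝟙 (compatible? r v) * κ′
    step r chain colors v ≡.refl = by-cases (compatible? r v)
      where
      fresh : ¬ HasColor r (color v)
      fresh has = proj₂ (colors (color v)) has (here ≡.refl)
      by-cases : (d : Dec (Compatible r v)) → extensions (r ∪ ⁅ v ⁆) ≈ 𝟙 d * κ′
      colors′ : HasColors (r ∪ ⁅ v ⁆) (λ c′ → ¬ c′ List.∈ L)
      by-cases (no ¬comp) = trans (extensions-0 (λ ch → ¬comp (Chain⇒Compatible ch))) (sym (zeroˡ _))
      by-cases (yes comp) = trans (const (r ∪ ⁅ v ⁆) (adjoin-Chain chain fresh comp) colors′) (sym (*-identityˡ _))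
      colors′ c′ = to , from
        where
        to : ¬ c′ List.∈ L → HasColor (r ∪ ⁅ v ⁆) c′
        to c′∉L with c′ Fin.≟ color v
        ... | yes ≡.refl = v , q⊆p∪q r ⁅ v ⁆ (x∈⁅x⁆ v) , ≡.refl
        ... | no c′≢ with proj₁ (colors c′) (λ { (here eq) → c′≢ eq ; (there p) → c′∉L p })
        ... | w , w∈ , cw = w , p⊆p∪q ⁅ v ⁆ w∈ , cw
        from : HasColor (r ∪ ⁅ v ⁆) c′ → ¬ c′ List.∈ L
        from (w , w∈ , ≡.refl) c′∈L with x∈p∪q⁻ r ⁅ v ⁆ w∈
        ... | inj₁ w∈r = proj₂ (colors (color w)) (w , w∈r , ≡.refl) (there c′∈L)
        ... | inj₂ w∈v = All.lookup c∉L (≡.subst (λ z → color z List.∈ L) (x∈⁅y⁆⇒x≡y v w∈v) c′∈L) ≡.refl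

-- Edge weights of a link and the bound for two colors.

module LinkWeights {c ℓ₁ ℓ₂} (K : RealClosedField c ℓ₁ ℓ₂) {q d} {G : Geometry q d} {N k rank}
                   (X : FlagComplex G N k rank) where
  open OrderedField K renaming (_≤_ to _≤ᴷ_)
  open Geometry G
  open GeometrySpectrum K G
  open InclusionBound K G
  open FlagComplex X
  open FlagCounts K X
  open SubsetLemmas
  open LinkSum K
  open import Data.Fin.Base using () renaming (_<_ to _<ᶠ_)
  open import Data.Fin.Subset using (Subset; _∈_; _∪_; _∩_; ⁅_⁆; Empty)
  open import Data.Fin.Subset.Properties
    using (_∈?_; _⊆?_; x∈p∪q⁻; x∈⁅x⁆; x∈⁅y⁆⇒x≡y; p⊆p∪q; q⊆p∪q; nonempty?)
  open import Data.List.Base using (filter)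
  open import Data.Nat.Base using (_∸_)
  open import Relation.Binary.Reasoning.Setoid setoid

  extensions-colors : ∀ {C : Fin k → Set} (C? : ∀ c → Dec (C c)) →
    ∃ λ κ′ → Positive κ′ × ∀ r → Chain r → HasColors r C → extensions r ≈ κ′
  extensions-colors {C} C? with extensions-const (filter (λ c → ¬? (C? c)) (allFin k)) (filter⁺ _ (allFin⁺ k))
  ... | κ′ , κ′>0 , const = κ′ , κ′>0 , λ r chain colors → const r chain (λ c →
        (λ c∉ → proj₁ (colors c) (decidable-stable (C? c) (λ ¬Cc → c∉ (∈-filter⁺ (λ c → ¬? (C? c)) (∈-allFin c) ¬Cc)))) ,
        (λ has c∈ → proj₂ (∈-filter⁻ (λ c → ¬? (C? c)) {xs = allFin k} c∈) (proj₂ (colors c) has)))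

  module Link (t : Subset N) (chain-t : Chain t) where

    Missing : Fin k → Set
    Missing c = ¬ HasColor t c

    LinkTop? : ∀ T → Dec (Empty (T ∩ t) × Flag (T ∪ t))
    LinkTop? T = ¬? (nonempty? (T ∩ t)) ×-dec Flag? (T ∪ t)

    ν : Fin N → Fin N → Carrier
    ν u v = ∑ₛ (λ T → 𝟙 (LinkTop? T) * (𝟙 (u ∈? T) * 𝟙 (v ∈? T)))

    μ : Fin N → Carrier
    μ v = ν v v

    ν-sym : ∀ u v → ν u v ≈ ν v u
    ν-sym u v = ∑-cong (subsets N) (λ T → *-congˡ (*-comm _ _))

    ν≥0 : ∀ u v → 0# ≤ᴷ ν u v
    ν≥0 u v = ∑-nonneg (subsets N) (λ T → 𝟙≥0 (LinkTop? T) *≥ (𝟙≥0 (u ∈? T) *≥ 𝟙≥0 (v ∈? T)))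

    top-vertex : ∀ {T c} → Empty (T ∩ t) × Flag (T ∪ t) → Missing c → ∃ λ v → v ∈ T × color v ≡ c
    top-vertex {T} {c} (_ , flag) missing with proj₁ (flag⁻ flag) c
    ... | v , v∈ , cv with x∈p∪q⁻ T t v∈
    ... | inj₁ v∈T = v , v∈T , cv
    ... | inj₂ v∈t = contradiction (v , v∈t , cv) missing

    top-distinct : ∀ {T} → Empty (T ∩ t) × Flag (T ∪ t) → Distinct T
    top-distinct (_ , flag) u∈ v∈ = proj₁ (Flag⇒Chain flag) (p⊆p∪q t u∈) (p⊆p∪q t v∈)

    -- Every top face of the link has exactly one vertex of a missing color, so summing over that
    -- vertex only forgets it.
    marginal : ∀ {c} → Missing c → ∀ u → ∑ᵥ (λ v → [ v ≐ c ] * ν u v) ≈ μ u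
    marginal {c} missing u = begin
      ∑ᵥ (λ v → [ v ≐ c ] * ν u v)
        ≈⟨ ∑-cong (allFin N) (λ v → *-∑ (subsets N) _ _) ⟩
      ∑ᵥ (λ v → ∑ₛ (λ T → [ v ≐ c ] * (𝟙 (LinkTop? T) * (𝟙 (u ∈? T) * 𝟙 (v ∈? T)))))
        ≈⟨ ∑-comm (allFin N) (subsets N) _ ⟩
      ∑ₛ (λ T → ∑ᵥ (λ v → [ v ≐ c ] * (𝟙 (LinkTop? T) * (𝟙 (u ∈? T) * 𝟙 (v ∈? T)))))
        ≈⟨ ∑-cong (subsets N) (λ T → trans (*-congˡ (*-∑ (allFin N) _ _)) (trans (*-∑ (allFin N) _ _) (∑-cong (allFin N) (λ v →
             solve 4 (λ l u c v → l :* (u :* (c :* v)) := c :* (l :* (u :* v))) refl (𝟙 (LinkTop? T)) (𝟙 (u ∈? T)) [ v ≐ c ] (𝟙 (v ∈? T)))))) ⟨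
      ∑ₛ (λ T → 𝟙 (LinkTop? T) * (𝟙 (u ∈? T) * ∑ᵥ (λ v → [ v ≐ c ] * 𝟙 (v ∈? T))))
        ≈⟨ ∑-cong (subsets N) (λ T → 𝟙*-cong (LinkTop? T) (λ top → *-congˡ (one top))) ⟩
      ∑ₛ (λ T → 𝟙 (LinkTop? T) * (𝟙 (u ∈? T) * 1#))
        ≈⟨ ∑-cong (subsets N) (λ T → *-congˡ (trans (*-identityʳ _) (sym (𝟙-idem (u ∈? T))))) ⟩
      μ u ∎
      where
      one : ∀ {T} → Empty (T ∩ t) × Flag (T ∪ t) → ∑ᵥ (λ v → [ v ≐ c ] * 𝟙 (v ∈? T)) ≈ 1#
      one {T} top with top-vertex top missing
      ... | v , v∈ , ≡.refl = trans (∑-cong (allFin N) (λ u → sym (𝟙-× (color u Fin.≟ color v) (u ∈? T))))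
            (∑-unique-1 (λ u → (color u Fin.≟ color v) ×-dec (u ∈? T)) (allFin⁺ N) (∈-allFin v) (≡.refl , v∈)
               (λ (cu , u∈) → top-distinct top u∈ v∈ cu))

    ν-same-color : ∀ {u v} → color u ≡ color v → u ≢ v → ν u v ≈ 0#
    ν-same-color {u} {v} cu≡cv u≢v = ∑-zero (subsets N) (λ T → 𝟙*-zero (LinkTop? T) (λ top →
      𝟙*-zero (u ∈? T) (λ u∈ → 𝟙-no (v ∈? T) (λ v∈ → u≢v (top-distinct top u∈ v∈ cu≡cv)))))

    -- T ↦ T ∪ t matches the top faces of the link with the flags containing t. As the colors of u
    -- and v are missing from t, membership of u and v is unaffected by adding t.
    ν-extensions : ∀ {u v} → Missing (color u) → Missing (color v) → ν u v ≈ extensions ((t ∪ ⁅ u ⁆) ∪ ⁅ v ⁆)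
    ν-extensions {u} {v} missing-u missing-v = begin
      ν u v
        ≈⟨ ∑-cong (subsets N) (λ T → trans (*-cong (𝟙-× (¬? (nonempty? (T ∩ t))) (Flag? (T ∪ t))) (*-cong (∈-∪ missing-u T) (∈-∪ missing-v T))) (*-assoc _ _ _)) ⟩
      ∑ₛ (λ T → 𝟙 (¬? (nonempty? (T ∩ t))) * h (T ∪ t))
        ≈⟨ ∑-disjoint t h ⟩
      ∑ₛ (λ T → 𝟙 (t ⊆? T) * h T)
        ≈⟨ ∑-cong (subsets N) (λ T → trans (solve 4 (λ t f u v → t :* (f :* (u :* v)) := f :* ((t :* u) :* v)) refl (𝟙 (t ⊆? T)) (𝟙 (Flag? T)) (𝟙 (u ∈? T)) (𝟙 (v ∈? T)))
             (*-congˡ (trans (*-congʳ (sym (𝟙-× (t ⊆? T) (u ∈? T)))) (trans (sym (𝟙-× ((t ⊆? T) ×-dec (u ∈? T)) (v ∈? T)))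
               (𝟙-cong (((t ⊆? T) ×-dec (u ∈? T)) ×-dec (v ∈? T)) (((t ∪ ⁅ u ⁆) ∪ ⁅ v ⁆) ⊆? T)
                 (λ ((t⊆ , u∈) , v∈) → ∪⁅⁆-⊆ (∪⁅⁆-⊆ t⊆ u∈) v∈)
                 (λ sub → ((λ x∈ → sub (p⊆p∪q ⁅ v ⁆ (p⊆p∪q ⁅ u ⁆ x∈))) , sub (p⊆p∪q ⁅ v ⁆ (q⊆p∪q t ⁅ u ⁆ (x∈⁅x⁆ u)))) ,
                          sub (q⊆p∪q (t ∪ ⁅ u ⁆) ⁅ v ⁆ (x∈⁅x⁆ v)))))))) ⟩
      extensions ((t ∪ ⁅ u ⁆) ∪ ⁅ v ⁆) ∎
      where
      h : Subset N → Carrier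
      h T = 𝟙 (Flag? T) * (𝟙 (u ∈? T) * 𝟙 (v ∈? T))
      ∈-∪ : ∀ {w} → Missing (color w) → ∀ T → 𝟙 (w ∈? T) ≈ 𝟙 (w ∈? (T ∪ t))
      ∈-∪ {w} missing T = 𝟙-cong (w ∈? T) (w ∈? (T ∪ t)) (p⊆p∪q t) from
        where
        from : w ∈ T ∪ t → w ∈ T
        from w∈ with x∈p∪q⁻ T t w∈
        ... | inj₁ w∈T = w∈T
        ... | inj₂ w∈t = contradiction (w , w∈t , ≡.refl) missing

    module _ {c c′} (c<c′ : c <ᶠ c′) (missing : Missing c) (missing′ : Missing c′) where

      Colors : Fin k → Set
      Colors e = HasColor t e ⊎ (e ≡ c ⊎ e ≡ c′)

      -- The number of flags through t, u and v is 0 unless these form a chain, and otherwise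
      -- depends only on their colors. Being a chain splits into compatibility of u, compatibility
      -- of v, and u ⊑ v.
      ν-pair : ∃ λ κ′ → Positive κ′ × ∀ {u v} → color u ≡ c → color v ≡ c′ →
               ν u v ≈ κ′ * (𝟙 (compatible? t u) * (𝟙 (compatible? t v) * ζ (space u) (space v)))
      ν-pair with extensions-colors {Colors} (λ e → hasColor? t e ⊎-dec ((e Fin.≟ c) ⊎-dec (e Fin.≟ c′)))
      ... | κ′ , κ′>0 , const = κ′ , κ′>0 , pair
        where
        pair : ∀ {u v} → color u ≡ c → color v ≡ c′ →
               ν u v ≈ κ′ * (𝟙 (compatible? t u) * (𝟙 (compatible? t v) * ζ (space u) (space v)))
        pair {u} {v} ≡.refl ≡.refl = trans (ν-extensions missing missing′)
          (trans (by-cases joint?) (*-congˡ (trans (𝟙-× (compatible? t u) (compatible? t v ×-dec (space u ⊑? space v))) (*-congˡ (𝟙-× (compatible? t v) (space u ⊑? space v))))))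
          where
          Joint : Set
          Joint = Compatible t u × Compatible t v × space u ⊑ space v
          joint? : Dec Joint
          joint? = compatible? t u ×-dec (compatible? t v ×-dec (space u ⊑? space v))
          u∈ : u ∈ t ∪ ⁅ u ⁆
          u∈ = q⊆p∪q t ⁅ u ⁆ (x∈⁅x⁆ u)
          v∈ : v ∈ (t ∪ ⁅ u ⁆) ∪ ⁅ v ⁆
          v∈ = q⊆p∪q (t ∪ ⁅ u ⁆) ⁅ v ⁆ (x∈⁅x⁆ v)
          to : Joint → Chain ((t ∪ ⁅ u ⁆) ∪ ⁅ v ⁆)
          to (comp-u , (bel , abv) , u⊑v) = adjoin-Chain (adjoin-Chain chain-t missing comp-u) fresh (bel′ , abv′)
            where
            fresh : ¬ HasColor (t ∪ ⁅ u ⁆) (color v)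
            fresh (w , w∈ , cw) with x∈p∪q⁻ t ⁅ u ⁆ w∈
            ... | inj₁ w∈t = missing′ (w , w∈t , cw)
            ... | inj₂ w∈u = ℕ.<⇒≢ c<c′ (≡.cong Fin.toℕ (≡.trans (≡.cong color (≡.sym (x∈⁅y⁆⇒x≡y u w∈u))) cw))
            bel′ : Below (t ∪ ⁅ u ⁆) (color v) (space v)
            bel′ w∈ lt with x∈p∪q⁻ t ⁅ u ⁆ w∈
            ... | inj₁ w∈t = bel w∈t lt
            ... | inj₂ w∈u = ≡.subst (λ w → space w ⊑ space v) (≡.sym (x∈⁅y⁆⇒x≡y u w∈u)) u⊑v
            abv′ : Above (t ∪ ⁅ u ⁆) (color v) (space v)
            abv′ w∈ lt with x∈p∪q⁻ t ⁅ u ⁆ w∈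
            ... | inj₁ w∈t = abv w∈t lt
            ... | inj₂ w∈u = contradiction (≡.subst (λ w → color v <ᶠ color w) (x∈⁅y⁆⇒x≡y u w∈u) lt) (ℕ.<⇒≯ c<c′)
          from : Chain ((t ∪ ⁅ u ⁆) ∪ ⁅ v ⁆) → Joint
          from ch = Chain⇒Compatible (⊆-Chain (p⊆p∪q ⁅ v ⁆) ch) ,
                    Chain⇒Compatible (⊆-Chain (∪⁅⁆-⊆ (λ x∈ → p⊆p∪q ⁅ v ⁆ (p⊆p∪q ⁅ u ⁆ x∈)) v∈) ch) ,
                    proj₂ ch (p⊆p∪q ⁅ v ⁆ u∈) v∈ c<c′
          colors : HasColors ((t ∪ ⁅ u ⁆) ∪ ⁅ v ⁆) Colors
          colors e = (λ { (inj₁ (w , w∈ , cw)) → w , p⊆p∪q ⁅ v ⁆ (p⊆p∪q ⁅ u ⁆ w∈) , cw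
                        ; (inj₂ (inj₁ ≡.refl)) → u , p⊆p∪q ⁅ v ⁆ u∈ , ≡.refl
                        ; (inj₂ (inj₂ ≡.refl)) → v , v∈ , ≡.refl }) , has
            where
            has : HasColor ((t ∪ ⁅ u ⁆) ∪ ⁅ v ⁆) e → Colors e
            has (w , w∈ , ≡.refl) with x∈p∪q⁻ (t ∪ ⁅ u ⁆) ⁅ v ⁆ w∈
            ... | inj₂ w∈v = inj₂ (inj₂ (≡.cong color (x∈⁅y⁆⇒x≡y v w∈v)))
            ... | inj₁ w∈tu with x∈p∪q⁻ t ⁅ u ⁆ w∈tu
            ... | inj₁ w∈t = inj₁ (w , w∈t , ≡.refl)
            ... | inj₂ w∈u = inj₂ (inj₁ (≡.cong color (x∈⁅y⁆⇒x≡y u w∈u)))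
          by-cases : (d : Dec Joint) → extensions ((t ∪ ⁅ u ⁆) ∪ ⁅ v ⁆) ≈ κ′ * 𝟙 d
          by-cases (yes joint) = trans (const _ (to joint) colors) (sym (*-identityʳ _))
          by-cases (no ¬joint) = trans (extensions-0 (λ ch → ¬joint (from ch))) (sym (zeroʳ _))

    mean-on : Fin k → (Fin N → Carrier) → Carrier
    mean-on c f = ∑ᵥ (λ v → [ v ≐ c ] * (μ v * f v))

    energy-on : Fin k → (Fin N → Carrier) → Carrier
    energy-on c f = ∑ᵥ (λ v → [ v ≐ c ] * (μ v * (f v * f v)))

    cross : Fin k → Fin k → (Fin N → Carrier) → (Fin N → Carrier) → Carrier
    cross c c′ f g = ∑ᵥ (λ u → ∑ᵥ (λ v → [ u ≐ c ] * ([ v ≐ c′ ] * (ν u v * (f u * g v)))))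

    energy-on≥0 : ∀ c f → 0# ≤ᴷ energy-on c f
    energy-on≥0 c f = ∑-nonneg (allFin N) (λ v → 𝟙≥0 (color v Fin.≟ c) *≥ (ν≥0 v v *≥ square-nonneg (f v)))

    ∑∑-spaces : ∀ c c′ (Ψ : V → V → Carrier) →
      ∑ᵥ (λ u → ∑ᵥ (λ v → [ u ≐ c ] * ([ v ≐ c′ ] * Ψ (space u) (space v)))) ≈
      E (λ U → 𝟙 (Level? (rank c) U) * E (λ W → 𝟙 (Level? (rank c′) W) * Ψ U W))
    ∑∑-spaces c c′ Ψ = begin
      ∑ᵥ (λ u → ∑ᵥ (λ v → [ u ≐ c ] * ([ v ≐ c′ ] * Ψ (space u) (space v))))
        ≈⟨ ∑-cong (allFin N) (λ u → *-∑ (allFin N) _ _) ⟨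
      ∑ᵥ (λ u → [ u ≐ c ] * ∑ᵥ (λ v → [ v ≐ c′ ] * Ψ (space u) (space v)))
        ≈⟨ ∑-cong (allFin N) (λ u → *-congˡ (∑ᵥ-spaces c′ (Ψ (space u)))) ⟩
      ∑ᵥ (λ u → [ u ≐ c ] * E (λ W → 𝟙 (Level? (rank c′) W) * Ψ (space u) W))
        ≈⟨ ∑ᵥ-spaces c (λ U → E (λ W → 𝟙 (Level? (rank c′) W) * Ψ U W)) ⟩
      E (λ U → 𝟙 (Level? (rank c) U) * E (λ W → 𝟙 (Level? (rank c′) W) * Ψ U W)) ∎

    module _ {ρ} (ρ>0 : Positive ρ) (ρρQ≈1 : ρ * ρ * Q ≈ 1#)
             {c c′} (c<c′ : c <ᶠ c′) (missing : Missing c) (missing′ : Missing c′)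
             (f g : Fin N → Carrier) (mean-f : mean-on c f ≈ 0#) where

      κ₀ : Carrier
      κ₀ = proj₁ (ν-pair c<c′ missing missing′)

      κ₀>0 : Positive κ₀
      κ₀>0 = proj₁ (proj₂ (ν-pair c<c′ missing missing′))

      ν-pair′ : ∀ {u v} → color u ≡ c → color v ≡ c′ →
                ν u v ≈ κ₀ * (𝟙 (compatible? t u) * (𝟙 (compatible? t v) * ζ (space u) (space v)))
      ν-pair′ = proj₂ (proj₂ (ν-pair c<c′ missing missing′))

      PairBound : Set _
      PairBound = (1# + 1#) * cross c c′ f g ≤ᴷ ρ ^ (rank c′ ∸ rank c) * (energy-on c f + energy-on c′ g)

      bound≥0 : 0# ≤ᴷ ρ ^ (rank c′ ∸ rank c) * (energy-on c f + energy-on c′ g)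
      bound≥0 = proj₁ (pos-^ (rank c′ ∸ rank c) ρ>0) *≥ (energy-on≥0 c f +≥ energy-on≥0 c′ g)

      -- A subspace of t between the two colors makes them independent.
      separated : ∀ {w} → w ∈ t → c <ᶠ color w → color w <ᶠ c′ → PairBound
      separated {w} w∈ c<w w<c′ = ≤-respˡ (sym (trans (*-congˡ cross≈0) (zeroʳ _))) bound≥0
        where
        φ : Fin N → Carrier
        φ v = 𝟙 (compatible? t v)
        ν-product : ∀ {u v} → color u ≡ c → color v ≡ c′ → ν u v ≈ κ₀ * (φ u * φ v)
        ν-product {u} {v} ≡.refl ≡.refl = trans (ν-pair′ ≡.refl ≡.refl) (*-congˡ
          (𝟙*-cong (compatible? t u) (λ (_ , abv) → trans (𝟙*-cong (compatible? t v) (λ (bel , _) →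
             𝟙-yes (space u ⊑? space v) (⊑-trans (abv w∈ c<w) (bel w∈ w<c′)))) (*-identityʳ _))))
        S : Carrier
        S = ∑ᵥ (λ u → [ u ≐ c ] * (φ u * f u))
        count = compatible-count (hasColor? t) c′
        γ = proj₁ count
        -- The weight μ is then a constant multiple of the indicator φ, so mean zero of f with
        -- respect to μ gives S = 0, and S is a factor of the cross sum.
        μ≈ : ∀ {u} → color u ≡ c → μ u ≈ κ₀ * γ * φ u
        μ≈ {u} cu = begin
          μ u                                                 ≈⟨ marginal missing′ u ⟨
          ∑ᵥ (λ v → [ v ≐ c′ ] * ν u v)                       ≈⟨ ∑-cong (allFin N) (λ v → 𝟙*-cong (color v Fin.≟ c′) (ν-product cu)) ⟩
          ∑ᵥ (λ v → [ v ≐ c′ ] * (κ₀ * (φ u * φ v)))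
            ≈⟨ trans (*-∑ (allFin N) _ _) (∑-cong (allFin N) (λ v → solve 4 (λ k a e b → k :* a :* (e :* b) := e :* (k :* (a :* b))) refl κ₀ (φ u) [ v ≐ c′ ] (φ v))) ⟨
          κ₀ * φ u * ∑ᵥ (λ v → [ v ≐ c′ ] * φ v)
            ≈⟨ *-congˡ (proj₂ (proj₂ count) t chain-t (λ _ → (λ h → h) , (λ h → h))) ⟩
          κ₀ * φ u * γ                                        ≈⟨ solve 3 (λ k a g → k :* a :* g := k :* g :* a) refl κ₀ (φ u) γ ⟩
          κ₀ * γ * φ u                                        ∎
        S≈0 : S ≈ 0#
        S≈0 = *-cancel-0 (proj₂ (pos-* κ₀>0 (proj₁ (proj₂ count)))) (begin
          κ₀ * γ * S
            ≈⟨ trans (*-∑ (allFin N) _ _) (∑-cong (allFin N) (λ u → solve 4 (λ k e a f → k :* (e :* (a :* f)) := e :* (k :* a :* f)) refl (κ₀ * γ) [ u ≐ c ] (φ u) (f u))) ⟩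
          ∑ᵥ (λ u → [ u ≐ c ] * (κ₀ * γ * φ u * f u))
            ≈⟨ ∑-cong (allFin N) (λ u → 𝟙*-cong (color u Fin.≟ c) (λ cu → *-congʳ (μ≈ cu))) ⟨
          mean-on c f                                         ≈⟨ mean-f ⟩
          0#                                                  ∎)
        cross≈0 : cross c c′ f g ≈ 0#
        cross≈0 = begin
          cross c c′ f g
            ≈⟨ ∑-cong (allFin N) (λ u → ∑-cong (allFin N) (λ v → 𝟙*-cong (color u Fin.≟ c) (λ cu → 𝟙*-cong (color v Fin.≟ c′) (λ cv → *-congʳ (ν-product cu cv))))) ⟩
          ∑ᵥ (λ u → ∑ᵥ (λ v → [ u ≐ c ] * ([ v ≐ c′ ] * (κ₀ * (φ u * φ v) * (f u * g v)))))
            ≈⟨ ∑-cong (allFin N) (λ u → ∑-cong (allFin N) (λ v → solve 7 (λ e e′ k a b f g →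
                 e :* (e′ :* (k :* (a :* b) :* (f :* g))) := (e :* (a :* f)) :* (k :* (e′ :* (b :* g)))) refl [ u ≐ c ] [ v ≐ c′ ] κ₀ (φ u) (φ v) (f u) (g v))) ⟩
          ∑ᵥ (λ u → ∑ᵥ (λ v → ([ u ≐ c ] * (φ u * f u)) * (κ₀ * ([ v ≐ c′ ] * (φ v * g v)))))
            ≈⟨ *-∑-*-∑ (allFin N) (allFin N) _ _ ⟨
          S * ∑ᵥ (λ v → κ₀ * ([ v ≐ c′ ] * (φ v * g v)))       ≈⟨ trans (*-congʳ S≈0) (zeroˡ _) ⟩
          0#                                                  ∎

      -- No member of t separates the colors, so the lower neighbour of c and the upper neighbour of
      -- c′ bound one interval that serves both: either vertex is compatible with t exactly when it
      -- lies in [A , B]. Cross sum and energies are then κ₀ times the quantities in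
      -- `inclusion-bound`.
      adjacent : (∀ {w} → w ∈ t → c <ᶠ color w → ¬ color w <ᶠ c′) → PairBound
      adjacent none with lower-neighbour (hasColor? t) c | upper-neighbour (hasColor? t) c′
      ... | a , a≤ , low | b , ≤b , upp = ≤-respˡ (sym cross≈) (≤-respʳ rhs≈ (*-monoˡ-≤ (proj₁ κ₀>0)
              (inclusion-bound ρ>0 ρρQ≈1 f̂ ĝ eq eq′ mean≈0)))
        where
        same : HasColors t (HasColor t)
        same _ = (λ h → h) , (λ h → h)
        L = low t chain-t same
        U = upp t chain-t same
        open LowerNeighbour L using (below⁺; below⁻) renaming (neighbour to A; level to lA)
        open UpperNeighbour U using (above⁺; above⁻) renaming (neighbour to B; level to lB)
        n = rank c
        m = rank c′
        x₀ = n ∸ a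
        j = m ∸ n
        y = b ∸ m
        eq : m ≡ n ℕ.+ j
        eq = ≡.sym (ℕ.m+[n∸m]≡n (ℕ.<⇒≤ (rank-mono c<c′)))
        eq′ : b ≡ m ℕ.+ y
        eq′ = ≡.sym (ℕ.m+[n∸m]≡n ≤b)
        A⊑B : A ⊑ B
        A⊑B = lower⊑upper (ℕ.<⇒≤ c<c′) chain-t L U
        open FixedInterval lA lB A⊑B
        open Iterated lA lB A⊑B {x₀} {n} (≡.sym (ℕ.m+[n∸m]≡n a≤))
        f̂ = extend c f
        ĝ = extend c′ g

        β? : ∀ W → Dec (A ⊑ W × W ⊑ B)
        β? W = (A ⊑? W) ×-dec (W ⊑? B)
        β : V → Carrier
        β W = 𝟙 (β? W)
        χ≈ : ∀ m W → χ m W ≈ 𝟙 (Level? m W) * β W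
        χ≈ m W = 𝟙-× (Level? m W) (β? W)

        between : ∀ {w} → w ∈ t → (c <ᶠ color w → c′ <ᶠ color w) × (color w <ᶠ c′ → color w <ᶠ c)
        between {w} w∈ = up-to , down-to
          where
          up-to : c <ᶠ color w → c′ <ᶠ color w
          up-to c<w with Fin.<-cmp (color w) c′
          ... | tri< lt _ _ = contradiction lt (none w∈ c<w)
          ... | tri≈ _ e _ = contradiction (w , w∈ , e) missing′
          ... | tri> _ _ gt = gt
          down-to : color w <ᶠ c′ → color w <ᶠ c
          down-to w<c′ with Fin.<-cmp (color w) c
          ... | tri< lt _ _ = lt
          ... | tri≈ _ e _ = contradiction (w , w∈ , e) missing
          ... | tri> _ _ gt = contradiction w<c′ (none w∈ gt)

        compatible-c : ∀ {u} → color u ≡ c → 𝟙 (compatible? t u) ≈ β (space u)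
        compatible-c {u} ≡.refl = 𝟙-cong (compatible? t u) (β? (space u))
          (λ (bel , abv) → below⁻ (space-Level u) bel , above⁻ (λ w∈ c′<w → abv w∈ (ℕ.<-trans c<c′ c′<w)))
          (λ (A⊑ , ⊑B) → below⁺ (space-Level u) A⊑ , (λ w∈ c<w → above⁺ ⊑B w∈ (proj₁ (between w∈) c<w)))

        compatible-c′ : ∀ {v} → color v ≡ c′ → 𝟙 (compatible? t v) ≈ β (space v)
        compatible-c′ {v} ≡.refl = 𝟙-cong (compatible? t v) (β? (space v))
          (λ (bel , abv) → below⁻ (space-Level v) (λ w∈ w<c → bel w∈ (ℕ.<-trans w<c c<c′)) , above⁻ abv)
          (λ (A⊑ , ⊑B) → (λ w∈ w<c′ → below⁺ (space-Level v) A⊑ w∈ (proj₂ (between w∈) w<c′)) , above⁺ ⊑B)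

        ν≈ : ∀ {u v} → color u ≡ c → color v ≡ c′ → ν u v ≈ κ₀ * (β (space u) * (β (space v) * ζ (space u) (space v)))
        ν≈ cu cv = trans (ν-pair′ cu cv) (*-congˡ (*-cong (compatible-c cu) (*-congʳ (compatible-c′ cv))))

        -- Summing ν over the vertices of color c′ counts the subspaces above u in the interval.
        -- This yields the coefficient that `inclusion-bound` attaches to the energy of f; `μ-c′`
        -- yields the other one.
        μ-c : ∀ {u} → color u ≡ c → μ u ≈ κ₀ * binomial j y * β (space u)
        μ-c {u} cu = begin
          μ u                                                                    ≈⟨ marginal missing′ u ⟨
          ∑ᵥ (λ v → [ v ≐ c′ ] * ν u v)
            ≈⟨ ∑-cong (allFin N) (λ v → 𝟙*-cong (color v Fin.≟ c′) (λ cv → ν≈ cu cv)) ⟩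
          ∑ᵥ (λ v → [ v ≐ c′ ] * (κ₀ * (β (space u) * (β (space v) * ζ (space u) (space v)))))
            ≈⟨ ∑ᵥ-spaces c′ (λ W → κ₀ * (β (space u) * (β W * ζ (space u) W))) ⟩
          E (λ W → 𝟙 (Level? m W) * (κ₀ * (β (space u) * (β W * ζ (space u) W))))
            ≈⟨ E-cong (λ W → trans (solve 5 (λ l k b w z → l :* (k :* (b :* (w :* z))) := k :* (b :* ((l :* w) :* z))) refl
                 (𝟙 (Level? m W)) κ₀ (β (space u)) (β W) (ζ (space u) W)) (*-congˡ (*-congˡ (*-congʳ (sym (χ≈ m W)))))) ⟩
          E (λ W → κ₀ * (β (space u) * (χ m W * ζ (space u) W)))
            ≈⟨ trans (*-congˡ (*-∑ elements _ _)) (*-∑ elements _ _) ⟨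
          κ₀ * (β (space u) * E (λ W → χ m W * ζ (space u) W))
            ≈⟨ *-congˡ (𝟙*-cong (β? (space u)) (λ (A⊑ , ⊑B) → above-count eq eq′ (level-c , A⊑ , ⊑B))) ⟩
          κ₀ * (β (space u) * binomial j y)
            ≈⟨ solve 3 (λ k b n → k :* (b :* n) := k :* n :* b) refl κ₀ (β (space u)) (binomial j y) ⟩
          κ₀ * binomial j y * β (space u)                                         ∎
          where
          level-c : Level n (space u)
          level-c = ≡.subst (λ e → Level (rank e) (space u)) cu (space-Level u)

        μ-c′ : ∀ {v} → color v ≡ c′ → μ v ≈ κ₀ * binomial x₀ j * β (space v)
        μ-c′ {v} cv = begin
          μ v                                                                    ≈⟨ marginal missing v ⟨
          ∑ᵥ (λ u → [ u ≐ c ] * ν v u)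
            ≈⟨ ∑-cong (allFin N) (λ u → 𝟙*-cong (color u Fin.≟ c) (λ cu → trans (ν-sym v u) (ν≈ cu cv))) ⟩
          ∑ᵥ (λ u → [ u ≐ c ] * (κ₀ * (β (space u) * (β (space v) * ζ (space u) (space v)))))
            ≈⟨ ∑ᵥ-spaces c (λ W → κ₀ * (β W * (β (space v) * ζ W (space v)))) ⟩
          E (λ W → 𝟙 (Level? n W) * (κ₀ * (β W * (β (space v) * ζ W (space v)))))
            ≈⟨ E-cong (λ W → trans (solve 5 (λ l k b w z → l :* (k :* (w :* (b :* z))) := k :* (b :* ((l :* w) :* z))) refl
                 (𝟙 (Level? n W)) κ₀ (β (space v)) (β W) (ζ W (space v))) (*-congˡ (*-congˡ (*-congʳ (sym (χ≈ n W)))))) ⟩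
          E (λ W → κ₀ * (β (space v) * (χ n W * ζ W (space v))))
            ≈⟨ trans (*-congˡ (*-∑ elements _ _)) (*-∑ elements _ _) ⟨
          κ₀ * (β (space v) * E (λ W → χ n W * ζ W (space v)))
            ≈⟨ *-congˡ (𝟙*-cong (β? (space v)) (λ (A⊑ , ⊑B) → below-count eq (level-c′ , A⊑ , ⊑B))) ⟩
          κ₀ * (β (space v) * binomial x₀ j)
            ≈⟨ solve 3 (λ k b n → k :* (b :* n) := k :* n :* b) refl κ₀ (β (space v)) (binomial x₀ j) ⟩
          κ₀ * binomial x₀ j * β (space v)                                        ∎
          where
          level-c′ : Level m (space v)
          level-c′ = ≡.subst (λ e → Level (rank e) (space v)) cv (space-Level v)

        on-interval : ∀ e {r} h (φ : V → Carrier) (ψ : Fin N → Carrier) →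
          (∀ {v} → color v ≡ e → μ v ≈ r * β (space v)) → (∀ {v} → color v ≡ e → ψ v ≈ φ (space v)) →
          rank e ≡ h → ∑ᵥ (λ v → [ v ≐ e ] * (μ v * ψ v)) ≈ r * E (λ W → χ h W * φ W)
        on-interval e {r} h φ ψ μ≈ ψ≈ ≡.refl = begin
          ∑ᵥ (λ v → [ v ≐ e ] * (μ v * ψ v))
            ≈⟨ ∑-cong (allFin N) (λ v → 𝟙*-cong (color v Fin.≟ e) (λ cv → *-cong (μ≈ cv) (ψ≈ cv))) ⟩
          ∑ᵥ (λ v → [ v ≐ e ] * (r * β (space v) * φ (space v)))
            ≈⟨ ∑ᵥ-spaces e (λ W → r * β W * φ W) ⟩
          E (λ W → 𝟙 (Level? h W) * (r * β W * φ W))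
            ≈⟨ E-cong (λ W → trans (solve 4 (λ l r b f → l :* (r :* b :* f) := r :* ((l :* b) :* f)) refl (𝟙 (Level? h W)) r (β W) (φ W))
                                   (*-congˡ (*-congʳ (sym (χ≈ h W))))) ⟩
          E (λ W → r * (χ h W * φ W))
            ≈⟨ *-∑ elements _ _ ⟨
          r * E (λ W → χ h W * φ W) ∎

        f≈ : ∀ {v} → color v ≡ c → f v ≈ f̂ (space v)
        f≈ cv = sym (extend-space f cv)
        g≈ : ∀ {v} → color v ≡ c′ → g v ≈ ĝ (space v)
        g≈ cv = sym (extend-space g cv)

        mean≈0 : mean n f̂ ≈ 0#
        mean≈0 = *-cancel-0 (proj₂ (pos-* κ₀>0 (binomial>0 j y)))
          (trans (sym (on-interval c n f̂ f μ-c f≈ ≡.refl)) mean-f)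

        energy-f : energy-on c f ≈ κ₀ * binomial j y * energy n f̂
        energy-f = on-interval c n (λ W → f̂ W * f̂ W) (λ v → f v * f v) μ-c (λ cv → *-cong (f≈ cv) (f≈ cv)) ≡.refl

        energy-g : energy-on c′ g ≈ κ₀ * binomial x₀ j * energy m ĝ
        energy-g = on-interval c′ m (λ W → ĝ W * ĝ W) (λ v → g v * g v) μ-c′ (λ cv → *-cong (g≈ cv) (g≈ cv)) ≡.refl

        rhs≈ : κ₀ * (ρ ^ j * (binomial j y * energy n f̂ + binomial x₀ j * energy m ĝ)) ≈
               ρ ^ j * (energy-on c f + energy-on c′ g)
        rhs≈ = trans (solve 6 (λ k r a e b h → k :* (r :* (a :* e :+ b :* h)) := r :* (k :* a :* e :+ k :* b :* h)) refl
                 κ₀ (ρ ^ j) (binomial j y) (energy n f̂) (binomial x₀ j) (energy m ĝ))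
               (*-congˡ (sym (+-cong energy-f energy-g)))

        cross≈ : (1# + 1#) * cross c c′ f g ≈ κ₀ * ((1# + 1#) * E (λ W → χ m W * (up n f̂ W * ĝ W)))
        cross≈ = trans (*-congˡ cross≈′) (solve 3 (λ o k p → o :* (k :* p) := k :* (o :* p)) refl (1# + 1#) κ₀ _)
          where
          Ψ : V → V → Carrier
          Ψ U W = κ₀ * (β U * (β W * ζ U W)) * (f̂ U * ĝ W)
          cross≈′ : cross c c′ f g ≈ κ₀ * E (λ W → χ m W * (up n f̂ W * ĝ W))
          cross≈′ = begin
            cross c c′ f g
              ≈⟨ ∑-cong (allFin N) (λ u → ∑-cong (allFin N) (λ v → 𝟙*-cong (color u Fin.≟ c) (λ cu →
                   𝟙*-cong (color v Fin.≟ c′) (λ cv → *-cong (ν≈ cu cv) (*-cong (f≈ cu) (g≈ cv)))))) ⟩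
            ∑ᵥ (λ u → ∑ᵥ (λ v → [ u ≐ c ] * ([ v ≐ c′ ] * Ψ (space u) (space v))))
              ≈⟨ ∑∑-spaces c c′ Ψ ⟩
            E (λ U → 𝟙 (Level? n U) * E (λ W → 𝟙 (Level? m W) * Ψ U W))
              ≈⟨ E-cong (λ U → *-∑ elements _ _) ⟩
            E (λ U → E (λ W → 𝟙 (Level? n U) * (𝟙 (Level? m W) * Ψ U W)))
              ≈⟨ ∑-comm elements elements _ ⟩
            E (λ W → E (λ U → 𝟙 (Level? n U) * (𝟙 (Level? m W) * Ψ U W)))
              ≈⟨ E-cong (λ W → E-cong (λ U → trans (solve 8 (λ l l′ k b b′ z f g →
                   l :* (l′ :* (k :* (b :* (b′ :* z)) :* (f :* g))) := k :* (l′ :* b′) :* g :* (l :* b :* f :* z)) refl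
                     (𝟙 (Level? n U)) (𝟙 (Level? m W)) κ₀ (β U) (β W) (ζ U W) (f̂ U) (ĝ W))
                   (*-cong (*-congʳ (*-congˡ (sym (χ≈ m W)))) (*-congʳ (*-congʳ (sym (χ≈ n U))))))) ⟩
            E (λ W → E (λ U → κ₀ * χ m W * ĝ W * (χ n U * f̂ U * ζ U W)))
              ≈⟨ E-cong (λ W → *-∑ elements _ _) ⟨
            E (λ W → κ₀ * χ m W * ĝ W * up n f̂ W)
              ≈⟨ E-cong (λ W → solve 4 (λ k x g u → k :* x :* g :* u := k :* (x :* (u :* g))) refl κ₀ (χ m W) (ĝ W) (up n f̂ W)) ⟩
            E (λ W → κ₀ * (χ m W * (up n f̂ W * ĝ W)))
              ≈⟨ *-∑ elements _ _ ⟨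
            κ₀ * E (λ W → χ m W * (up n f̂ W * ĝ W)) ∎

      pair-bound : PairBound
      pair-bound with Fin.any? (λ w → (w ∈? t) ×-dec ((c Fin.<? color w) ×-dec (color w Fin.<? c′)))
      ... | yes (w , w∈ , c<w , w<c′) = separated w∈ c<w w<c′
      ... | no none = adjacent (λ {w} w∈ c<w w<c′ → none (w , w∈ , c<w , w<c′))

-- Reduction to eigenvectors orthogonal to the constants.

module SecondEigenvalue {c ℓ₁ ℓ₂} (K : RealClosedField c ℓ₁ ℓ₂) where
  open OrderedField K
  open Spectral K
  open import Algebra.Properties.Semiring.Sum (RealClosedField.semiring K) public
    using (sum-cong-≋; ∑-distrib-+; *-distribˡ-sum; sum-replicate-zero)
  open import Data.Nat.Base using (z≤n)
  open import Data.Vec.Functional using (Vector)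
  open import Relation.Binary.Reasoning.Setoid setoid

  Eigen : ∀ {n} → Matrix n → Carrier → Vector Carrier n → Set _
  Eigen M l φ = ∀ v → sum (λ u → M v u * φ u) ≈ l * φ v

  sum-linear : ∀ {n} (w : Vector Carrier n) x y (φ ψ : Vector Carrier n) →
               sum (λ v → w v * (x * φ v + y * ψ v)) ≈ x * sum (λ v → w v * φ v) + y * sum (λ v → w v * ψ v)
  sum-linear w x y φ ψ = begin
    sum (λ v → w v * (x * φ v + y * ψ v))
      ≈⟨ sum-cong-≋ (λ v → solve 5 (λ w x y f g → w :* (x :* f :+ y :* g) := x :* (w :* f) :+ y :* (w :* g)) refl (w v) x y (φ v) (ψ v)) ⟩
    sum (λ v → x * (w v * φ v) + y * (w v * ψ v))
      ≈⟨ ∑-distrib-+ (λ v → x * (w v * φ v)) (λ v → y * (w v * ψ v)) ⟩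
    sum (λ v → x * (w v * φ v)) + sum (λ v → y * (w v * ψ v))
      ≈⟨ +-cong (*-distribˡ-sum x (λ v → w v * φ v)) (*-distribˡ-sum y (λ v → w v * ψ v)) ⟨
    x * sum (λ v → w v * φ v) + y * sum (λ v → w v * ψ v) ∎

  -- A second eigenvector that is not orthogonal to the constants has
  -- eigenvalue 1; then so has the first one, or it is orthogonal to them, and
  -- in any case some combination is orthogonal to the constants and has an
  -- eigenvalue at least as large.
  second-eigenvalue : ∀ {n} (M : Matrix n) (w : Vector Carrier n) {b : Carrier} →
    (∀ {l φ} → Eigen M l φ → l ≈ 1# ⊎ sum (λ v → w v * φ v) ≈ 0#) →
    (∀ {l φ} → Eigen M l φ → sum (λ v → w v * φ v) ≈ 0# → ¬ (∀ v → φ v ≈ 0#) → l ≤ b) →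
    ∀ μ → IsSecondLargestEigenvalue M μ → μ ≤ b
  second-eigenvalue {suc (suc n)} M w {b} one-or-orthogonal bound μ (Λ , suc zero , ≡.refl , μ≈) =
    ≤-respˡ (sym μ≈) (by-cases (one-or-orthogonal (eigen₁)) (one-or-orthogonal eigen₀))
    where
    open Spectrum Λ
    e₀ = eigenvector zero
    e₁ = eigenvector (suc zero)
    l₀ = eigenvalue zero
    l₁ = eigenvalue (suc zero)
    eigen₀ : Eigen M l₀ e₀
    eigen₀ = isEigen zero
    eigen₁ : Eigen M l₁ e₁
    eigen₁ = isEigen (suc zero)
    l₁≤l₀ : l₁ ≤ l₀
    l₁≤l₀ = decreasing z≤n
    combination : Carrier → Carrier → Vector Carrier (suc (suc n))
    combination x y v = x * e₀ v + y * e₁ v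
    coefficient : Carrier → Carrier → Vector Carrier (suc (suc n))
    coefficient x y zero          = x
    coefficient x y (suc zero)    = y
    coefficient x y (suc (suc _)) = 0#
    vanishing : ∀ x y → (∀ v → combination x y v ≈ 0#) → ∀ i → coefficient x y i ≈ 0#
    vanishing x y h = independent (coefficient x y) (λ v → trans
      (+-congˡ (trans (+-congˡ (trans (sum-cong-≋ {n} {λ i → 0# * eigenvector (suc (suc i)) v} {λ _ → 0#} (λ _ → zeroˡ _)) (sum-replicate-zero n))) (+-identityʳ _))) (h v))
    independent₀ : ¬ (∀ v → e₀ v ≈ 0#)
    independent₀ h = 1≉0 (vanishing 1# 0# (λ v → trans (+-cong (trans (*-congˡ (h v)) (zeroʳ _)) (zeroˡ _)) (+-identityʳ _)) zero)
    independent₁ : ¬ (∀ v → e₁ v ≈ 0#)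
    independent₁ h = 1≉0 (vanishing 0# 1# (λ v → trans (+-cong (zeroˡ _) (trans (*-congˡ (h v)) (zeroʳ _))) (+-identityʳ _)) (suc zero))
    m₀ = sum (λ v → w v * e₀ v)
    m₁ = sum (λ v → w v * e₁ v)
    by-cases : l₁ ≈ 1# ⊎ m₁ ≈ 0# → l₀ ≈ 1# ⊎ m₀ ≈ 0# → l₁ ≤ b
    by-cases (inj₂ m₁≈0) _ = bound eigen₁ m₁≈0 independent₁
    by-cases _ (inj₂ m₀≈0) = ≤-trans l₁≤l₀ (bound eigen₀ m₀≈0 independent₀)
    by-cases (inj₁ l₁≈1) (inj₁ l₀≈1) with m₁ ≟ 0#
    ... | yes m₁≈0 = bound eigen₁ m₁≈0 independent₁
    -- In m₁ e₀ - m₀ e₁ the two means cancel, and the vector is nonzero by independence because its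
    -- coefficient m₁ is.
    ... | no m₁≉0 = ≤-respˡ (sym l₁≈1) (bound eigen orthogonal (λ h → m₁≉0 (vanishing m₁ (- m₀) h zero)))
      where
      orthogonal : sum (λ v → w v * combination m₁ (- m₀) v) ≈ 0#
      orthogonal = trans (sum-linear w m₁ (- m₀) e₀ e₁)
        (solve 2 (λ s t → s :* t :+ (:- t) :* s := κ 0) refl m₁ m₀)
      eigen : Eigen M 1# (combination m₁ (- m₀))
      eigen v = begin
        sum (λ u → M v u * combination m₁ (- m₀) u)                                       ≈⟨ sum-linear (M v) m₁ (- m₀) e₀ e₁ ⟩
        m₁ * sum (λ u → M v u * e₀ u) + (- m₀) * sum (λ u → M v u * e₁ u)                 ≈⟨ +-cong (*-congˡ (eigen₀ v)) (*-congˡ (eigen₁ v)) ⟩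
        m₁ * (l₀ * e₀ v) + (- m₀) * (l₁ * e₁ v)                                           ≈⟨ +-cong (*-congˡ (*-congʳ l₀≈1)) (*-congˡ (*-congʳ l₁≈1)) ⟩
        m₁ * (1# * e₀ v) + (- m₀) * (1# * e₁ v)
          ≈⟨ solve 5 (λ o s t e f → s :* (o :* e) :+ t :* (o :* f) := o :* (s :* e :+ t :* f)) refl 1# m₁ (- m₀) (e₀ v) (e₁ v) ⟩
        1# * combination m₁ (- m₀) v                                                      ∎

-- Partite graphs whose edges are weighted by counts of top faces.

module WeightedPartite {c ℓ₁ ℓ₂} (K : RealClosedField c ℓ₁ ℓ₂) {N k} (color : Fin N → Fin k)
                       (ν : Fin N → Fin N → RealClosedField.Carrier K) where
  open OrderedField K
  open Spectral K
  open SecondEigenvalue K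
  open import Data.List.Base using (length; lookup)
  open import Data.List.Relation.Unary.All as All using (All)
  open import Data.Vec.Functional using (Vector)
  open import Relation.Binary.Reasoning.Setoid setoid

  square-zero : ∀ {x} → x * x ≈ 0# → x ≈ 0#
  square-zero {x} xx≈0 with x ≟ 0#
  ... | yes x≈0 = x≈0
  ... | no x≉0  = *-cancel-0 x≉0 xx≈0

  ∑ᵥ : (Fin N → Carrier) → Carrier
  ∑ᵥ f = ∑ (allFin N) f

  ∑ᶜ : (Fin k → Carrier) → Carrier
  ∑ᶜ f = ∑ (allFin k) f

  -- Eigenvectors are indexed by positions in the vertex list, whereas the counting arguments sum
  -- over all of `Fin N`. Uniqueness of the list makes the extension well defined.
  extend-by-zero : ∀ {L : List (Fin N)} → Unique L → (φ : Vector Carrier (length L)) →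
                   ∃ λ (f : Fin N → Carrier) → ∀ i → f (lookup L i) ≈ φ i
  extend-by-zero {[]} _ φ = (λ _ → 0#) , λ ()
  extend-by-zero {x ∷ L} (x∉L ∷ uL) φ with extend-by-zero uL (λ i → φ (suc i))
  ... | f , f≈ = f′ , f′≈
    where
    f′ : Fin N → Carrier
    f′ v = 𝟙 (v Fin.≟ x) * φ zero + 𝟙 (¬? (v Fin.≟ x)) * f v
    f′≈ : ∀ i → f′ (lookup (x ∷ L) i) ≈ φ i
    f′≈ zero = trans (+-cong (𝟙*-yes (x Fin.≟ x) ≡.refl _) (𝟙*-no (¬? (x Fin.≟ x)) (λ h → h ≡.refl) _)) (+-identityʳ _)
    f′≈ (suc i) = trans (+-cong (𝟙*-no (y Fin.≟ x) (λ y≡x → y≢x y≡x) _) (𝟙*-yes (¬? (y Fin.≟ x)) y≢x _))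
                        (trans (+-identityˡ _) (f≈ i))
      where
      y = lookup L i
      y≢x : y ≢ x
      y≢x y≡x = All.lookup x∉L (∈-lookup {xs = L} i) (≡.sym y≡x)

  μ : Fin N → Carrier
  μ v = ν v v

  [_≐_] : Fin N → Fin k → Carrier
  [ v ≐ e ] = 𝟙 (color v Fin.≟ e)

  mean-on : Fin k → (Fin N → Carrier) → Carrier
  mean-on e f = ∑ᵥ (λ v → [ v ≐ e ] * (μ v * f v))

  energy-on : Fin k → (Fin N → Carrier) → Carrier
  energy-on e f = ∑ᵥ (λ v → [ v ≐ e ] * (μ v * (f v * f v)))

  cross : Fin k → Fin k → (Fin N → Carrier) → (Fin N → Carrier) → Carrier
  cross e e′ f g = ∑ᵥ (λ u → ∑ᵥ (λ v → [ u ≐ e ] * ([ v ≐ e′ ] * (ν u v * (f u * g v)))))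

  cross-by-columns : ∀ p e′ e f g →
    p * cross e′ e f g ≈ ∑ᵥ (λ v → [ v ≐ e ] * (g v * (p * ∑ᵥ (λ u → [ u ≐ e′ ] * (ν u v * f u)))))
  cross-by-columns p e′ e f g = begin
    p * cross e′ e f g
      ≈⟨ trans (*-congˡ (∑-comm (allFin N) (allFin N) _)) (*-∑ (allFin N) _ p) ⟩
    ∑ᵥ (λ v → p * ∑ᵥ (λ u → [ u ≐ e′ ] * ([ v ≐ e ] * (ν u v * (f u * g v)))))
      ≈⟨ ∑-cong (allFin N) (λ v → *-congˡ (∑-cong (allFin N) (λ u → regroup [ u ≐ e′ ] [ v ≐ e ] (ν u v) (f u) (g v)))) ⟩
    ∑ᵥ (λ v → p * ∑ᵥ (λ u → ([ v ≐ e ] * g v) * ([ u ≐ e′ ] * (ν u v * f u))))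
      ≈⟨ ∑-cong (allFin N) (λ v → *-congˡ (*-∑ (allFin N) _ _)) ⟨
    ∑ᵥ (λ v → p * (([ v ≐ e ] * g v) * ∑ᵥ (λ u → [ u ≐ e′ ] * (ν u v * f u))))
      ≈⟨ ∑-cong (allFin N) (λ v → regroup′ p [ v ≐ e ] (g v) _) ⟩
    ∑ᵥ (λ v → [ v ≐ e ] * (g v * (p * ∑ᵥ (λ u → [ u ≐ e′ ] * (ν u v * f u))))) ∎
    where
    regroup : ∀ a b n f g → a * (b * (n * (f * g))) ≈ (b * g) * (a * (n * f))
    regroup = solve 5 (λ a b n f g → a :* (b :* (n :* (f :* g))) := (b :* g) :* (a :* (n :* f))) refl
    regroup′ : ∀ p b g s → p * ((b * g) * s) ≈ b * (g * (p * s))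
    regroup′ = solve 4 (λ p b g s → p :* ((b :* g) :* s) := b :* (g :* (p :* s))) refl

module WeightedPartiteDefinition {c ℓ₁ ℓ₂} (K : RealClosedField c ℓ₁ ℓ₂) {N k} (color : Fin N → Fin k)
                                 (ν : Fin N → Fin N → RealClosedField.Carrier K) where
  open OrderedField K
  open Spectral K
  open WeightedPartite K color ν

  -- ν u v stands for the number of top faces through u and v, so μ v = ν v v is
  -- the number of those through v, and P for the set of colors of the vertices
  -- of the graph; a top face has exactly one vertex of each color in P.
  record IsWeightedPartite (G : WeightedGraph N) {P : Fin k → Set} (P? : ∀ e → Dec (P e)) (θ : Fin k → Fin k → Carrier)
                           (c₀ D R : Carrier) : Set (c ⊔ ℓ₁ ⊔ ℓ₂) where
    open WeightedGraph G using (Vertex; weight)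
    field
      -- `c₀` converts ν into edge weights and cancels in the adjacency operator; `D` is the number
      -- of other colors; `θ e e′` bounds the cross term of two colors, and `R` the row sums of θ.
      -- Together they bound the second eigenvalue by R / D.
      c₀>0         : Positive c₀
      D>0          : Positive D
      ν-sym        : ∀ u v → ν u v ≈ ν v u
      ν≥0          : ∀ u v → 0# ≤ ν u v
      marginal     : ∀ {e} → P e → ∀ u → ∑ᵥ (λ v → [ v ≐ e ] * ν u v) ≈ μ u
      ν-same-color : ∀ {u v} → color u ≡ color v → u ≢ v → ν u v ≈ 0#
      weight-≡     : ∀ v → weight v v ≈ 0#
      weight-≢     : ∀ {u v} → u ≢ v → weight u v ≈ c₀ * ν u v
      vertex⁻      : ∀ {v} → Vertex v → P (color v) × Positive (μ v)
      vertex⁺      : ∀ {v} → P (color v) → Positive (μ v) → Vertex v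
      R≥0          : 0# ≤ R
      θ-sym        : ∀ e e′ → θ e e′ ≈ θ e′ e
      θ≥0          : ∀ e e′ → 0# ≤ θ e e′
      row          : ∀ {e} → P e → ∑ᶜ (λ e′ → 𝟙 (P? e′) * (𝟙 (¬? (e′ Fin.≟ e)) * θ e′ e)) ≤ R
      degree       : ∀ {e} → P e → ∑ᶜ (λ e′ → 𝟙 (P? e′) * 𝟙 (¬? (e′ Fin.≟ e))) ≈ D
      pair-bound   : ∀ {e e′} → P e → P e′ → e ≢ e′ → ∀ f → (∀ {e} → P e → mean-on e f ≈ 0#) →
                     (1# + 1#) * cross e e′ f f ≤ θ e e′ * (energy-on e f + energy-on e′ f)

-- From bounds for pairs of colors to the second eigenvalue.

module WeightedPartiteBound {c ℓ₁ ℓ₂} (K : RealClosedField c ℓ₁ ℓ₂) {N k} {color : Fin N → Fin k}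
  {ν : Fin N → Fin N → RealClosedField.Carrier K} {G : Spectral.WeightedGraph K N} {P : Fin k → Set} {P? : ∀ e → Dec (P e)}
  {θ : Fin k → Fin k → RealClosedField.Carrier K} {c₀ D R : RealClosedField.Carrier K}
  (W : WeightedPartiteDefinition.IsWeightedPartite K color ν G P? θ c₀ D R) where
  open OrderedField K
  open Spectral K
  open SecondEigenvalue K
  open import Data.List.Base using (lookup)
  open import Data.List.Relation.Unary.All as All using (All)
  open import Data.Sum.Base using (map₂)
  open import Data.Vec.Functional using (Vector)
  open import Relation.Binary.Reasoning.Setoid setoid
  open WeightedPartite K color ν
  open WeightedPartiteDefinition K color ν
  open WeightedGraph G
  open IsWeightedPartite W

  -- On the colors in `P`, the adjacency matrix of the complete graph.
  ε : Fin k → Fin k → Carrier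
  ε e′ e = 𝟙 (P? e′) * 𝟙 (¬? (e′ Fin.≟ e))

  μ≈0⇒ν≈0 : ∀ {u v} → P (color v) → μ u ≈ 0# → ν u v ≈ 0#
  μ≈0⇒ν≈0 {u} {v} Pv μu≈0 = trans (sym (𝟙*-yes (color v Fin.≟ color v) ≡.refl _))
    (∑≈0⇒≈0 (allFin N) (λ w → 𝟙≥0 (color w Fin.≟ color v) *≥ ν≥0 u w) (trans (marginal Pv u) μu≈0) (∈-allFin v))

  vertex-or-0 : ∀ {v} → P (color v) → Vertex v ⊎ μ v ≈ 0#
  vertex-or-0 {v} Pv with μ v ≟ 0#
  ... | yes μ≈0 = inj₂ μ≈0
  ... | no μ≉0  = inj₁ (vertex⁺ Pv (ν≥0 v v , μ≉0))

  weight-ν : ∀ {v} → P (color v) → ∀ u →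
             𝟙 (Vertex? u) * weight u v ≈ c₀ * (𝟙 (P? (color u)) * (𝟙 (¬? (color u Fin.≟ color v)) * ν u v))
  weight-ν {v} Pv u with Vertex? u
  ... | no ¬V = trans (zeroˡ _) (sym (trans (*-congˡ (𝟙*-zero (P? (color u)) (λ Pu →
          trans (*-congˡ (ν≈0 Pu)) (zeroʳ _)))) (zeroʳ _)))
    where
    ν≈0 : P (color u) → ν u v ≈ 0#
    ν≈0 Pu with vertex-or-0 Pu
    ... | inj₁ V    = contradiction V ¬V
    ... | inj₂ μ≈0  = μ≈0⇒ν≈0 Pv μ≈0
  ... | yes V = trans (*-identityˡ _) (trans (by-color (color u Fin.≟ color v)) (*-congˡ (sym (𝟙*-yes (P? (color u)) (proj₁ (vertex⁻ V)) _))))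
    where
    by-color : (d : Dec (color u ≡ color v)) → weight u v ≈ c₀ * (𝟙 (¬? d) * ν u v)
    by-color (no cu≢cv) = trans (weight-≢ (λ u≡v → cu≢cv (≡.cong color u≡v))) (*-congˡ (sym (*-identityˡ _)))
    by-color (yes cu≡cv) with u Fin.≟ v
    ... | yes ≡.refl = trans (weight-≡ u) (sym (trans (*-congˡ (zeroˡ _)) (zeroʳ _)))
    ... | no u≢v = trans (weight-≢ u≢v) (trans (*-congˡ (ν-same-color cu≡cv u≢v)) (trans (zeroʳ _) (sym (trans (*-congˡ (zeroˡ _)) (zeroʳ _)))))

  neighbours : ∀ {v} → P (color v) → ∀ (g : Fin N → Carrier) →
    ∑ᵥ (λ u → 𝟙 (Vertex? u) * (weight u v * g u)) ≈
    c₀ * ∑ᶜ (λ e → ε e (color v) * ∑ᵥ (λ u → [ u ≐ e ] * (ν u v * g u)))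
  neighbours {v} Pv g = begin
    ∑ᵥ (λ u → 𝟙 (Vertex? u) * (weight u v * g u))
      ≈⟨ ∑-cong (allFin N) (λ u → trans (sym (*-assoc _ _ _)) (*-congʳ (weight-ν Pv u))) ⟩
    ∑ᵥ (λ u → c₀ * (𝟙 (P? (color u)) * (𝟙 (¬? (color u Fin.≟ color v)) * ν u v)) * g u)
      ≈⟨ ∑-cong (allFin N) (λ u → solve 5 (λ c p e n g → c :* (p :* (e :* n)) :* g := c :* ((p :* e) :* (n :* g))) refl
           c₀ (𝟙 (P? (color u))) (𝟙 (¬? (color u Fin.≟ color v))) (ν u v) (g u)) ⟩
    ∑ᵥ (λ u → c₀ * (ε (color u) (color v) * (ν u v * g u)))
      ≈⟨ *-∑ (allFin N) _ c₀ ⟨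
    c₀ * ∑ᵥ (λ u → ε (color u) (color v) * (ν u v * g u))
      ≈⟨ *-congˡ (∑-cong (allFin N) (λ u → sym (∑-unique (λ e → color u Fin.≟ e) (allFin⁺ k)
           (λ e → ε e (color v) * (ν u v * g u)) (∈-allFin (color u)) ≡.refl ≡.sym))) ⟩
    c₀ * ∑ᵥ (λ u → ∑ᶜ (λ e → [ u ≐ e ] * (ε e (color v) * (ν u v * g u))))
      ≈⟨ *-congˡ (∑-comm (allFin N) (allFin k) _) ⟩
    c₀ * ∑ᶜ (λ e → ∑ᵥ (λ u → [ u ≐ e ] * (ε e (color v) * (ν u v * g u))))
      ≈⟨ *-congˡ (∑-cong (allFin k) (λ e → trans (*-∑ (allFin N) _ _) (∑-cong (allFin N) (λ u →
           solve 3 (λ a b c → b :* (a :* c) := a :* (b :* c)) refl [ u ≐ e ] (ε e (color v)) (ν u v * g u))))) ⟨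
    c₀ * ∑ᶜ (λ e → ε e (color v) * ∑ᵥ (λ u → [ u ≐ e ] * (ν u v * g u))) ∎

  -- Each of the `D` other colors contributes `μ v` by `marginal`. Thus `π₀` is proportional to μ,
  -- and the normalisation of the adjacency operator is division by D μ.
  degree-sum : ∀ {v} → P (color v) → ∑ᵥ (λ u → 𝟙 (Vertex? u) * weight u v) ≈ c₀ * (D * μ v)
  degree-sum {v} Pv = begin
    ∑ᵥ (λ u → 𝟙 (Vertex? u) * weight u v)
      ≈⟨ ∑-cong (allFin N) (λ u → *-congˡ (*-identityʳ _)) ⟨
    ∑ᵥ (λ u → 𝟙 (Vertex? u) * (weight u v * 1#))
      ≈⟨ neighbours Pv (λ _ → 1#) ⟩
    c₀ * ∑ᶜ (λ e → ε e (color v) * ∑ᵥ (λ u → [ u ≐ e ] * (ν u v * 1#)))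
      ≈⟨ *-congˡ (∑-cong (allFin k) (λ e → trans (*-assoc _ _ _) (trans (𝟙*-cong (P? e) (λ Pe → *-congˡ
           (trans (∑-cong (allFin N) (λ u → *-congˡ (trans (*-identityʳ _) (ν-sym u v)))) (marginal Pe v)))) (sym (*-assoc _ _ _))))) ⟩
    c₀ * ∑ᶜ (λ e → ε e (color v) * μ v)
      ≈⟨ *-congˡ (trans (sym (∑-* (allFin k) _ (μ v))) (*-congʳ (degree Pv))) ⟩
    c₀ * (D * μ v) ∎

  ι : Fin order → Fin N
  ι = lookup vertices

  vertices-unique : Unique vertices
  vertices-unique = filter⁺ Vertex? (allFin⁺ N)

  ι-vertex : ∀ i → Vertex (ι i)
  ι-vertex i = proj₂ (∈-filter⁻ Vertex? {xs = allFin N} (∈-lookup {xs = vertices} i))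

  sum-vertices : ∀ (g : Fin N → Carrier) → sum (λ i → g (ι i)) ≈ ∑ᵥ (λ v → 𝟙 (Vertex? v) * g v)
  sum-vertices g = trans (∑-sum vertices g) (∑-filter Vertex? (allFin N) g)

  at-vertices : ∀ {Q : Fin N → Set ℓ₁} → (∀ i → Q (ι i)) → ∀ {v} → Vertex v → Q v
  at-vertices {Q} h {v} V = on-list vertices h (∈-filter⁺ Vertex? (∈-allFin v) V)
    where
    on-list : ∀ L → (∀ i → Q (lookup L i)) → v List.∈ L → Q v
    on-list (x ∷ L) h (here ≡.refl) = h zero
    on-list (x ∷ L) h (there p) = on-list L (λ i → h (suc i)) p

  -- Multiplying by 2 π₀ clears the denominators. The equation then makes sense for every index
  -- whose color is in `P`, since both sides vanish where μ does, and it can be summed over all of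
  -- `Fin N`.
  eigen-equation : ∀ {l φ} → Eigen adjacency l φ → ∀ (f : Fin N → Carrier) → (∀ i → f (ι i) ≈ φ i) →
    ∀ {v} → P (color v) → ∑ᶜ (λ e → ε e (color v) * ∑ᵥ (λ u → [ u ≐ e ] * (ν u v * f u))) ≈ l * D * (μ v * f v)
  eigen-equation {l} {φ} eigen f f≈ {v} Pv with vertex-or-0 Pv
  ... | inj₂ μ≈0 = trans (∑-zero (allFin k) (λ e → trans (*-assoc _ _ _) (𝟙*-zero (P? e) (λ Pe →
          trans (*-congˡ (∑-zero (allFin N) (λ u → 𝟙*-zero (color u Fin.≟ e) (λ { ≡.refl →
            trans (*-congʳ (trans (ν-sym u v) (μ≈0⇒ν≈0 Pe μ≈0))) (zeroˡ _) })))) (zeroʳ _)))))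
          (sym (trans (*-congˡ (trans (*-congʳ μ≈0) (zeroˡ _))) (zeroʳ _)))
  ... | inj₁ V = at-vertices {Q} at V
    where
    Q : Fin N → Set ℓ₁
    Q v = ∑ᶜ (λ e → ε e (color v) * ∑ᵥ (λ u → [ u ≐ e ] * (ν u v * f u))) ≈ l * D * (μ v * f v)
    at : ∀ i → Q (ι i)
    at i = *-cancel-≈ (proj₂ c₀>0) (begin
      c₀ * ∑ᶜ (λ e → ε e (color (ι i)) * ∑ᵥ (λ u → [ u ≐ e ] * (ν u (ι i) * f u)))
        ≈⟨ neighbours Pi f ⟨
      ∑ᵥ (λ u → 𝟙 (Vertex? u) * (weight u (ι i) * f u))
        ≈⟨ sum-vertices (λ u → weight u (ι i) * f u) ⟨
      sum (λ j → π₁ j i * f (ι j))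
        ≈⟨ sum-cong-≋ (λ j → *-congˡ (f≈ j)) ⟩
      sum (λ j → π₁ j i * φ j)
        ≈⟨ sum-cong-≋ (λ j → begin
             π₁ j i * φ j                        ≈⟨ *-congʳ (*/ (proj₂ 2π₀>0) (π₁ j i)) ⟨
             2π₀ * (π₁ j i / 2π₀) * φ j          ≈⟨ *-assoc _ _ _ ⟩
             2π₀ * (adjacency i j * φ j)         ∎) ⟩
      sum (λ j → 2π₀ * (adjacency i j * φ j))
        ≈⟨ *-distribˡ-sum 2π₀ (λ j → adjacency i j * φ j) ⟨
      2π₀ * sum (λ j → adjacency i j * φ j)
        ≈⟨ *-cong 2π₀≈ (eigen i) ⟩
      c₀ * (D * μ (ι i)) * (l * φ i)
        ≈⟨ *-congˡ (*-congˡ (f≈ i)) ⟨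
      c₀ * (D * μ (ι i)) * (l * f (ι i))
        ≈⟨ solve 5 (λ c d m l f → c :* (d :* m) :* (l :* f) := c :* (l :* d :* (m :* f))) refl c₀ D (μ (ι i)) l (f (ι i)) ⟩
      c₀ * (l * D * (μ (ι i) * f (ι i))) ∎)
      where
      Pi : P (color (ι i))
      Pi = proj₁ (vertex⁻ (ι-vertex i))
      2π₀ : Carrier
      2π₀ = fromℕ 2 * π₀ i
      2π₀≈ : 2π₀ ≈ c₀ * (D * μ (ι i))
      2π₀≈ = trans (*/ (proj₂ (pos-fromℕ 1)) _) (trans (sum-vertices (λ u → weight u (ι i))) (degree-sum Pi))
      2π₀>0 : Positive 2π₀
      2π₀>0 = pos-resp (sym 2π₀≈) (pos-* c₀>0 (pos-* D>0 (proj₂ (vertex⁻ (ι-vertex i)))))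

  ε-swap : ∀ e e′ x → 𝟙 (P? e) * (ε e′ e * x) ≈ 𝟙 (P? e′) * (ε e e′ * x)
  ε-swap e e′ x = trans (solve 4 (λ p q d x → p :* (q :* d :* x) := q :* (p :* d :* x)) refl (𝟙 (P? e)) (𝟙 (P? e′)) (𝟙 (¬? (e′ Fin.≟ e))) x)
    (*-congˡ (*-congʳ (*-congˡ (𝟙-cong (¬? (e′ Fin.≟ e)) (¬? (e Fin.≟ e′)) (λ h p → h (≡.sym p)) (λ h p → h (≡.sym p))))))

  scale : ∀ s (m : Fin k → Carrier) → s * ∑ᶜ (λ e → 𝟙 (P? e) * m e) ≈ ∑ᶜ (λ e → 𝟙 (P? e) * (s * m e))
  scale s m = trans (*-∑ (allFin k) _ s) (∑-cong (allFin k) (λ e →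
    solve 3 (λ s p m → s :* (p :* m) := p :* (s :* m)) refl s (𝟙 (P? e)) (m e)))

  degree-swap : ∀ (m : Fin k → Carrier) → ∑ᶜ (λ e → 𝟙 (P? e) * ∑ᶜ (λ e′ → ε e′ e * m e′)) ≈ D * ∑ᶜ (λ e → 𝟙 (P? e) * m e)
  degree-swap m = begin
    ∑ᶜ (λ e → 𝟙 (P? e) * ∑ᶜ (λ e′ → ε e′ e * m e′))
      ≈⟨ ∑-cong (allFin k) (λ e → *-∑ (allFin k) _ _) ⟩
    ∑ᶜ (λ e → ∑ᶜ (λ e′ → 𝟙 (P? e) * (ε e′ e * m e′)))
      ≈⟨ ∑-comm (allFin k) (allFin k) _ ⟩
    ∑ᶜ (λ e′ → ∑ᶜ (λ e → 𝟙 (P? e) * (ε e′ e * m e′)))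
      ≈⟨ ∑-cong (allFin k) (λ e′ → ∑-cong (allFin k) (λ e → ε-swap e e′ (m e′))) ⟩
    ∑ᶜ (λ e′ → ∑ᶜ (λ e → 𝟙 (P? e′) * (ε e e′ * m e′)))
      ≈⟨ ∑-cong (allFin k) (λ e′ → trans (*-congˡ (∑-* (allFin k) _ (m e′))) (*-∑ (allFin k) _ _)) ⟨
    ∑ᶜ (λ e′ → 𝟙 (P? e′) * (∑ᶜ (λ e → ε e e′) * m e′))
      ≈⟨ ∑-cong (allFin k) (λ e′ → 𝟙*-cong (P? e′) (λ Pe′ → *-congʳ (degree Pe′))) ⟩
    ∑ᶜ (λ e′ → 𝟙 (P? e′) * (D * m e′))
      ≈⟨ scale D m ⟨
    D * ∑ᶜ (λ e → 𝟙 (P? e) * m e) ∎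

  -- The all-ones matrix is the identity plus the complete graph.
  split-color : ∀ (m : Fin k → Carrier) {e} → P e → 1# * m e + ∑ᶜ (λ e′ → ε e′ e * m e′) ≈ ∑ᶜ (λ e′ → 𝟙 (P? e′) * m e′)
  split-color m {e} Pe = begin
    1# * m e + ∑ᶜ (λ e′ → ε e′ e * m e′)
      ≈⟨ +-congʳ (trans (*-congʳ (sym (𝟙-yes (P? e) Pe)))
           (sym (∑-unique (Fin._≟ e) (allFin⁺ k) (λ e′ → 𝟙 (P? e′) * m e′) (∈-allFin e) ≡.refl (λ p → p)))) ⟩
    ∑ᶜ (λ e′ → 𝟙 (e′ Fin.≟ e) * (𝟙 (P? e′) * m e′)) + ∑ᶜ (λ e′ → ε e′ e * m e′)
      ≈⟨ ∑-+ (allFin k) _ _ ⟨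
    ∑ᶜ (λ e′ → 𝟙 (e′ Fin.≟ e) * (𝟙 (P? e′) * m e′) + ε e′ e * m e′)
      ≈⟨ ∑-cong (allFin k) (λ e′ → either (e′ Fin.≟ e) (𝟙 (P? e′)) (m e′)) ⟩
    ∑ᶜ (λ e′ → 𝟙 (P? e′) * m e′) ∎
    where
    either : ∀ {a} {A : Set a} (d : Dec A) p m → 𝟙 d * (p * m) + p * 𝟙 (¬? d) * m ≈ p * m
    either (yes _) p m = trans (+-cong (*-identityˡ _) (trans (*-congʳ (zeroʳ p)) (zeroˡ m))) (+-identityʳ _)
    either (no _) p m = trans (+-cong (zeroˡ _) (*-congʳ (*-identityʳ p))) (+-identityˡ _)

  𝟙*-mono : ∀ {a} {A : Set a} (d : Dec A) {x y} → (A → x ≤ y) → 𝟙 d * x ≤ 𝟙 d * y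
  𝟙*-mono (yes a) x≤y = *-monoˡ-≤ 1≥0 (x≤y a)
  𝟙*-mono (no _)  _   = ≤-reflexive (trans (zeroˡ _) (sym (zeroˡ _)))

  -- A Schur test: summed over ordered pairs, the two terms of θ (y e′ + y e) contribute equally
  -- because θ is symmetric, and the row sums of θ bound each of them.
  row-sums : ∀ (x : Fin k → Fin k → Carrier) (y : Fin k → Carrier) → (∀ e → 0# ≤ y e) →
    (∀ {e e′} → P e → P e′ → e ≢ e′ → (1# + 1#) * x e e′ ≤ θ e e′ * (y e + y e′)) →
    ∑ᶜ (λ e → 𝟙 (P? e) * ∑ᶜ (λ e′ → ε e′ e * x e′ e)) ≤ ∑ᶜ (λ e → 𝟙 (P? e) * y e) * R
  row-sums x y y≥0 xy = *-cancel-≤ {k = 1# + 1#} (pos-+ pos-1 1≥0)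
    (≤-respˡ lhs (≤-trans (∑-mono (allFin k) (λ e → ∑-mono (allFin k) (λ e′ → term e e′))) (≤-respˡ (sym middle) rhs)))
    where
    two : Carrier
    two = 1# + 1#
    lhs : ∑ᶜ (λ e → ∑ᶜ (λ e′ → 𝟙 (P? e) * (ε e′ e * (two * x e′ e)))) ≈ two * ∑ᶜ (λ e → 𝟙 (P? e) * ∑ᶜ (λ e′ → ε e′ e * x e′ e))
    lhs = begin
      ∑ᶜ (λ e → ∑ᶜ (λ e′ → 𝟙 (P? e) * (ε e′ e * (two * x e′ e))))
        ≈⟨ ∑-cong (allFin k) (λ e → ∑-cong (allFin k) (λ e′ → solve 4 (λ p q t x → p :* (q :* (t :* x)) := t :* (p :* (q :* x))) refl (𝟙 (P? e)) (ε e′ e) two (x e′ e))) ⟩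
      ∑ᶜ (λ e → ∑ᶜ (λ e′ → two * (𝟙 (P? e) * (ε e′ e * x e′ e))))
        ≈⟨ trans (*-∑ (allFin k) _ two) (∑-cong (allFin k) (λ e → trans (*-congˡ (*-∑ (allFin k) _ _)) (*-∑ (allFin k) _ two))) ⟨
      two * ∑ᶜ (λ e → 𝟙 (P? e) * ∑ᶜ (λ e′ → ε e′ e * x e′ e)) ∎
    term : ∀ e e′ → 𝟙 (P? e) * (ε e′ e * (two * x e′ e)) ≤ 𝟙 (P? e) * (ε e′ e * (θ e′ e * (y e′ + y e)))
    term e e′ = 𝟙*-mono (P? e) (λ Pe → ≤-respˡ (sym (*-assoc _ _ _)) (≤-respʳ (sym (*-assoc _ _ _))
      (𝟙*-mono (P? e′) (λ Pe′ → 𝟙*-mono (¬? (e′ Fin.≟ e)) (λ e′≢e → xy Pe′ Pe e′≢e)))))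
    S : Carrier
    S = ∑ᶜ (λ e → ∑ᶜ (λ e′ → 𝟙 (P? e) * (ε e′ e * (θ e′ e * y e))))
    swapped : ∑ᶜ (λ e → ∑ᶜ (λ e′ → 𝟙 (P? e) * (ε e′ e * (θ e′ e * y e′)))) ≈ S
    swapped = trans (∑-comm (allFin k) (allFin k) _) (∑-cong (allFin k) (λ e′ → ∑-cong (allFin k) (λ e →
      trans (ε-swap e e′ _) (*-congˡ (*-congˡ (*-congʳ (θ-sym e′ e)))))))
    middle : ∑ᶜ (λ e → ∑ᶜ (λ e′ → 𝟙 (P? e) * (ε e′ e * (θ e′ e * (y e′ + y e))))) ≈ two * S
    middle = begin
      ∑ᶜ (λ e → ∑ᶜ (λ e′ → 𝟙 (P? e) * (ε e′ e * (θ e′ e * (y e′ + y e)))))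
        ≈⟨ ∑-cong (allFin k) (λ e → ∑-cong (allFin k) (λ e′ → solve 5 (λ p q t y z → p :* (q :* (t :* (y :+ z))) := p :* (q :* (t :* y)) :+ p :* (q :* (t :* z))) refl
             (𝟙 (P? e)) (ε e′ e) (θ e′ e) (y e′) (y e))) ⟩
      ∑ᶜ (λ e → ∑ᶜ (λ e′ → 𝟙 (P? e) * (ε e′ e * (θ e′ e * y e′)) + 𝟙 (P? e) * (ε e′ e * (θ e′ e * y e))))
        ≈⟨ trans (∑-cong (allFin k) (λ e → ∑-+ (allFin k) _ _)) (∑-+ (allFin k) _ _) ⟩
      ∑ᶜ (λ e → ∑ᶜ (λ e′ → 𝟙 (P? e) * (ε e′ e * (θ e′ e * y e′)))) + S
        ≈⟨ +-congʳ swapped ⟩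
      S + S
        ≈⟨ solve 1 (λ s → s :+ s := (κ 1 :+ κ 1) :* s) refl S ⟩
      two * S ∎
    rhs : two * S ≤ two * (∑ᶜ (λ e → 𝟙 (P? e) * y e) * R)
    rhs = *-monoˡ-≤ (1≥0 +≥ 1≥0) (≤-respʳ (sym (∑-* (allFin k) _ R)) (∑-mono (allFin k) (λ e → ≤-respˡ (row-sum e) (≤-respʳ (sym (*-assoc _ _ _))
      (𝟙*-mono (P? e) (λ Pe → *-monoˡ-≤ (y≥0 e) (row Pe)))))))
      where
      row-sum : ∀ e → 𝟙 (P? e) * (y e * ∑ᶜ (λ e′ → 𝟙 (P? e′) * (𝟙 (¬? (e′ Fin.≟ e)) * θ e′ e))) ≈
                      ∑ᶜ (λ e′ → 𝟙 (P? e) * (ε e′ e * (θ e′ e * y e)))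
      row-sum e = trans (*-congˡ (*-∑ (allFin k) _ _)) (trans (*-∑ (allFin k) _ _) (∑-cong (allFin k) (λ e′ →
        solve 5 (λ p y q d t → p :* (y :* (q :* (d :* t))) := p :* (q :* d :* (t :* y))) refl (𝟙 (P? e)) (y e) (𝟙 (P? e′)) (𝟙 (¬? (e′ Fin.≟ e))) (θ e′ e))))

  ∑-colors : ∀ (h : Fin N → Carrier) → ∑ᵥ (λ v → 𝟙 (Vertex? v) * (μ v * h v)) ≈ ∑ᶜ (λ e → 𝟙 (P? e) * mean-on e h)
  ∑-colors h = begin
    ∑ᵥ (λ v → 𝟙 (Vertex? v) * (μ v * h v))
      ≈⟨ ∑-cong (allFin N) (λ v → masks v) ⟩
    ∑ᵥ (λ v → 𝟙 (P? (color v)) * (μ v * h v))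
      ≈⟨ ∑-cong (allFin N) (λ v → ∑-unique (λ e → color v Fin.≟ e) (allFin⁺ k) (λ e → 𝟙 (P? e) * (μ v * h v)) (∈-allFin (color v)) ≡.refl ≡.sym) ⟨
    ∑ᵥ (λ v → ∑ᶜ (λ e → [ v ≐ e ] * (𝟙 (P? e) * (μ v * h v))))
      ≈⟨ ∑-comm (allFin N) (allFin k) _ ⟩
    ∑ᶜ (λ e → ∑ᵥ (λ v → [ v ≐ e ] * (𝟙 (P? e) * (μ v * h v))))
      ≈⟨ ∑-cong (allFin k) (λ e → trans (*-∑ (allFin N) _ _) (∑-cong (allFin N) (λ v →
           solve 3 (λ p a x → p :* (a :* x) := a :* (p :* x)) refl (𝟙 (P? e)) [ v ≐ e ] (μ v * h v)))) ⟨
    ∑ᶜ (λ e → 𝟙 (P? e) * mean-on e h) ∎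
    where
    masks : ∀ v → 𝟙 (Vertex? v) * (μ v * h v) ≈ 𝟙 (P? (color v)) * (μ v * h v)
    masks v with Vertex? v
    ... | yes V = *-congʳ (sym (𝟙-yes (P? (color v)) (proj₁ (vertex⁻ V))))
    ... | no ¬V = trans (zeroˡ _) (sym (𝟙*-zero (P? (color v)) (λ Pv → trans (*-congʳ (μ≈0 Pv)) (zeroˡ _))))
      where
      μ≈0 : P (color v) → μ v ≈ 0#
      μ≈0 Pv with vertex-or-0 Pv
      ... | inj₁ V = contradiction V ¬V
      ... | inj₂ eq = eq

  module _ {l φ} (eigen : Eigen adjacency l φ) (f : Fin N → Carrier) (f≈ : ∀ i → f (ι i) ≈ φ i) where

    eigen-at : ∀ {e v} → P e → color v ≡ e → ∑ᶜ (λ e′ → ε e′ e * ∑ᵥ (λ u → [ u ≐ e′ ] * (ν u v * f u))) ≈ l * D * (μ v * f v)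
    eigen-at Pe ≡.refl = eigen-equation eigen f f≈ Pe

    -- The eigenvalue equation paired with a test function on one color. The choice g = 1 gives the
    -- equation for the means, and g = f the one for the energies.
    weighted : ∀ {e} → P e → ∀ (g : Fin N → Carrier) →
      ∑ᶜ (λ e′ → ε e′ e * cross e′ e f g) ≈ l * D * ∑ᵥ (λ v → [ v ≐ e ] * (μ v * (f v * g v)))
    weighted {e} Pe g = begin
      ∑ᶜ (λ e′ → ε e′ e * cross e′ e f g)
        ≈⟨ ∑-cong (allFin k) (λ e′ → cross-by-columns (ε e′ e) e′ e f g) ⟩
      ∑ᶜ (λ e′ → ∑ᵥ (λ v → [ v ≐ e ] * (g v * (ε e′ e * ∑ᵥ (λ u → [ u ≐ e′ ] * (ν u v * f u))))))
        ≈⟨ ∑-comm (allFin k) (allFin N) _ ⟩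
      ∑ᵥ (λ v → ∑ᶜ (λ e′ → [ v ≐ e ] * (g v * (ε e′ e * ∑ᵥ (λ u → [ u ≐ e′ ] * (ν u v * f u))))))
        ≈⟨ ∑-cong (allFin N) (λ v → trans (*-congˡ (*-∑ (allFin k) _ _)) (*-∑ (allFin k) _ _)) ⟨
      ∑ᵥ (λ v → [ v ≐ e ] * (g v * ∑ᶜ (λ e′ → ε e′ e * ∑ᵥ (λ u → [ u ≐ e′ ] * (ν u v * f u)))))
        ≈⟨ ∑-cong (allFin N) (λ v → 𝟙*-cong (color v Fin.≟ e) (λ cv → *-congˡ (eigen-at Pe cv))) ⟩
      ∑ᵥ (λ v → [ v ≐ e ] * (g v * (l * D * (μ v * f v))))
        ≈⟨ ∑-cong (allFin N) (λ v → solve 5 (λ a g s m f → a :* (g :* (s :* (m :* f))) := s :* (a :* (m :* (f :* g)))) refl [ v ≐ e ] (g v) (l * D) (μ v) (f v)) ⟩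
      ∑ᵥ (λ v → l * D * ([ v ≐ e ] * (μ v * (f v * g v))))
        ≈⟨ *-∑ (allFin N) _ _ ⟨
      l * D * ∑ᵥ (λ v → [ v ≐ e ] * (μ v * (f v * g v))) ∎

    cross-1 : ∀ {e e′} → P e → cross e′ e f (λ _ → 1#) ≈ mean-on e′ f
    cross-1 {e} {e′} Pe = begin
      ∑ᵥ (λ u → ∑ᵥ (λ v → [ u ≐ e′ ] * ([ v ≐ e ] * (ν u v * (f u * 1#)))))
        ≈⟨ ∑-cong (allFin N) (λ u → trans (∑-cong (allFin N) (λ v → trans (*-congˡ (*-congˡ (*-congˡ (*-identityʳ _))))
             (solve 4 (λ a b n f → a :* (b :* (n :* f)) := (a :* f) :* (b :* n)) refl [ u ≐ e′ ] [ v ≐ e ] (ν u v) (f u))))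
             (sym (*-∑ (allFin N) _ _))) ⟩
      ∑ᵥ (λ u → [ u ≐ e′ ] * f u * ∑ᵥ (λ v → [ v ≐ e ] * ν u v))
        ≈⟨ ∑-cong (allFin N) (λ u → trans (*-congˡ (marginal Pe u)) (trans (*-assoc _ _ _) (*-congˡ (*-comm _ _)))) ⟩
      mean-on e′ f ∎

    means : ∀ {e} → P e → ∑ᶜ (λ e′ → ε e′ e * mean-on e′ f) ≈ l * D * mean-on e f
    means {e} Pe = begin
      ∑ᶜ (λ e′ → ε e′ e * mean-on e′ f)                              ≈⟨ ∑-cong (allFin k) (λ e′ → *-congˡ (cross-1 Pe)) ⟨
      ∑ᶜ (λ e′ → ε e′ e * cross e′ e f (λ _ → 1#))                   ≈⟨ weighted Pe (λ _ → 1#) ⟩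
      l * D * ∑ᵥ (λ v → [ v ≐ e ] * (μ v * (f v * 1#)))              ≈⟨ *-congˡ (∑-cong (allFin N) (λ v → *-congˡ (*-congˡ (*-identityʳ _)))) ⟩
      l * D * mean-on e f                                            ∎

    total-mean : Carrier
    total-mean = ∑ᶜ (λ e → 𝟙 (P? e) * mean-on e f)

    total-mean-eigen : D * total-mean ≈ D * (l * total-mean)
    total-mean-eigen = begin
      D * total-mean                                                           ≈⟨ degree-swap (λ e → mean-on e f) ⟨
      ∑ᶜ (λ e → 𝟙 (P? e) * ∑ᶜ (λ e′ → ε e′ e * mean-on e′ f))                  ≈⟨ ∑-cong (allFin k) (λ e → 𝟙*-cong (P? e) (λ Pe → means Pe)) ⟩
      ∑ᶜ (λ e → 𝟙 (P? e) * (l * D * mean-on e f))                              ≈⟨ scale (l * D) (λ e → mean-on e f) ⟨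
      l * D * total-mean                                                       ≈⟨ trans (*-congʳ (*-comm l D)) (*-assoc D l total-mean) ⟩
      D * (l * total-mean)                                                     ∎

    one-or-orthogonal : l ≈ 1# ⊎ total-mean ≈ 0#
    one-or-orthogonal = by-cases (total-mean ≟ 0#)
      where
      by-cases : Dec (total-mean ≈ 0#) → l ≈ 1# ⊎ total-mean ≈ 0#
      by-cases (yes M≈0) = inj₂ M≈0
      by-cases (no M≉0)  = inj₁ (*-cancel-≈ M≉0 (trans (*-comm _ _) (trans (sym (*-cancel-≈ (proj₂ D>0) total-mean-eigen)) (sym (*-identityʳ _)))))

    -- By `means` and `split-color`, (1 + l D) times the mean on a color is the total mean, and 1 +
    -- l D is positive for l ≥ 0.
    mean-zero : total-mean ≈ 0# → 0# ≤ l → ∀ {e} → P e → mean-on e f ≈ 0#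
    mean-zero M≈0 l≥0 {e} Pe = *-cancel-0 (proj₂ (pos-+ pos-1 (l≥0 *≥ proj₁ D>0))) (begin
      (1# + l * D) * mean-on e f                                   ≈⟨ distribʳ (mean-on e f) 1# (l * D) ⟩
      1# * mean-on e f + l * D * mean-on e f                       ≈⟨ +-congˡ (means Pe) ⟨
      1# * mean-on e f + ∑ᶜ (λ e′ → ε e′ e * mean-on e′ f)         ≈⟨ split-color (λ e → mean-on e f) Pe ⟩
      total-mean                                                   ≈⟨ M≈0 ⟩
      0#                                                           ∎)

    energy : Fin k → Carrier
    energy e = energy-on e f

    energy≥0 : ∀ e → 0# ≤ energy e
    energy≥0 e = ∑-nonneg (allFin N) (λ v → 𝟙≥0 (color v Fin.≟ e) *≥ (ν≥0 v v *≥ square-nonneg (f v)))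

    total-energy : Carrier
    total-energy = ∑ᶜ (λ e → 𝟙 (P? e) * energy e)

    energy-eigen : ∑ᶜ (λ e → 𝟙 (P? e) * ∑ᶜ (λ e′ → ε e′ e * cross e′ e f f)) ≈ l * D * total-energy
    energy-eigen = trans (∑-cong (allFin k) (λ e → 𝟙*-cong (P? e) (λ Pe → weighted Pe f))) (sym (scale (l * D) energy))

    energy-zero : total-energy ≈ 0# → ∀ i → φ i ≈ 0#
    energy-zero T≈0 i = trans (sym (f≈ i)) f≈0
      where
      v = ι i
      Pv = proj₁ (vertex⁻ (ι-vertex i))
      Y≈0 : energy (color v) ≈ 0#
      Y≈0 = trans (sym (𝟙*-yes (P? (color v)) Pv _))
        (∑≈0⇒≈0 (allFin k) (λ e → 𝟙≥0 (P? e) *≥ energy≥0 e) T≈0 (∈-allFin (color v)))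
      ff≈0 : f v * f v ≈ 0#
      ff≈0 = *-cancel-0 (proj₂ (proj₂ (vertex⁻ (ι-vertex i)))) (trans (sym (𝟙*-yes (color v Fin.≟ color v) ≡.refl _))
        (∑≈0⇒≈0 (allFin N) (λ w → 𝟙≥0 (color w Fin.≟ color v) *≥ (ν≥0 w w *≥ square-nonneg (f w))) Y≈0 (∈-allFin v)))
      f≈0 : f v ≈ 0#
      f≈0 = square-zero ff≈0

    energy-bound : total-mean ≈ 0# → 0# ≤ l → total-energy * (D * l) ≤ total-energy * R
    energy-bound M≈0 l≥0 = ≤-respˡ (trans energy-eigen (trans (*-comm _ _) (*-congˡ (*-comm l D))))
      (row-sums (λ e′ e → cross e′ e f f) energy energy≥0 (λ Pe Pe′ e≢e′ → pair-bound Pe Pe′ e≢e′ f (mean-zero M≈0 l≥0)))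

    eigenvalue-bound : total-mean ≈ 0# → ¬ (∀ i → φ i ≈ 0#) → D * l ≤ R
    eigenvalue-bound M≈0 φ≉0 = by-sign (total l 0#)
      where
      by-sign : l ≤ 0# ⊎ 0# ≤ l → D * l ≤ R
      -- The means vanish color by color only when l ≥ 0 is known; for the other sign R ≥ 0
      -- suffices.
      by-sign (inj₁ l≤0) = ≤-trans (≤-respʳ (zeroʳ D) (*-monoˡ-≤ (proj₁ D>0) l≤0)) R≥0
      by-sign (inj₂ l≥0) = *-cancel-≤ (∑-nonneg (allFin k) (λ e → 𝟙≥0 (P? e) *≥ energy≥0 e) , (λ T≈0 → φ≉0 (energy-zero T≈0)))
                       (energy-bound M≈0 l≥0)

  second-eigenvalue-bound : SecondLargestEigenvalue≤ G (R / D)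
  second-eigenvalue-bound = second-eigenvalue adjacency (λ i → μ (ι i))
    (λ {l} {φ} eigen → let (f , f≈) = extend-by-zero vertices-unique φ in
       map₂ (trans (functional f f≈)) (one-or-orthogonal eigen f f≈))
    (λ {l} {φ} eigen mean≈0 φ≉0 → let (f , f≈) = extend-by-zero vertices-unique φ in
       ≤-/ D>0 (eigenvalue-bound eigen f f≈ (trans (sym (functional f f≈)) mean≈0) φ≉0))
    where
    functional : ∀ {φ : Vector Carrier order} (f : Fin N → Carrier) → (∀ i → f (ι i) ≈ φ i) → sum (λ i → μ (ι i) * φ i) ≈ ∑ᶜ (λ e → 𝟙 (P? e) * mean-on e f)
    functional f f≈ = trans (sum-cong-≋ (λ i → *-congˡ (sym (f≈ i)))) (trans (sum-vertices (λ v → μ v * f v)) (∑-colors f))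

-- Powers of 1 / √q and their sums.

module RootEstimates {c ℓ₁ ℓ₂} (K : RealClosedField c ℓ₁ ℓ₂) {q} (1<q : 1 ℕ.< q) where
  open OrderedField K
  import Data.Fin.Base as Fin
  open import Data.Fin.Base using (toℕ)
  import Data.List.Properties as List
  open import Data.Nat.Base using (s≤s; z≤n; ∣_-_∣)
  open import Relation.Binary.Reasoning.Setoid setoid
  open RealClosedField K using (√-nonneg; √-square)

  Q : Carrier
  Q = fromℕ q

  root : Carrier
  root = √ Q

  root≥0 : 0# ≤ root
  root≥0 = √-nonneg (fromℕ≥0 q)

  root² : root * root ≈ Q
  root² = √-square (fromℕ≥0 q)

  Q-1>0 : Positive (Q - 1#)
  Q-1>0 = at-least-two 1<q
    where
    at-least-two : ∀ {q} → 1 ℕ.< q → Positive (fromℕ q - 1#)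
    at-least-two {suc (suc n)} _ = pos-resp
      (solve 2 (λ o s → s := o :+ s :- o) refl 1# (fromℕ (suc n))) (pos-fromℕ n)
    at-least-two {suc zero} (s≤s ())

  root-1>0 : Positive (root - 1#)
  root-1>0 = pos (total 1# root)
    where
    Q≉1 : ¬ Q - 1# ≤ 0#
    Q≉1 Q≤1 = proj₂ Q-1>0 (antisym Q≤1 (proj₁ Q-1>0))
    pos : 1# ≤ root ⊎ root ≤ 1# → Positive (root - 1#)
    pos (inj₂ r≤1) = contradiction (by-difference (x-y≥0 (*-mono-≤ root≥0 root≥0 r≤1 r≤1)) (begin
      0#                                          ≈⟨ solve 2 (λ r q → κ 0 := (q :- κ 1) :+ (κ 1 :* κ 1 :- q)) refl root Q ⟩
      (Q - 1#) + (1# * 1# - Q)                    ≈⟨ +-congˡ (+-congˡ (-‿cong root²)) ⟨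
      (Q - 1#) + (1# * 1# - root * root)          ∎)) Q≉1
    pos (inj₁ 1≤r) = x-y≥0 1≤r , λ r≈1 → Q≉1 (≤-reflexive (begin
      Q - 1#                                      ≈⟨ +-congʳ root² ⟨
      root * root - 1#                            ≈⟨ solve 1 (λ r → r :* r :- κ 1 := (r :- κ 1) :* (r :+ κ 1)) refl root ⟩
      (root - 1#) * (root + 1#)                   ≈⟨ trans (*-congʳ r≈1) (zeroˡ _) ⟩
      0#                                          ∎))

  root>0 : Positive root
  root>0 = pos-resp (solve 1 (λ r → κ 1 :+ (r :- κ 1) := r) refl root) (pos-+ pos-1 (proj₁ root-1>0))

  ρ : Carrier
  ρ = 1# / root

  ρ>0 : Positive ρ
  ρ>0 = pos-* pos-1 (pos-⁻¹ root>0)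

  root*ρ : root * ρ ≈ 1#
  root*ρ = */ (proj₂ root>0) 1#

  ρρQ : ρ * ρ * Q ≈ 1#
  ρρQ = begin
    ρ * ρ * Q                  ≈⟨ *-congˡ root² ⟨
    ρ * ρ * (root * root)      ≈⟨ solve 2 (λ p r → p :* p :* (r :* r) := (r :* p) :* (r :* p)) refl ρ root ⟩
    (root * ρ) * (root * ρ)    ≈⟨ *-cong root*ρ root*ρ ⟩
    1# * 1#                    ≈⟨ *-identityʳ 1# ⟩
    1#                         ∎

  ρ≤1 : ρ ≤ 1#
  ρ≤1 = by-difference (proj₁ ρ>0 *≥ proj₁ root-1>0) (begin
    1#                         ≈⟨ root*ρ ⟨
    root * ρ                   ≈⟨ solve 2 (λ p r → r :* p := p :+ p :* (r :- κ 1)) refl ρ root ⟩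
    ρ + ρ * (root - 1#)        ∎)

  ρ^-antitone : ∀ {i j} → i ℕ.≤ j → ρ ^ j ≤ ρ ^ i
  ρ^-antitone {zero} {zero}  _ = ≤-refl
  ρ^-antitone {zero} {suc j} _ = ≤-trans (*-mono-≤ (proj₁ ρ>0) (proj₁ (pos-^ j ρ>0)) ρ≤1 (ρ^-antitone {zero} {j} z≤n))
                                         (≤-reflexive (*-identityʳ 1#))
  ρ^-antitone {suc i} {suc j} (s≤s i≤j) = *-monoˡ-≤ (proj₁ ρ>0) (ρ^-antitone i≤j)

  -- The sum ρ + ρ² + ρ³ + … of the geometric series.
  series : Carrier
  series = 1# / (root - 1#)

  series>0 : Positive series
  series>0 = pos-* pos-1 (pos-⁻¹ root-1>0)

  series-step : ρ + ρ * series ≈ series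
  series-step = *-cancel-≈ (proj₂ (pos-* root>0 root-1>0)) (begin
    root * (root - 1#) * (ρ + ρ * series)
      ≈⟨ solve 3 (λ r p g → r :* (r :- κ 1) :* (p :+ p :* g) := (r :* p) :* ((r :- κ 1) :+ (r :- κ 1) :* g)) refl root ρ series ⟩
    (root * ρ) * ((root - 1#) + (root - 1#) * series)
      ≈⟨ *-cong root*ρ (+-congˡ (*/ (proj₂ root-1>0) 1#)) ⟩
    1# * ((root - 1#) + 1#)
      ≈⟨ solve 1 (λ r → κ 1 :* ((r :- κ 1) :+ κ 1) := r :* κ 1) refl root ⟩
    root * 1#
      ≈⟨ *-congˡ (*/ (proj₂ root-1>0) 1#) ⟨
    root * ((root - 1#) * series)
      ≈⟨ *-assoc _ _ _ ⟨
    root * (root - 1#) * series ∎)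

  2series : fromℕ 2 / (root - 1#) ≈ series + series
  2series = trans (*-congʳ (+-congˡ (+-identityʳ 1#)))
    (solve 1 (λ i → (κ 1 :+ κ 1) :* i := κ 1 :* i :+ κ 1 :* i) refl ((root - 1#) ⁻¹))

  ∑-allFin-suc : ∀ {k} (f : Fin (suc k) → Carrier) → ∑ (allFin (suc k)) f ≈ f zero + ∑ (allFin k) (λ i → f (suc i))
  ∑-allFin-suc {k} f = +-congˡ (trans (≈-reflexive (≡.cong (λ L → ∑ L f) (≡.sym (List.map-tabulate {n = k} (λ i → i) suc))))
                                      (∑-map suc (allFin k) f))

  geometric-sum : ∀ k → ∑ (allFin k) (λ j → ρ ^ suc (toℕ j)) ≤ series
  geometric-sum zero    = proj₁ series>0
  geometric-sum (suc k) = ≤-respˡ (sym (trans (∑-allFin-suc {k} (λ j → ρ ^ suc (toℕ j)))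
      (+-cong (*-identityʳ ρ) (sym (*-∑ (allFin k) (λ j → ρ ^ suc (toℕ j)) ρ)))))
    (≤-respʳ series-step (+-mono-≤ ≤-refl (*-monoˡ-≤ (proj₁ ρ>0) (geometric-sum k))))

  -- The extra term is the tail of the geometric series cut off at color 0. With it the induction
  -- closes: in passing from e to e + 1 the new term ρ^(e+1) and the new tail add up to the old
  -- tail.
  row-sum : ∀ {k} (e : Fin k) →
    ∑ (allFin k) (λ j → 𝟙 (¬? (j Fin.≟ e)) * ρ ^ ∣ toℕ j - toℕ e ∣) + series * ρ ^ toℕ e ≤ series + series
  row-sum {suc k} zero = +-mono-≤ (≤-respˡ (sym (trans (∑-allFin-suc {k} (λ j → 𝟙 (¬? (j Fin.≟ zero)) * ρ ^ ∣ toℕ j - 0 ∣))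
      (trans (+-cong (zeroˡ _) (∑-cong (allFin k) (λ j → *-identityˡ _))) (+-identityˡ _)))) (geometric-sum k))
    (≤-reflexive (*-identityʳ series))
  row-sum {suc k} (suc e) = ≤-respˡ (sym (begin
    ∑ (allFin (suc k)) row + series * ρ ^ suc (toℕ e)
      ≈⟨ +-congʳ (trans (∑-allFin-suc {k} row) (+-congʳ (*-identityˡ _))) ⟩
    ρ ^ suc (toℕ e) + S + series * ρ ^ suc (toℕ e)
      ≈⟨ solve 4 (λ p x s g → p :* x :+ s :+ g :* (p :* x) := s :+ (p :+ p :* g) :* x) refl ρ (ρ ^ toℕ e) S series ⟩
    S + (ρ + ρ * series) * ρ ^ toℕ e
      ≈⟨ +-congˡ (*-congʳ series-step) ⟩
    S + series * ρ ^ toℕ e ∎)) (row-sum e)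
    where
    row : Fin (suc k) → Carrier
    row j = 𝟙 (¬? (j Fin.≟ suc e)) * ρ ^ ∣ toℕ j - suc (toℕ e) ∣
    S : Carrier
    S = ∑ (allFin k) (λ j → 𝟙 (¬? (j Fin.≟ e)) * ρ ^ ∣ toℕ j - toℕ e ∣)

-- Edge probabilities as counts of top faces.

module ComplexWeights {c ℓ₁ ℓ₂} (K : RealClosedField c ℓ₁ ℓ₂) {N} (X : Complex N) where
  open OrderedField K
  open Spectral K
  open Complex X
  open SubsetLemmas
  open import Data.Fin.Subset using (Subset; _∈_; _⊆_; _∪_; ⁅_⁆; ∣_∣)
  open import Data.Fin.Subset.Properties using (anySubset?; _∈?_; _⊆?_; x∈p∪q⁻; x∈⁅x⁆; x∈⁅y⁆⇒x≡y; p⊆p∪q; q⊆p∪q)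
  open import Data.List.Base using (length)
  open import Data.Nat.Combinatorics using (_C_; nC1≡n; nCk+nC[k+1]≡[n+1]C[k+1])
  open import Data.Bool.Base using (if_then_else_)
  open import Relation.Binary.Reasoning.Setoid setoid
  open WeightedGraph (underlyingGraph X) using (weight; Vertex)

  ν : Fin N → Fin N → Carrier
  ν u v = ∑ (subsets N) (λ T → 𝟙 (Top? T) * (𝟙 (u ∈? T) * 𝟙 (v ∈? T)))

  pair : Fin N → Fin N → Subset N
  pair u v = ⁅ u ⁆ ∪ ⁅ v ⁆

  pair-⊆ : ∀ {u v T} → u ∈ T → v ∈ T → pair u v ⊆ T
  pair-⊆ {u} {v} {T} u∈ v∈ x∈ with x∈p∪q⁻ ⁅ u ⁆ ⁅ v ⁆ x∈
  ... | inj₁ x∈u = ≡.subst (_∈ T) (≡.sym (x∈⁅y⁆⇒x≡y u x∈u)) u∈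
  ... | inj₂ x∈v = ≡.subst (_∈ T) (≡.sym (x∈⁅y⁆⇒x≡y v x∈v)) v∈

  ∈-pairˡ : ∀ u v → u ∈ pair u v
  ∈-pairˡ u v = p⊆p∪q ⁅ v ⁆ (x∈⁅x⁆ u)

  ∈-pairʳ : ∀ u v → v ∈ pair u v
  ∈-pairʳ u v = q⊆p∪q ⁅ u ⁆ ⁅ v ⁆ (x∈⁅x⁆ v)

  ∣pair∣ : ∀ {u v} → u ≢ v → ∣ pair u v ∣ ≡ 2
  ∣pair∣ {u} {v} u≢v = cardinality
    where
    open ℕSums using () renaming (𝟙 to 𝟙ℕ)
    split : ∀ i → 𝟙ℕ (i ∈? pair u v) ≡ 𝟙ℕ (i Fin.≟ u) ℕ.+ 𝟙ℕ (i Fin.≟ v)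
    split i = cases (i Fin.≟ u) (i Fin.≟ v)
      where
      cases : (d : Dec (i ≡ u)) (e : Dec (i ≡ v)) → 𝟙ℕ (i ∈? pair u v) ≡ 𝟙ℕ d ℕ.+ 𝟙ℕ e
      cases (yes ≡.refl) (yes ≡.refl) = contradiction ≡.refl u≢v
      cases (yes ≡.refl) (no _)       = ℕSums.𝟙-yes (i ∈? pair u v) (∈-pairˡ i v)
      cases (no _)       (yes ≡.refl) = ℕSums.𝟙-yes (i ∈? pair u v) (∈-pairʳ u i)
      cases (no i≢u)     (no i≢v)     = ℕSums.𝟙-no (i ∈? pair u v) λ i∈ → neither (x∈p∪q⁻ ⁅ u ⁆ ⁅ v ⁆ i∈)
        where
        neither : ¬ (i ∈ ⁅ u ⁆ ⊎ i ∈ ⁅ v ⁆)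
        neither (inj₁ p) = i≢u (x∈⁅y⁆⇒x≡y u p)
        neither (inj₂ p) = i≢v (x∈⁅y⁆⇒x≡y v p)
    cardinality : ∣ pair u v ∣ ≡ 2
    cardinality = ≡.trans (∣∣-∑ (pair u v)) (≡.trans (ℕSums.∑-cong (allFin N) split)
      (≡.trans (ℕSums.∑-+ (allFin N) (λ i → 𝟙ℕ (i Fin.≟ u)) (λ i → 𝟙ℕ (i Fin.≟ v)))
        (≡.cong₂ ℕ._+_ (ℕSums.∑-unique-1 (Fin._≟ u) (allFin⁺ N) (∈-allFin u) ≡.refl (λ p → p))
                       (ℕSums.∑-unique-1 (Fin._≟ v) (allFin⁺ N) (∈-allFin v) ≡.refl (λ p → p)))))

  weight-loop : ∀ v → weight v v ≈ 0#
  weight-loop v = trans (𝟙*-if (Edge? v v) _) (𝟙*-no (Edge? v v) (λ (v≢v , _) → v≢v ≡.refl) _)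

  ν>0 : ∀ {T u v} → Top T → u ∈ T → v ∈ T → Positive (ν u v)
  ν>0 {T} {u} {v} top u∈ v∈ = ∑-positive (subsets N)
    (λ T → 𝟙≥0 (Top? T) *≥ (𝟙≥0 (u ∈? T) *≥ 𝟙≥0 (v ∈? T))) (∈-subsets T)
    (pos-resp (sym (trans (𝟙*-yes (Top? T) top _) (trans (𝟙*-yes (u ∈? T) u∈ _) (𝟙-yes (v ∈? T) v∈)))) pos-1)

  ν-support : ∀ {u v} → ¬ ν u v ≈ 0# → ∃ λ T → Top T × u ∈ T × v ∈ T
  ν-support {u} {v} ν≉0 = found (anySubset? (λ T → Top? T ×-dec (u ∈? T ×-dec v ∈? T)))
    where
    found : Dec (∃ λ T → Top T × u ∈ T × v ∈ T) → _
    found (yes w)   = w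
    found (no none) = contradiction (∑-zero (subsets N) (λ T → 𝟙*-zero (Top? T) (λ top →
      𝟙*-zero (u ∈? T) (λ u∈ → 𝟙-no (v ∈? T) (λ v∈ → none (T , top , u∈ , v∈)))))) ν≉0

  vertex⇒ν>0 : ∀ {v} → Vertex v → Positive (ν v v)
  vertex⇒ν>0 {v} (T , top , v⊆T) = ν>0 {T} {v} {v} top (v⊆T (x∈⁅x⁆ v)) (v⊆T (x∈⁅x⁆ v))

  ν>0⇒vertex : ∀ {v} → Positive (ν v v) → Vertex v
  ν>0⇒vertex {v} (_ , ν≉0) with ν-support {v} {v} ν≉0
  ... | T , top , v∈ , _ = T , top , λ x∈ → ≡.subst (_∈ T) (≡.sym (x∈⁅y⁆⇒x≡y v x∈)) v∈

  module Pure {m} (2≤m : 2 ℕ.≤ m) (pure : ∀ {T} → Top T → ∣ T ∣ ≡ m) {T₀} (top₀ : Top T₀) where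

    -- A top face through an edge selects it with probability 1 / (m choose 2) and is itself one of
    -- `length tops` equally likely faces. Purity makes the first factor constant.
    scale : Carrier
    scale = fromℕ (m C 2) ⁻¹ / fromℕ (length tops)

    mC2>0 : ∀ {m} → 2 ℕ.≤ m → Positive (fromℕ (m C 2))
    -- Pascal's rule writes (m+2 choose 2) as (m + 1) + (m+1 choose 2), a successor.
    mC2>0 {suc (suc m)} _ = ≡.subst (λ n → Positive (fromℕ n))
      (≡.trans (≡.cong (ℕ._+ suc m C 2) (≡.sym (nC1≡n (suc m)))) (nCk+nC[k+1]≡[n+1]C[k+1] (suc m) 1))
      (pos-fromℕ (m ℕ.+ suc m C 2))
    mC2>0 {suc zero} (ℕ.s≤s ())

    scale>0 : Positive scale
    scale>0 = pos-* (pos-⁻¹ (mC2>0 2≤m)) (pos-⁻¹ (length>0 (∈-filter⁺ Top? (∈-subsets T₀) top₀)))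
      where
      length>0 : ∀ {L : List.List (Subset N)} → T₀ List.∈ L → Positive (fromℕ (length L))
      length>0 {_ List.∷ L} _ = pos-fromℕ (length L)

    weight-edge : ∀ {u v} → u ≢ v → weight u v ≈ scale * ν u v
    weight-edge {u} {v} u≢v = trans (𝟙*-if (Edge? u v) _) (by-cases (Edge? u v))
      where
      t = pair u v
      prob≈ : prob X t ≈ scale * ν u v
      prob≈ = begin
        ∑ tops _ / fromℕ (length tops)
          ≈⟨ *-congʳ (∑-filter Top? (subsets N) _) ⟩
        ∑ (subsets N) (λ T → 𝟙 (Top? T) * (if does (t ⊆? T) then fromℕ (∣ T ∣ C ∣ t ∣) ⁻¹ else 0#)) / fromℕ (length tops)
          ≈⟨ *-congʳ (∑-cong (subsets N) (λ T → 𝟙*-cong (Top? T) (λ top → begin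
               (if does (t ⊆? T) then fromℕ (∣ T ∣ C ∣ t ∣) ⁻¹ else 0#)   ≈⟨ 𝟙*-if (t ⊆? T) _ ⟩
               𝟙 (t ⊆? T) * fromℕ (∣ T ∣ C ∣ t ∣) ⁻¹
                 ≈⟨ *-cong (trans (𝟙-cong (t ⊆? T) (u ∈? T ×-dec v ∈? T) (λ sub → sub (∈-pairˡ u v) , sub (∈-pairʳ u v)) (λ (u∈ , v∈) → pair-⊆ u∈ v∈))
                                  (𝟙-× (u ∈? T) (v ∈? T)))
                           (≈-reflexive (≡.cong₂ (λ a b → fromℕ (a C b) ⁻¹) (pure top) (∣pair∣ u≢v))) ⟩
               𝟙 (u ∈? T) * 𝟙 (v ∈? T) * fromℕ (m C 2) ⁻¹                  ∎))) ⟩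
        ∑ (subsets N) (λ T → 𝟙 (Top? T) * (𝟙 (u ∈? T) * 𝟙 (v ∈? T) * fromℕ (m C 2) ⁻¹)) / fromℕ (length tops)
          ≈⟨ *-congʳ (trans (∑-cong (subsets N) (λ T → sym (*-assoc _ _ _))) (sym (∑-* (subsets N) _ _))) ⟩
        ν u v * fromℕ (m C 2) ⁻¹ / fromℕ (length tops)
          ≈⟨ solve 3 (λ n i l → n :* i :* l := i :* l :* n) refl (ν u v) (fromℕ (m C 2) ⁻¹) (fromℕ (length tops) ⁻¹) ⟩
        scale * ν u v ∎
      by-cases : (d : Dec (Edge u v)) → 𝟙 d * prob X t ≈ scale * ν u v
      by-cases (yes _)   = trans (*-identityˡ _) prob≈
      by-cases (no ¬edge) = trans (zeroˡ _) (sym (trans (*-congˡ ν≈0) (zeroʳ _)))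
        where
        ν≈0 : ν u v ≈ 0#
        ν≈0 = ∑-zero (subsets N) (λ T → 𝟙*-zero (Top? T) (λ top → 𝟙*-zero (u ∈? T) (λ u∈ → 𝟙-no (v ∈? T) (λ v∈ →
          ¬edge (u≢v , T , top , pair-⊆ u∈ v∈)))))

-- Gaps of strictly increasing sequences.

module StrictlyMonotone where
  open import Data.Fin.Base using (toℕ; _<_)
  open import Data.Nat.Base using (_+_; _∸_; _≤_; s≤s; z≤n; ∣_-_∣)

  from-zero : ∀ {k} (s : Fin (suc k) → ℕ) → (∀ {i j} → i < j → s i ℕ.< s j) → ∀ j → s zero + toℕ j ≤ s j
  from-zero s mono zero = ℕ.≤-reflexive (ℕ.+-identityʳ _)
  from-zero {suc k} s mono (suc j) = ℕ.≤-trans (ℕ.≤-reflexive (ℕ.+-suc _ _))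
    (ℕ.≤-trans (ℕ.+-monoˡ-≤ (toℕ j) (mono {zero} {suc zero} (s≤s z≤n))) (from-zero (λ i → s (suc i)) (λ i<j → mono (s≤s i<j)) j))

  -- A strictly increasing sequence of integers grows by at least 1 per step. This lets index gaps
  -- replace rank gaps, so that one geometric series serves for every set of ranks.
  distance : ∀ {k} (s : Fin k → ℕ) → (∀ {i j} → i < j → s i ℕ.< s j) → ∀ {i j} → i < j → ∣ toℕ i - toℕ j ∣ ≤ s j ∸ s i
  distance {suc k} s mono {zero} {j} _ = ℕ.m+n≤o⇒m≤o∸n (toℕ j) (ℕ.≤-trans (ℕ.≤-reflexive (ℕ.+-comm (toℕ j) _)) (from-zero s mono j))
  distance {suc k} s mono {suc i} {suc j} (s≤s i<j) = distance (λ i → s (suc i)) (λ i<j → mono (s≤s i<j)) i<j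

-- The projected flags complex satisfies the interface.

module ProjectedFlagComplex {q} (F : FiniteField q) (d : ℕ) {k} (s : Fin k → ℕ)
  (s-mono : ∀ {i j} → i Fin.< j → s i ℕ.< s j) (s<d : ∀ i → s i ℕ.< d) where
  open ProjectedFlags F d s
  open SubspaceGeometry F d using (geometry; module L)
  open SubsetLemmas
  open import Data.Fin.Subset using (Subset; _∈_; _⊆_; _⊂_)
  open import Data.List.Membership.Propositional.Properties using (∈-cartesianProduct⁺)
  import Data.List.Relation.Unary.Any as Any
  open import Data.List.Relation.Unary.Any.Properties using (lookup-index)
  import Data.List.Relation.Unary.All as All
  open import Data.List.Relation.Unary.Unique.Propositional.Properties using (cartesianProduct⁺)
  open import Relation.Binary.PropositionalEquality.Core using (cong; cong₂)

  lookup-injective : ∀ {a} {A : Set a} {L : List A} → Unique L → ∀ {i j} → List.lookup L i ≡ List.lookup L j → i ≡ j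
  lookup-injective (_ ∷ _)     {zero}  {zero}  _  = ≡.refl
  lookup-injective {L = _ ∷ L} (x∉ ∷ _) {zero}  {suc j} eq = contradiction eq (All.lookup x∉ (∈-lookup {xs = L} j))
  lookup-injective {L = _ ∷ L} (x∉ ∷ _) {suc i} {zero}  eq = contradiction (≡.sym eq) (All.lookup x∉ (∈-lookup {xs = L} i))
  lookup-injective (_ ∷ uL)    {suc i} {suc j} eq = cong suc (lookup-injective uL eq)

  candidates : List (Fin k × L.VectSet)
  candidates = List.cartesianProduct (allFin k) (subsets (q ℕ.^ d))

  vertexList-unique : Unique vertexList
  vertexList-unique = filter⁺ IsVertex? (cartesianProduct⁺ (allFin⁺ k) (subsets-unique (q ℕ.^ d)))

  space-Level : ∀ v → L.Level (s (color v)) (space v)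
  space-Level v = proj₂ (∈-filter⁻ IsVertex? {xs = candidates} (∈-lookup {xs = vertexList} v))

  vertex-≡ : ∀ {u v} → color u ≡ color v → space u ≡ space v → u ≡ v
  vertex-≡ cu su = lookup-injective vertexList-unique (cong₂ _,_ cu su)

  vertex : ∀ c {W} → L.Level (s c) W → ∃ λ v → color v ≡ c × space v ≡ W
  vertex c {W} l = Any.index W∈ , cong proj₁ (≡.sym (lookup-index W∈)) , cong proj₂ (≡.sym (lookup-index W∈))
    where
    W∈ : (c , W) List.∈ vertexList
    W∈ = ∈-filter⁺ IsVertex? (∈-cartesianProduct⁺ (∈-allFin c) (∈-subsets W)) l

  ⊆⇒⊂ : ∀ {a b A B} → L.Level a A → L.Level b B → a ℕ.< b → A ⊆ B → A ⊂ B
  ⊆⇒⊂ {a} {b} {A} {B} lA lB a<b A⊆B = proper (L.∉-or-⊆ A B)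
    where
    proper : Dec (∃ λ v → v L.∈ᵛ B × ¬ v L.∈ᵛ A) → A ⊂ B
    proper (yes (v , v∈B , v∉A)) = A⊆B , _ , v∈B , v∉A
    proper (no ∄) = contradiction (L.Level-mono {A = B} {B = A} lB lA (L.∄⇒⊆ ∄)) (ℕ.<⇒≱ a<b)

  flagComplex : FlagComplex geometry size k s
  flagComplex = record
    { rank-mono   = s-mono
    ; rank<d      = s<d
    ; color       = color
    ; space       = space
    ; space-Level = space-Level
    ; vertex-≡    = vertex-≡
    ; vertex      = vertex
    ; Flag        = IsFlag
    ; Flag?       = IsFlag?
    ; flag⁺       = λ {T} full distinct nested →
        (λ c → proj₁ (full c) , proj₂ (full c) , λ (w∈ , cw) →
          distinct (proj₁ (proj₂ (full c))) w∈ (≡.trans (proj₂ (proj₂ (full c))) (≡.sym cw))) ,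
        (λ u v u∈ v∈ lt → ⊆⇒⊂ (space-Level u) (space-Level v) (s-mono lt) (nested u∈ v∈ lt))
    ; flag⁻       = λ {T} (full , nested) →
        (λ c → proj₁ (full c) , proj₁ (proj₂ (full c))) ,
        (λ {u} {v} u∈ v∈ cu≡cv → ≡.trans (≡.sym (proj₂ (proj₂ (full (color v))) (u∈ , cu≡cv))) (proj₂ (proj₂ (full (color v))) (v∈ , ≡.refl))) ,
        (λ {u} {v} u∈ v∈ lt → proj₁ (nested u v u∈ v∈ lt))
    }

-- Spectral bounds for the links of faces.

module LinkSpectrum {c ℓ₁ ℓ₂} (K : RealClosedField c ℓ₁ ℓ₂) {q} (1<q : 1 ℕ.< q) {d} {G : Geometry q d} {N k rank}
                    (X : FlagComplex G N k rank) where
  open OrderedField K renaming (_≤_ to _≤ᴷ_)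
  open Spectral K
  open FlagComplex X
  open FlagCounts K X using (Chain; HasColor; hasColor?; Flag⇒Chain; ⊆-Chain)
  open LinkWeights K X using (module Link)
  open RootEstimates K 1<q
  open SubsetLemmas
  open import Data.Fin.Base using (toℕ) renaming (_<_ to _<ᶠ_)
  open import Data.Fin.Subset using (Subset; _∈_; _⊆_; _∪_; _∩_; ∣_∣; Empty)
  open import Data.Fin.Subset.Properties using (_∈?_; x∈p∪q⁻; x∈p∩q⁺; x∈p∩q⁻; p⊆p∪q; q⊆p∪q; x∈⁅x⁆; ⊆-antisym)
  import Data.List.Properties as List
  open import Data.Nat.Base using (_≤_; _∸_; s≤s)
  open import Relation.Binary.PropositionalEquality.Core using (cong)
  open import Relation.Binary.Reasoning.Setoid setoid
  open WeightedPartiteDefinition K color using (IsWeightedPartite)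

  gap : Fin k → Fin k → ℕ
  gap e e′ = ℕ.∣ toℕ e - toℕ e′ ∣

  complex : Complex N
  complex = record { Top = Flag ; Top? = Flag? }

  module FaceLink (t : Subset N) (face : Complex.Face complex t) where

    chain-t : Chain t
    chain-t = ⊆-Chain (proj₂ (proj₂ face)) (Flag⇒Chain (proj₁ (proj₂ face)))

    open Link t chain-t

    L : Complex N
    L = link complex t

    missing? : ∀ e → Dec (Missing e)
    missing? e = ¬? (hasColor? t e)

    top-missing : ∀ {T v} → Complex.Top L T → v ∈ T → Missing (color v)
    top-missing {T} {v} (empty , flag) v∈T (w , w∈t , cw) =
      empty (v , x∈p∩q⁺ (v∈T , ≡.subst (_∈ t) (proj₁ (Flag⇒Chain flag) (q⊆p∪q T t w∈t) (p⊆p∪q t v∈T) cw) w∈t))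

    -- The flag that witnesses the face t, with t removed. The link needs a top face because edge
    -- probabilities divide by the number of them.
    top₀ : ∃ (Complex.Top L)
    top₀ = T , empty , ≡.subst Flag (≡.sym T∪t) (proj₁ (proj₂ face))
      where
      T₀ : Subset N
      T₀ = proj₁ face
      T? : ∀ i → Dec (i ∈ T₀ × ¬ i ∈ t)
      T? i = (i ∈? T₀) ×-dec ¬? (i ∈? t)
      T : Subset N
      T = fromDec T?
      empty : Empty (T ∩ t)
      empty (i , i∈) = proj₂ (∈-fromDec⁻ T? (proj₁ (x∈p∩q⁻ T t i∈))) (proj₂ (x∈p∩q⁻ T t i∈))
      to : T ∪ t ⊆ T₀
      to {i} i∈ = by-cases (x∈p∪q⁻ T t i∈)
        where
        by-cases : i ∈ T ⊎ i ∈ t → i ∈ T₀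
        by-cases (inj₁ i∈T) = proj₁ (∈-fromDec⁻ T? i∈T)
        by-cases (inj₂ i∈t) = proj₂ (proj₂ face) i∈t
      from : T₀ ⊆ T ∪ t
      from {i} i∈ = by-cases (i ∈? t)
        where
        by-cases : Dec (i ∈ t) → i ∈ T ∪ t
        by-cases (yes i∈t) = q⊆p∪q T t i∈t
        by-cases (no i∉t)  = p⊆p∪q t (∈-fromDec⁺ T? (i∈ , i∉t))
      T∪t : T ∪ t ≡ T₀
      T∪t = ⊆-antisym to from

    module Counting where
      open ℕSums using () renaming (∑ to ∑ℕ; 𝟙 to 𝟙ℕ)

      missing-colors : ℕ
      missing-colors = ∑ℕ (allFin k) (λ e → 𝟙ℕ (missing? e))

      ∣∣-colors : ∀ T → ∣ T ∣ ≡ ∑ℕ (allFin k) (λ e → ∑ℕ (allFin N) (λ v → 𝟙ℕ ((color v Fin.≟ e) ×-dec (v ∈? T))))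
      ∣∣-colors T = ≡.trans (∣∣-∑ T) (≡.trans (ℕSums.∑-cong (allFin N) (λ v → ≡.sym (≡.trans
        (ℕSums.∑-cong (allFin k) (λ e → ℕSums.𝟙-× (color v Fin.≟ e) (v ∈? T)))
        (ℕSums.∑-unique (λ e → color v Fin.≟ e) (allFin⁺ k) (λ _ → 𝟙ℕ (v ∈? T)) (∈-allFin (color v)) ≡.refl ≡.sym))))
        (ℕSums.∑-comm (allFin N) (allFin k) (λ v e → 𝟙ℕ ((color v Fin.≟ e) ×-dec (v ∈? T)))))

      one-of-color : ∀ {T e v} → Distinct T → v ∈ T → color v ≡ e → ∑ℕ (allFin N) (λ v → 𝟙ℕ ((color v Fin.≟ e) ×-dec (v ∈? T))) ≡ 1
      one-of-color {T} {e} {v} dis v∈ cv = ℕSums.∑-unique-1 (λ v → (color v Fin.≟ e) ×-dec (v ∈? T)) (allFin⁺ N) (∈-allFin v) (cv , v∈)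
        (λ (cu , u∈) → dis u∈ v∈ (≡.trans cu (≡.sym cv)))

      none-of-color : ∀ {T e} → (∀ {v} → v ∈ T → color v ≢ e) → ∑ℕ (allFin N) (λ v → 𝟙ℕ ((color v Fin.≟ e) ×-dec (v ∈? T))) ≡ 0
      none-of-color {T} {e} none = ℕSums.∑-zero (allFin N) (λ v → ℕSums.𝟙-no ((color v Fin.≟ e) ×-dec (v ∈? T)) (λ (cv , v∈) → none v∈ cv))

      ∣top∣ : ∀ {T} → Complex.Top L T → ∣ T ∣ ≡ missing-colors
      ∣top∣ {T} top = ≡.trans (∣∣-colors T) (ℕSums.∑-cong (allFin k) (λ e → at e (hasColor? t e)))
        where
        at : ∀ e (h : Dec (HasColor t e)) → ∑ℕ (allFin N) (λ v → 𝟙ℕ ((color v Fin.≟ e) ×-dec (v ∈? T))) ≡ 𝟙ℕ (¬? h)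
        at e (no missing) = one-of-color (top-distinct top) (proj₁ (proj₂ (top-vertex top missing))) (proj₂ (proj₂ (top-vertex top missing)))
        at e (yes has)    = none-of-color (λ v∈ cv → top-missing top v∈ (≡.subst (HasColor t) (≡.sym cv) has))

      -- Color by color: t has exactly one vertex of the color, or the color is missing.
      ∣t∣+missing : ∣ t ∣ ℕ.+ missing-colors ≡ k
      ∣t∣+missing = ≡.trans (≡.cong (ℕ._+ missing-colors) (∣∣-colors t))
        (≡.trans (≡.sym (ℕSums.∑-+ (allFin k) (λ e → ∑ℕ (allFin N) (λ v → 𝟙ℕ ((color v Fin.≟ e) ×-dec (v ∈? t)))) (λ e → 𝟙ℕ (missing? e))))
        (≡.trans (ℕSums.∑-cong (allFin k) (λ e → at e (hasColor? t e)))
        (≡.trans (∑-length (allFin k)) (List.length-tabulate (λ i → i)))))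
        where
        at : ∀ e (h : Dec (HasColor t e)) → ∑ℕ (allFin N) (λ v → 𝟙ℕ ((color v Fin.≟ e) ×-dec (v ∈? t))) ℕ.+ 𝟙ℕ (¬? h) ≡ 1
        at e (no missing)          = ≡.cong (ℕ._+ 1) (none-of-color (λ v∈ cv → missing (_ , v∈ , cv)))
        at e (yes (v , v∈ , cv))   = ≡.cong (ℕ._+ 0) (one-of-color (proj₁ chain-t) v∈ cv)

      missing≡ : missing-colors ≡ k ∸ ∣ t ∣
      missing≡ = ≡.sym (≡.trans (≡.cong (_∸ ∣ t ∣) (≡.sym ∣t∣+missing)) (ℕ.m+n∸m≡n ∣ t ∣ missing-colors))

    open Counting

    graph : WeightedGraph N
    graph = underlyingGraph L

    module _ (codim≥2 : 2 ≤ k ∸ ∣ t ∣) where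

      open ComplexWeights K L using (weight-loop; vertex⇒ν>0; ν>0⇒vertex; module Pure)
      open Pure {missing-colors} (≡.subst (2 ≤_) (≡.sym missing≡) codim≥2) ∣top∣ (proj₂ top₀)

      cross-sym : ∀ e e′ (f : Fin N → Carrier) → cross e e′ f f ≈ cross e′ e f f
      cross-sym e e′ f = trans (∑-comm (allFin N) (allFin N) _) (∑-cong (allFin N) (λ v → ∑-cong (allFin N) (λ u →
        trans (*-congˡ (*-congˡ (*-cong (ν-sym u v) (*-comm (f u) (f v)))))
          (solve 3 (λ a b x → a :* (b :* x) := b :* (a :* x)) refl (𝟙 (color u Fin.≟ e)) (𝟙 (color v Fin.≟ e′)) (ν v u * (f v * f u))))))

      -- Common to both bounds. The whole link takes all missing colors with θ a power of ρ, and a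
      -- bipartite graph takes two colors with θ = ρ; in each case θ has only to dominate ρ to the
      -- power of the rank gap.
      weightedPartite : ∀ {P : Fin k → Set} {Vertex : Fin N → Set} (P? : ∀ e → Dec (P e)) (Vertex? : ∀ v → Dec (Vertex v)) (θ : Fin k → Fin k → Carrier) {D R} →
        (∀ {v} → Vertex v → WeightedGraph.Vertex graph v × P (color v)) →
        (∀ {v} → WeightedGraph.Vertex graph v × P (color v) → Vertex v) →
        (∀ {e} → P e → Missing e) → Positive D → 0# ≤ᴷ R →
        (∀ e e′ → θ e e′ ≈ θ e′ e) → (∀ e e′ → 0# ≤ᴷ θ e e′) →
        (∀ {e e′} → e <ᶠ e′ → ρ ^ (rank e′ ∸ rank e) ≤ᴷ θ e e′) →
        (∀ {e} → P e → ∑ (allFin k) (λ e′ → 𝟙 (P? e′) * (𝟙 (¬? (e′ Fin.≟ e)) * θ e′ e)) ≤ᴷ R) →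
        (∀ {e} → P e → ∑ (allFin k) (λ e′ → 𝟙 (P? e′) * 𝟙 (¬? (e′ Fin.≟ e))) ≈ D) →
        IsWeightedPartite ν (record { Vertex = Vertex ; Vertex? = Vertex? ; weight = WeightedGraph.weight graph }) P? θ scale D R
      weightedPartite {P} {Vertex} P? Vertex? θ {D} {R} vertex→ vertex← P⇒missing D>0 R≥0 θ-sym θ≥0 ρ≤θ row degree = record
        { c₀>0         = scale>0
        ; D>0          = D>0
        ; ν-sym        = ν-sym
        ; ν≥0          = ν≥0
        ; marginal     = λ Pe → marginal (P⇒missing Pe)
        ; ν-same-color = ν-same-color
        ; weight-≡     = weight-loop
        ; weight-≢     = weight-edge
        ; vertex⁻      = λ V → proj₂ (vertex→ V) , vertex⇒ν>0 (proj₁ (vertex→ V))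
        ; vertex⁺      = λ Pv μ>0 → vertex← (ν>0⇒vertex μ>0 , Pv)
        ; R≥0          = R≥0
        ; θ-sym        = θ-sym
        ; θ≥0          = θ≥0
        ; row          = row
        ; degree       = degree
        ; pair-bound   = bound
        }
        where
        increasing : ∀ {e e′} → e <ᶠ e′ → P e → P e′ → ∀ f → mean-on e f ≈ 0# →
                     (1# + 1#) * cross e e′ f f ≤ᴷ θ e e′ * (energy-on e f + energy-on e′ f)
        increasing {e} {e′} e<e′ Pe Pe′ f mean≈0 = ≤-trans
          (pair-bound ρ>0 ρρQ e<e′ (P⇒missing Pe) (P⇒missing Pe′) f f mean≈0)
          (*-mono-≤ (proj₁ (pos-^ (rank e′ ∸ rank e) ρ>0)) (energy-on≥0 e f +≥ energy-on≥0 e′ f) (ρ≤θ e<e′) ≤-refl)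
        bound : ∀ {e e′} → P e → P e′ → e ≢ e′ → ∀ f → (∀ {e} → P e → mean-on e f ≈ 0#) →
                (1# + 1#) * cross e e′ f f ≤ᴷ θ e e′ * (energy-on e f + energy-on e′ f)
        bound {e} {e′} Pe Pe′ e≢e′ f means≈0 = by-order (Fin.<-cmp e e′)
          where
          open import Relation.Binary.Definitions using (Tri)
          by-order : Tri (e <ᶠ e′) (e ≡ e′) (e′ <ᶠ e) → (1# + 1#) * cross e e′ f f ≤ᴷ θ e e′ * (energy-on e f + energy-on e′ f)
          by-order (tri< lt _ _) = increasing lt Pe Pe′ f (means≈0 Pe)
          by-order (tri≈ _ eq _) = contradiction eq e≢e′
          -- The bound from flag counts is for the smaller color first; the cross sum is symmetric,
          -- so the other order follows.
          by-order (tri> _ _ gt) = ≤-respˡ (*-congˡ (cross-sym e′ e f)) (≤-respʳ (*-cong (θ-sym e′ e) (+-comm _ _))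
            (increasing gt Pe′ Pe f (means≈0 Pe′)))

      others : ∀ {e} → Missing e →
               ∑ (allFin k) (λ e′ → 𝟙 (missing? e′) * 𝟙 (¬? (e′ Fin.≟ e))) ≈ fromℕ (k ∸ ∣ t ∣ ∸ 1)
      others {e} missing = begin
        S                                         ≈⟨ solve 2 (λ o s → s := o :+ s :- o) refl 1# S ⟩
        (1# + S) - 1#                             ≈⟨ +-congʳ total-count ⟩
        fromℕ (k ∸ ∣ t ∣) - 1#                    ≈⟨ minus-one codim≥2 ⟩
        fromℕ (k ∸ ∣ t ∣ ∸ 1)                     ∎
        where
        S : Carrier
        S = ∑ (allFin k) (λ e′ → 𝟙 (missing? e′) * 𝟙 (¬? (e′ Fin.≟ e)))
        minus-one : ∀ {n} → 2 ≤ n → fromℕ n - 1# ≈ fromℕ (n ∸ 1)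
        minus-one {suc n} _ = solve 2 (λ o s → o :+ s :- o := s) refl 1# (fromℕ n)
        either : ∀ {a} {A : Set a} (h : Dec A) p → 𝟙 h * p + p * 𝟙 (¬? h) ≈ p
        either (yes _) p = trans (+-cong (*-identityˡ p) (zeroʳ p)) (+-identityʳ p)
        either (no _)  p = trans (+-cong (zeroˡ p) (*-identityʳ p)) (+-identityˡ p)
        total-count : 1# + S ≈ fromℕ (k ∸ ∣ t ∣)
        total-count = begin
          1# + S
            ≈⟨ +-congʳ (trans (sym (𝟙-yes (missing? e) missing))
                 (sym (∑-unique (Fin._≟ e) (allFin⁺ k) (λ e′ → 𝟙 (missing? e′)) (∈-allFin e) ≡.refl (λ p → p)))) ⟩
          ∑ (allFin k) (λ e′ → 𝟙 (e′ Fin.≟ e) * 𝟙 (missing? e′)) + S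
            ≈⟨ ∑-+ (allFin k) _ _ ⟨
          ∑ (allFin k) (λ e′ → 𝟙 (e′ Fin.≟ e) * 𝟙 (missing? e′) + 𝟙 (missing? e′) * 𝟙 (¬? (e′ Fin.≟ e)))
            ≈⟨ ∑-cong (allFin k) (λ e′ → either (e′ Fin.≟ e) (𝟙 (missing? e′))) ⟩
          ∑ (allFin k) (λ e′ → 𝟙 (missing? e′))     ≈⟨ fromℕ-∑𝟙 missing? (allFin k) ⟨
          fromℕ missing-colors                      ≡⟨ ≡.cong fromℕ missing≡ ⟩
          fromℕ (k ∸ ∣ t ∣)                         ∎

      R : Carrier
      R = fromℕ 2 / (root - 1#)

      R>0 : Positive R
      R>0 = pos-* (pos-fromℕ 1) (pos-⁻¹ root-1>0)

      D : Carrier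
      D = fromℕ (k ∸ ∣ t ∣ ∸ 1)

      D≥1 : 1# ≤ᴷ D
      D≥1 = at-least-one codim≥2
        where
        at-least-one : ∀ {n} → 2 ≤ n → 1# ≤ᴷ fromℕ (n ∸ 1)
        at-least-one {suc (suc n)} _ = by-difference (fromℕ≥0 n) refl
        at-least-one {suc zero} (s≤s ())

      D>0 : Positive D
      D>0 = pos-≥ pos-1 D≥1

      link-bound : SecondLargestEigenvalue≤ graph (R / D)
      link-bound = WeightedPartiteBound.second-eigenvalue-bound K {color = color} {ν = ν} {G = graph} {P? = missing?}
        -- The exponent is the gap of the indices, not of the ranks: a weaker bound, but with
        -- geometric row sums whatever the ranks are.
        (weightedPartite missing? (WeightedGraph.Vertex? graph) (λ e e′ → ρ ^ gap e e′)
          (λ V@(T , top , v⊆T) → V , top-missing top (v⊆T (x∈⁅x⁆ _))) proj₁ (λ missing → missing) D>0 (proj₁ R>0)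
          (λ e e′ → ≈-reflexive (≡.cong (ρ ^_) (ℕ.∣-∣-comm (toℕ e) (toℕ e′))))
          (λ e e′ → proj₁ (pos-^ (gap e e′) ρ>0))
          (λ e<e′ → ρ^-antitone (StrictlyMonotone.distance rank rank-mono e<e′))
          (λ {e} _ → row e) others)
        where
        row : ∀ e → ∑ (allFin k) (λ e′ → 𝟙 (missing? e′) * (𝟙 (¬? (e′ Fin.≟ e)) * ρ ^ gap e′ e)) ≤ᴷ R
        -- Admitting the colors of t and adding the tail from `row-sum` both only enlarge the sum.
        row e = ≤-trans (∑-mono (allFin k) (λ e′ → drop (missing? e′) (𝟙≥0 (¬? (e′ Fin.≟ e)) *≥ proj₁ (pos-^ (gap e′ e) ρ>0))))
          (≤-trans (by-difference (proj₁ series>0 *≥ proj₁ (pos-^ (toℕ e) ρ>0)) refl) (≤-respʳ (sym 2series) (row-sum e)))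
          where
          drop : ∀ {a} {A : Set a} (h : Dec A) {x} → 0# ≤ᴷ x → 𝟙 h * x ≤ᴷ x
          drop (yes _) _   = ≤-reflexive (*-identityˡ _)
          drop (no _)  x≥0 = ≤-respˡ (sym (zeroˡ _)) x≥0

      link-bound′ : SecondLargestEigenvalue≤ graph (fromℕ 2 / (D * (root - 1#)))
      link-bound′ μ second = ≤-respʳ (*-cancel-≈ (proj₂ (pos-* D>0 root-1>0)) (begin
        D * (root - 1#) * (R / D)                          ≈⟨ solve 3 (λ d r x → d :* r :* x := r :* (d :* x)) refl D (root - 1#) (R / D) ⟩
        (root - 1#) * (D * (R / D))                        ≈⟨ *-congˡ (*/ (proj₂ D>0) R) ⟩
        (root - 1#) * R                                    ≈⟨ */ (proj₂ root-1>0) (fromℕ 2) ⟩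
        fromℕ 2                                            ≈⟨ */ (proj₂ (pos-* D>0 root-1>0)) (fromℕ 2) ⟨
        D * (root - 1#) * (fromℕ 2 / (D * (root - 1#)))    ∎)) (link-bound μ second)

      local-bound : SecondLargestEigenvalue≤ graph R
      local-bound μ second = ≤-trans (link-bound μ second) (*-cancel-≤ D>0 (≤-respˡ (sym (*/ (proj₂ D>0) R))
        (≤-respˡ (*-identityˡ R) (*-mono-≤ 1≥0 (proj₁ R>0) D≥1 ≤-refl))))

      -- With two colors each has a single other one, so D = 1 and R = ρ; distinct ranks differ by
      -- at least 1, so ρ dominates the required power.
      product-bound : ∀ i j → i ≢ j → Missing i → Missing j →
        SecondLargestEigenvalue≤ (inducedSubgraph graph (λ v → color v Fin.≟ i ⊎-dec color v Fin.≟ j)) ρ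
      product-bound i j i≢j missing-i missing-j μ second = ≤-respʳ ρ/1 (WeightedPartiteBound.second-eigenvalue-bound K
          {color = color} {ν = ν} {G = inducedSubgraph graph (λ v → color v Fin.≟ i ⊎-dec color v Fin.≟ j)} {P? = P?}
        (weightedPartite P? (WeightedGraph.Vertex? (inducedSubgraph graph (λ v → color v Fin.≟ i ⊎-dec color v Fin.≟ j))) (λ _ _ → ρ)
          (λ V → V) (λ V → V) P⇒missing pos-1 (proj₁ ρ>0)
          (λ _ _ → refl) (λ _ _ → proj₁ ρ>0)
          (λ {e} {e′} e<e′ → ≤-respʳ (*-identityʳ ρ) (ρ^-antitone {1} (ℕ.m<n⇒0<n∸m (rank-mono e<e′))))
          (λ {e} Pe → ≤-reflexive (row Pe)) degree) μ second)
        where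
        P : Fin k → Set
        P e = e ≡ i ⊎ e ≡ j
        P? : ∀ e → Dec (P e)
        P? e = e Fin.≟ i ⊎-dec e Fin.≟ j
        ρ/1 : ρ / 1# ≈ ρ
        ρ/1 = trans (sym (*-identityˡ _)) (*/ 1≉0 ρ)
        P⇒missing : ∀ {e} → P e → Missing e
        P⇒missing (inj₁ ≡.refl) = missing-i
        P⇒missing (inj₂ ≡.refl) = missing-j
        other : ∀ {e} → P e → ∃ λ e° → P e° × e° ≢ e × (∀ {e′} → P e′ × e′ ≢ e → e′ ≡ e°)
        other (inj₁ ≡.refl) = j , inj₂ ≡.refl , (λ j≡i → i≢j (≡.sym j≡i)) ,
          λ { (inj₁ eq , ne) → contradiction eq ne ; (inj₂ eq , _) → eq }
        other (inj₂ ≡.refl) = i , inj₁ ≡.refl , i≢j ,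
          λ { (inj₁ eq , _) → eq ; (inj₂ eq , ne) → contradiction eq ne }
        degree : ∀ {e} → P e → ∑ (allFin k) (λ e′ → 𝟙 (P? e′) * 𝟙 (¬? (e′ Fin.≟ e))) ≈ 1#
        degree {e} Pe with other Pe
        ... | e° , Pe° , e°≢e , only = trans (∑-cong (allFin k) (λ e′ → sym (𝟙-× (P? e′) (¬? (e′ Fin.≟ e)))))
          (∑-unique-1 (λ e′ → P? e′ ×-dec ¬? (e′ Fin.≟ e)) (allFin⁺ k) (∈-allFin e°) (Pe° , e°≢e) only)
        row : ∀ {e} → P e → ∑ (allFin k) (λ e′ → 𝟙 (P? e′) * (𝟙 (¬? (e′ Fin.≟ e)) * ρ)) ≈ ρ
        row Pe = trans (∑-cong (allFin k) (λ e′ → sym (*-assoc _ _ _)))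
          (trans (sym (∑-* (allFin k) _ ρ)) (trans (*-congʳ (degree Pe)) (*-identityˡ ρ)))

-- The three bounds for the projected flags complex.

open import Data.Fin.Base using (Fin) renaming (_<_ to _<ᶠ_)
open import Data.Fin.Subset using (∣_∣)
open import Data.Nat.Base using (ℕ; suc; _≤_; _<_; _∸_; _^_)
open import Data.Nat.Primality using (Prime)
open import Data.Product.Base using (_×_; _,_; proj₁; proj₂)
open import Relation.Binary.PropositionalEquality.Core using (_≡_)

theorem1p3 :
    (d : ℕ) → 3 ≤ d →
    (q p e : ℕ) → Prime p → q ≡ p ^ suc e →
    (F : FiniteField q) →
    (k : ℕ) → 2 ≤ k →
    (s : Fin k → ℕ) →
    (∀ {i j} → i <ᶠ j → s i < s j) →
    (∀ i → 1 ≤ s i × s i < d) →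
    ∀ {c ℓ₁ ℓ₂} (K : RealClosedField c ℓ₁ ℓ₂) →
    let open RealClosedField K hiding (_≤_)
        open Spectral K
        open ProjectedFlags F d s using (projectedFlags)
        open PartiteComplex projectedFlags using (Face)
    in
    (∀ t → Face t → 2 ≤ k ∸ ∣ t ∣ →
       SecondLargestEigenvalue≤ (linkGraph projectedFlags t)
         (fromℕ 2 / (fromℕ (k ∸ ∣ t ∣ ∸ 1) * (√ (fromℕ q) - 1#))))
    × IsLocalSpectralExpander projectedFlags (fromℕ 2 / (√ (fromℕ q) - 1#))
    × IsProduct projectedFlags (1# / √ (fromℕ q))
theorem1p3 d _ q _ _ _ _ F k _ s s-mono s-bounds K =
  (λ t face codim≥2 → S.FaceLink.link-bound′ t face codim≥2) ,
  (λ t face codim≥2 → S.FaceLink.local-bound t face codim≥2) ,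
  (λ τ face codim≥2 i j i≢j other-colors → S.FaceLink.product-bound τ face codim≥2 i j i≢j
     (λ (v , v∈ , v-color) → proj₁ (other-colors v v∈) v-color)
     (λ (v , v∈ , v-color) → proj₂ (other-colors v v∈) v-color))
  where
  open ProjectedFlagComplex F d s s-mono (λ i → proj₂ (s-bounds i)) using (flagComplex)
  module S = LinkSpectrum K (SubspaceGeometry.L.1<q F d) flagComplex
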